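{- Let $\mathsf{N}_n$ be a uniformly random simplex tree-child network with $n$ taxa. On the event that $\mathsf{N}_n$ has at least one reticulation vertex, let $r_n$ be chosen uniformly at random among the reticulation vertices of $\mathsf{N}_n$ (on the complementary event $r_n$ is an arbitrary vertex). There exists a deterministic infinite rooted network $(\hat{\mathcal{R}},\rho_0)$, namely the one constructed in the context, such that $(\mathsf{N}_n,r_n)\xrightarrow{d}(\hat{\mathcal{R}},\rho_0)$ in the local weak sense as $n\to\infty$.
   Context: A simplex tree-child network on a finite set $X$ is a finite directed acyclic graph $N=(V,E)$ with a root $o$ and with leaves bijectively labelled by $X$, such that: the root has (indegree, outdegree) $=(0,1)$; every vertex is reachable from $o$ by a directed path; every leaf has degree $(1,0)$; every vertex that is neither the root nor a leaf is either a tree vertex, of degree $(1,2)$, or a reticulation vertex, of degree $(2,1)$; (tree-child) every non-leaf vertex has at least one child that is a tree vertex or a leaf; (one-component) the unique child of every reticulation vertex is a leaf. Networks are considered up to isomorphism preserving leaf labels. $\mathsf{N}_n$ is uniform on the finite set of simplex tree-child networks with leaf label set $[n]$. Local neighbourhoods: for a directed graph $N$ and $v\in V(N)$, $U_R(N,v)$ is the subgraph induced by the vertices at undirected graph distance at most $R$ from $v$, rooted at $v$. Each vertex carries a mark giving its type in $N$ (root, tree vertex, reticulation, or leaf); leaf labels are ignored. $\cong$ denotes isomorphism of rooted directed marked graphs, i.e. a bijection of vertex sets preserving root, marks, edges and edge orientations. Local weak convergence $(N_n,v_n)\xrightarrow{d}(N,v)$ means $\mathbb{P}(U_R(N_n,v_n)\cong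 G)\to\mathbb{P}(U_R(N,v)\cong G)$ for every fixed $R\ge0$ and every finite rooted directed marked graph $G$; for deterministic $(N,v)$ this is $\mathbb{P}(U_R(N_n,v_n)\cong U_R(N,v))\to1$ for every $R\ge0$. Construction. A bi-infinite spine is a bi-infinite directed path $\cdots\to x_{ -1}\to x_0\to x_1\to\cdots$ of tree vertices. To decorate a tree vertex $x$ means: give $x$ a new reticulation child $\rho(x)$; give $\rho(x)$ a new leaf child $\ell(x)$; and give $\rho(x)$ a second parent $w(x)$, which is a tree vertex on a new bi-infinite spine, all of whose vertices other than $w(x)$ are in turn decorated, recursively (the reticulation child of $w(x)$ is $\rho(x)$). All spines and vertices introduced at every level are pairwise distinct. The reticulation limit $\hat{\mathcal{R}}$ has two disjoint bi-infinite spines $\cdots\to p_{ -1}\to p_0\to p_1\to\cdots$ and $\cdots\to q_{ -1}\to q_0\to q_1\to\cdots$, and a reticulation $\rho_0$ whose two parents are $p_0$ and $q_0$ and whose only child is a leaf $\ell_0$; every spine vertex $p_i,q_i$ with $i\ne0$ is decorated, while $p_0,q_0$ have $\rho_0$ as their only reticulation child. It is rooted at $\rho_0$. -}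

module Defs where

import Algebra.Properties.Semiring.Sum as SemiringSum
open import Data.Bool.Base using (Bool; true; false; T; if_then_else_)
open import Data.Bool.Properties as Bool using (T?)
open import Data.Fin.Base as Fin using (Fin; zero; suc)
import Data.Fin.Properties as Fin
open import Data.Fin.Subset using (∣_∣)
open import Data.Integer.Base as ℤ using (ℤ; 0ℤ; +_; +0; +[1+_]; -[1+_])
import Data.Integer.Properties as ℤ
open import Data.Irrelevant using ([_])
open import Data.List.Base as List using (List; []; _∷_; _++_; allFin; filter; concatMap; cartesianProduct; cartesianProductWith; deduplicate; length; lookup; upTo)
open import Data.List.Membership.Propositional using (_∈_)
open import Data.List.Membership.Propositional.Properties
  using (∈-allFin; ∈-++⁺ˡ; ∈-++⁺ʳ; ∈-concat⁺′; ∈-map⁺; ∈-upTo⁺)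
import Data.List.Membership.DecPropositional as DecMembership
open import Data.List.Relation.Unary.All as All using (All; []; _∷_)
open import Data.List.Relation.Unary.Any as Any using (Any; here; there)
import Data.List.Relation.Unary.Any.Properties as Any
import Data.List.Relation.Unary.Enumerates.Setoid as Enumerates
import Data.List.Relation.Unary.Enumerates.Setoid.Properties as EnumeratesP
import Data.List.Relation.Unary.Unique.Setoid as Unique
import Data.List.Relation.Unary.Unique.DecSetoid.Properties as UniqueP
open import Data.Nat.Base as ℕ using (ℕ; zero; suc; z≤n; s≤s)
import Data.Nat.Properties as ℕ
open import Data.Product.Base using (Σ; ∃-syntax; _×_; _,_; proj₁; proj₂; uncurry)
import Data.Product.Properties as Product
open import Data.Rational.Base as ℚ using (ℚ; 0ℚ; 1ℚ; _/_)
open import Data.Refinement using (Refinement-syntax; _,_; value)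
import Data.Refinement.Properties as Refinement
open import Data.Sum.Base as Sum using (_⊎_; inj₁; inj₂; [_,_]′)
open import Data.Vec.Base using (tabulate)
open import Data.Vec.Properties using (tabulate-cong)
open import Function.Base using (_∘_)
open import Function.Bundles using (_↔_; _⇔_; _↣_; mk↣; mk⇔; mk↔ₛ′; Inverse; Equivalence)
import Function.Construct.Composition as Composition
import Function.Construct.Identity as Identity
import Function.Construct.Symmetry as Symmetry
open import Level using (0ℓ)
open import Relation.Binary.Bundles using (Setoid; DecSetoid)
open import Relation.Binary.Core using (Rel)
open import Relation.Binary.Construct.Closure.ReflexiveTransitive as Star using (Star; ε; _◅_)
open import Relation.Binary.Construct.Closure.Symmetric using (SymClosure; fwd; bwd)
open import Relation.Binary.Construct.Closure.Transitive using (TransClosure; [_]; _∷_)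
  renaming (_++_ to _++⁺_)
open import Relation.Binary.Definitions using (Decidable; DecidableEquality)
open import Relation.Binary.PropositionalEquality
  using (_≡_; _≢_; _≗_; refl; sym; trans; cong; cong₂; subst; subst₂; module ≡-Reasoning)
open import Relation.Nullary using (¬_; Dec; yes; no; ¬?; contradiction)
open import Relation.Nullary.Decidable using (does; map′; _×-dec_; _⊎-dec_; _→-dec_; recompute)

data VertexType : Set where
  root tree reticulation leaf : VertexType

record MarkedDigraph : Set₁ where
  field
    Vertex : Set
    _⟶_    : Rel Vertex 0ℓ
    mark   : Vertex → VertexType

record RootedDigraph : Set₁ where
  field
    graph : MarkedDigraph
    base  : MarkedDigraph.Vertex graph
  open MarkedDigraph graph public

-- Within G R v w : there is an undirected walk from v to w of length at
-- most R, i.e. the undirected graph distance of v and w is at most R.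
data Within (G : MarkedDigraph) : ℕ → Rel (MarkedDigraph.Vertex G) 0ℓ where
  here : ∀ {R v} → Within G R v v
  step : ∀ {R u v w} → SymClosure (MarkedDigraph._⟶_ G) u v →
         Within G R v w → Within G (suc R) u w

-- The subgraph induced by the vertices at distance at most R from v.  The
-- proof that a vertex belongs to it is irrelevant, so that equality of
-- its vertices is equality in G.
U : ℕ → (G : MarkedDigraph) → MarkedDigraph.Vertex G → RootedDigraph
U R G v = record
  { graph = record
      { Vertex = [ w ∈ Vertex ∣ Within G R v w ]
      ; _⟶_    = λ a b → value a ⟶ value b
      ; mark   = λ a → mark (value a)
      }
  ; base  = v , [ here ]
  }
  where open MarkedDigraph G

infix 4 _≅_

record _≅_ (G H : RootedDigraph) : Set where
  private
    module G = RootedDigraph G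
    module H = RootedDigraph H
  field
    bijection : G.Vertex ↔ H.Vertex
  open Inverse bijection public using (to; from)
  field
    to-base : to G.base ≡ H.base
    to-mark : ∀ v → H.mark (to v) ≡ G.mark v
    to-edge : ∀ u v → (u G.⟶ v) ⇔ (to u H.⟶ to v)

-- Every finite rooted marked digraph is isomorphic to one on some Fin size.
record FiniteRootedDigraph : Set where
  field
    size : ℕ
    edge : Fin size → Fin size → Bool
    mark : Fin size → VertexType
    base : Fin size

  rootedDigraph : RootedDigraph
  rootedDigraph = record
    { graph = record
        { Vertex = Fin size
        ; _⟶_    = λ u v → T (edge u v)
        ; mark   = mark
        }
    ; base  = base
    }

-- Since the edges form a binary relation, there are no parallel edges.
record LabelledDigraph (n size : ℕ) : Set where
  field
    edge   : Fin size → Fin size → Bool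
    origin : Fin size
    mark   : Fin size → VertexType
    taxon  : Fin n → Fin size

  infix 4 _⟶_
  _⟶_ : Rel (Fin size) 0ℓ
  u ⟶ v = T (edge u v)

  indegree outdegree : Fin size → ℕ
  indegree  v = ∣ tabulate (λ u → edge u v) ∣
  outdegree v = ∣ tabulate (λ w → edge v w) ∣

degrees : VertexType → ℕ × ℕ
degrees root         = 0 , 1
degrees tree         = 1 , 2
degrees reticulation = 2 , 1
degrees leaf         = 1 , 0

-- By the field `typed` the marks are determined by the edges.
record IsSimplexTreeChild {n size : ℕ} (G : LabelledDigraph n size) : Set where
  open LabelledDigraph G
  field
    typed            : ∀ v → (indegree v , outdegree v) ≡ degrees (mark v)
    origin-root      : mark origin ≡ root
    root-unique      : ∀ v → mark v ≡ root → v ≡ origin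
    acyclic          : ∀ v → ¬ TransClosure _⟶_ v v
    reachable        : ∀ v → Star _⟶_ origin v
    taxon-leaf       : ∀ i → mark (taxon i) ≡ leaf
    taxon-injective  : ∀ i j → taxon i ≡ taxon j → i ≡ j
    taxon-surjective : ∀ v → mark v ≡ leaf → ∃[ i ] taxon i ≡ v
    tree-child       : ∀ v → mark v ≢ leaf →
                       ∃[ w ] v ⟶ w × (mark w ≡ tree ⊎ mark w ≡ leaf)
    one-component    : ∀ v w → mark v ≡ reticulation → v ⟶ w → mark w ≡ leaf

record Network (n : ℕ) : Set where
  field
    size               : ℕ
    labelledDigraph    : LabelledDigraph n size
    isSimplexTreeChild : IsSimplexTreeChild labelledDigraph
  open LabelledDigraph labelledDigraph public
  open IsSimplexTreeChild isSimplexTreeChild public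

  markedDigraph : MarkedDigraph
  markedDigraph = record { Vertex = Fin size ; _⟶_ = _⟶_ ; mark = mark }

infix 4 _≅ₗ_

record _≅ₗ_ {n : ℕ} (M N : Network n) : Set where
  private
    module M = Network M
    module N = Network N
  field
    bijection : Fin M.size ↔ Fin N.size
  open Inverse bijection public using (to; from; strictlyInverseˡ; strictlyInverseʳ)
  field
    to-edge  : ∀ u v → N.edge (to u) (to v) ≡ M.edge u v
    to-taxon : ∀ i → to (M.taxon i) ≡ N.taxon i

≅ₗ-refl : ∀ {n} {N : Network n} → N ≅ₗ N
≅ₗ-refl = record
  { bijection = Identity.↔-id _ ; to-edge = λ _ _ → refl ; to-taxon = λ _ → refl }

≅ₗ-sym : ∀ {n} {M N : Network n} → M ≅ₗ N → N ≅ₗ M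
≅ₗ-sym {N = N} f = record
  { bijection = Symmetry.↔-sym bijection
  ; to-edge   = λ u v → trans (sym (to-edge (from u) (from v)))
      (cong₂ (Network.edge N) (strictlyInverseˡ u) (strictlyInverseˡ v))
  ; to-taxon  = λ i → trans (cong from (sym (to-taxon i))) (strictlyInverseʳ _)
  }
  where open _≅ₗ_ f

≅ₗ-trans : ∀ {n} {L M N : Network n} → L ≅ₗ M → M ≅ₗ N → L ≅ₗ N
≅ₗ-trans f g = record
  { bijection = g.bijection Composition.↔-∘ f.bijection
  ; to-edge   = λ u v → trans (g.to-edge (f.to u) (f.to v)) (f.to-edge u v)
  ; to-taxon  = λ i → trans (cong g.to (f.to-taxon i)) (g.to-taxon i)
  }
  where
  module f = _≅ₗ_ f
  module g = _≅ₗ_ g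

≅ₗ-setoid : ℕ → Setoid 0ℓ 0ℓ
≅ₗ-setoid n = record
  { Carrier       = Network n
  ; _≈_           = _≅ₗ_
  ; isEquivalence = record { refl = ≅ₗ-refl ; sym = ≅ₗ-sym ; trans = ≅ₗ-trans }
  }

-- The finite set of networks up to isomorphism, given by a list containing
-- exactly one representative of each isomorphism class.  `networks` below
-- shows that there is such a list for each n.
record NetworkList (n : ℕ) : Set where
  open Enumerates (≅ₗ-setoid n) using (IsEnumeration)
  open Unique (≅ₗ-setoid n) using (Unique)
  field
    list     : List (Network n)
    complete : IsEnumeration list
    unique   : Unique list

-- `new s i` is the spine introduced by decorating the vertex of index i on
-- the spine s; its vertex of index 0 plays the role of w.
data Spine : Set where
  𝕡 𝕢 : Spine
  new : Spine → (i : ℤ) → .{{ℤ.NonZero i}} → Spine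

-- `node s i` is the vertex of index i on the spine s; `ρ s i` and `ℓ s i`
-- are the reticulation and the leaf introduced by decorating it.
data LimitVertex : Set where
  ρ₀ ℓ₀ : LimitVertex
  node  : Spine → ℤ → LimitVertex
  ρ ℓ   : Spine → (i : ℤ) → .{{ℤ.NonZero i}} → LimitVertex

data _⟶̂_ : Rel LimitVertex 0ℓ where
  spine  : ∀ s i → node s i ⟶̂ node s (ℤ.suc i)
  p₀⟶ρ₀ : node 𝕡 0ℤ ⟶̂ ρ₀
  q₀⟶ρ₀ : node 𝕢 0ℤ ⟶̂ ρ₀
  ρ₀⟶ℓ₀ : ρ₀ ⟶̂ ℓ₀
  x⟶ρ   : ∀ s i .{{_ : ℤ.NonZero i}} → node s i ⟶̂ ρ s i
  w⟶ρ   : ∀ s i .{{_ : ℤ.NonZero i}} → node (new s i) 0ℤ ⟶̂ ρ s i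
  ρ⟶ℓ   : ∀ s i .{{_ : ℤ.NonZero i}} → ρ s i ⟶̂ ℓ s i

limitMark : LimitVertex → VertexType
limitMark ρ₀         = reticulation
limitMark ℓ₀         = leaf
limitMark (node _ _) = tree
limitMark (ρ _ _)    = reticulation
limitMark (ℓ _ _)    = leaf

R̂ : MarkedDigraph
R̂ = record { Vertex = LimitVertex ; _⟶_ = _⟶̂_ ; mark = limitMark }

R̂-infinite : ℕ ↣ LimitVertex
R̂-infinite = mk↣ {to = λ k → node 𝕡 (+ k)} λ { refl → refl }

Listing : Set → Set
Listing A = Σ (List A) λ xs → ∀ a → a ∈ xs

listingFin : ∀ n → Listing (Fin n)
listingFin n = allFin n , ∈-allFin

∀? : ∀ {A : Set} {P : A → Set} → Listing A → (∀ a → Dec (P a)) → Dec (∀ a → P a)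
∀? (xs , ∈xs) P? = map′ (λ ps a → All.lookup ps (∈xs a)) (λ f → All.universal f xs) (All.all? P? xs)

-- All functions Fin m → A with values in a list, up to pointwise equality.
functions : ∀ {A : Set} m → List A → List (Fin m → A)
functions zero    xs = (λ ()) ∷ []
functions (suc m) xs = cartesianProductWith cons xs (functions m xs)
  where
  cons : ∀ {A : Set} {m} → A → (Fin m → A) → Fin (suc m) → A
  cons a f zero    = a
  cons a f (suc i) = f i

functions-complete : ∀ {A : Set} (_~_ : A → A → Set) {xs : List A} m (f : Fin m → A) →
                     (∀ i → Any (f i ~_) xs) → Any (λ g → ∀ i → f i ~ g i) (functions m xs)
functions-complete _~_ zero    f f∈ = here λ ()
functions-complete _~_ (suc m) f f∈ =
  Any.cartesianProductWith⁺ _ (λ { r rs zero → r ; r rs (suc i) → rs i })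
    (f∈ zero) (functions-complete _~_ m (f ∘ suc) (f∈ ∘ suc))

bijection? : ∀ {A B : Set} → Listing A → Listing B →
             DecidableEquality A → DecidableEquality B →
             (Q : (A → B) → Set) → (∀ {f g} → f ≗ g → Q f → Q g) → (∀ f → Dec (Q f)) →
             Dec (Σ (A ↔ B) (Q ∘ Inverse.to))
bijection? {A} {B} LA@(xs , ∈xs) LB@(ys , ∈ys) _≟A_ _≟B_ Q Q-resp Q? =
  map′ sound complete (Any.any? (λ f → Any.any? (candidate? f) gs) fs)
  where
  fs : List (A → B)
  fs = List.map (_∘ (Any.index ∘ ∈xs)) (functions (length xs) ys)

  gs : List (B → A)
  gs = List.map (_∘ (Any.index ∘ ∈ys)) (functions (length ys) xs)

  listed : ∀ {A B : Set} (xs : List A) (∈xs : ∀ a → a ∈ xs) (ys : List B) (∈ys : ∀ b → b ∈ ys)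
           (h : A → B) → Any (h ≗_) (List.map (_∘ (Any.index ∘ ∈xs)) (functions (length xs) ys))
  listed xs ∈xs ys ∈ys h = Any.map⁺ (Any.map
    (λ eq a → trans (cong h (Any.lookup-index (∈xs a))) (eq (Any.index (∈xs a))))
    (functions-complete _≡_ (length xs) (h ∘ lookup xs) (∈ys ∘ h ∘ lookup xs)))

  Candidate : (A → B) → (B → A) → Set
  Candidate f g = (∀ b → f (g b) ≡ b) × (∀ a → g (f a) ≡ a) × Q f

  candidate? : ∀ f g → Dec (Candidate f g)
  candidate? f g = ∀? LB (λ b → f (g b) ≟B b) ×-dec ∀? LA (λ a → g (f a) ≟A a) ×-dec Q? f

  sound : Any (λ f → Any (Candidate f) gs) fs → Σ (A ↔ B) (Q ∘ Inverse.to)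
  sound any =
    let f , any′ = Any.satisfied any
        g , fg , gf , Qf = Any.satisfied any′
    in mk↔ₛ′ f g fg gf , Qf

  complete : Σ (A ↔ B) (Q ∘ Inverse.to) → Any (λ f → Any (Candidate f) gs) fs
  complete (h , Qh) = Any.map
    (λ {f} f≗ → Any.map
      (λ {g} g≗ →
          (λ b → trans (sym (f≗ (g b))) (trans (cong to (sym (g≗ b))) (strictlyInverseˡ b)))
        , (λ a → trans (sym (g≗ (f a))) (trans (cong from (sym (f≗ a))) (strictlyInverseʳ a)))
        , Q-resp f≗ Qh)
      (listed ys ∈ys xs ∈xs from))
    (listed xs ∈xs ys ∈ys to)
    where open Inverse h

_≟ᵗ_ : DecidableEquality VertexType
root         ≟ᵗ root         = yes refl
root         ≟ᵗ tree         = no λ ()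
root         ≟ᵗ reticulation = no λ ()
root         ≟ᵗ leaf         = no λ ()
tree         ≟ᵗ root         = no λ ()
tree         ≟ᵗ tree         = yes refl
tree         ≟ᵗ reticulation = no λ ()
tree         ≟ᵗ leaf         = no λ ()
reticulation ≟ᵗ root         = no λ ()
reticulation ≟ᵗ tree         = no λ ()
reticulation ≟ᵗ reticulation = yes refl
reticulation ≟ᵗ leaf         = no λ ()
leaf         ≟ᵗ root         = no λ ()
leaf         ≟ᵗ tree         = no λ ()
leaf         ≟ᵗ reticulation = no λ ()
leaf         ≟ᵗ leaf         = yes refl

record Finite (G : RootedDigraph) : Set where
  open RootedDigraph G
  field
    listing : Listing Vertex
    _≟_     : DecidableEquality Vertex
    _⟶?_    : Decidable _⟶_

≅-dec : ∀ {G H} → Finite G → Finite H → Dec (G ≅ H)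
≅-dec {G} {H} FG FH = map′
  (λ (b , tb , tm , te) → record { bijection = b ; to-base = tb ; to-mark = tm ; to-edge = te })
  (λ i → let open _≅_ i in bijection , to-base , to-mark , to-edge)
  (bijection? FG.listing FH.listing FG._≟_ FH._≟_ Preserves preserves-resp preserves?)
  where
  module G  = RootedDigraph G
  module H  = RootedDigraph H
  module FG = Finite FG
  module FH = Finite FH

  Preserves : (G.Vertex → H.Vertex) → Set
  Preserves f = f G.base ≡ H.base × (∀ v → H.mark (f v) ≡ G.mark v)
              × (∀ u v → (u G.⟶ v) ⇔ (f u H.⟶ f v))

  preserves-resp : ∀ {f g} → f ≗ g → Preserves f → Preserves g
  preserves-resp f≗g (b , m , e) =
      trans (sym (f≗g _)) b
    , (λ v → trans (cong H.mark (sym (f≗g v))) (m v))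
    , (λ u v → mk⇔ (subst₂ H._⟶_ (f≗g u) (f≗g v) ∘ Equivalence.to (e u v))
                   (Equivalence.from (e u v) ∘ subst₂ H._⟶_ (sym (f≗g u)) (sym (f≗g v))))

  preserves? : ∀ f → Dec (Preserves f)
  preserves? f = (f G.base FH.≟ H.base)
    ×-dec ∀? FG.listing (λ v → H.mark (f v) ≟ᵗ G.mark v)
    ×-dec ∀? FG.listing λ u → ∀? FG.listing λ v →
            map′ (uncurry mk⇔) (λ e → Equivalence.to e , Equivalence.from e)
              (((u FG.⟶? v) →-dec (f u FH.⟶? f v)) ×-dec ((f u FH.⟶? f v) →-dec (u FG.⟶? v)))

record LocallyFinite (G : MarkedDigraph) : Set where
  open MarkedDigraph G
  field
    _≟_                 : DecidableEquality Vertex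
    _⟶?_                : Decidable _⟶_
    neighbours          : Vertex → List Vertex
    neighbours-complete : ∀ {u v} → SymClosure _⟶_ u v → v ∈ neighbours u

U-finite : ∀ {G} → LocallyFinite G → ∀ R v → Finite (U R G v)
U-finite {G} lf R v = record
  { listing = listing
  ; _≟_     = Refinement._≟_ _≟_
  ; _⟶?_    = λ a b → value a ⟶? value b
  }
  where
  open MarkedDigraph G
  open LocallyFinite lf
  open DecMembership _≟_ using (_∈?_)

  adjacent? : Decidable (SymClosure _⟶_)
  adjacent? u w = map′ [ fwd , bwd ]′ (λ { (fwd e) → inj₁ e ; (bwd e) → inj₂ e })
    ((u ⟶? w) ⊎-dec (w ⟶? u))

  ball : ℕ → Vertex → List Vertex
  ball zero    u = u ∷ []
  ball (suc k) u = u ∷ concatMap (ball k) (neighbours u)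

  ∈-ball : ∀ {k u w} → Within G k u w → w ∈ ball k u
  ∈-ball {zero}  here       = here refl
  ∈-ball {suc k} here       = here refl
  ∈-ball         (step e p) = there (∈-concat⁺′ (∈-ball p) (∈-map⁺ _ (neighbours-complete e)))

  within? : ∀ k → Decidable (Within G k)
  within? zero u w = map′ (λ { refl → here }) (λ { here → refl }) (u ≟ w)
  within? (suc k) u w = map′
    [ (λ { refl → here }) , join ]′
    (λ { here       → inj₁ refl
       ; (step e p) → inj₂ (Any.map (λ { refl → e , p }) (neighbours-complete e)) })
    ((u ≟ w) ⊎-dec Any.any? (λ x → adjacent? u x ×-dec within? k x w) (neighbours u))
    where
    join : ∀ {xs} → Any (λ x → SymClosure _⟶_ u x × Within G k x w) xs → Within G (suc k) u w
    join (here (e , p)) = step e p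
    join (there i)      = join i

  select : List Vertex → List [ w ∈ Vertex ∣ Within G R v w ]
  select [] = []
  select (w ∷ ws) with within? R v w
  ... | yes p = (w , [ p ]) ∷ select ws
  ... | no  _ = select ws

  ∈-select : ∀ {w ws} .(p : Within G R v w) → w ∈ ws → (w , [ p ]) ∈ select ws
  ∈-select {w} {x ∷ ws} p w∈ with within? R v x
  ∈-select p (here refl)  | yes _ = here refl
  ∈-select p (there w∈)   | yes _ = there (∈-select p w∈)
  ∈-select p (here refl)  | no ¬p = contradiction (recompute (within? R v _) p) ¬p
  ∈-select p (there w∈)   | no _  = ∈-select p w∈

  listing : Listing [ w ∈ Vertex ∣ Within G R v w ]
  listing = select (ball R v) , λ { (w , [ p ]) →
    ∈-select p (recompute (w ∈? ball R v) (∈-ball p)) }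

finite : (G : FiniteRootedDigraph) → Finite (FiniteRootedDigraph.rootedDigraph G)
finite G = record
  { listing = listingFin _ ; _≟_ = Fin._≟_ ; _⟶?_ = λ u v → T? (FiniteRootedDigraph.edge G u v) }

network-locallyFinite : ∀ {n} (N : Network n) → LocallyFinite (Network.markedDigraph N)
network-locallyFinite N = record
  { _≟_                 = Fin._≟_
  ; _⟶?_                = λ u v → T? (Network.edge N u v)
  ; neighbours          = λ _ → allFin _
  ; neighbours-complete = λ _ → ∈-allFin _
  }

R̂-locallyFinite : LocallyFinite R̂
R̂-locallyFinite = record
  { _≟_                 = _≟_
  ; _⟶?_                = λ u v → map′ (All.lookup (children-sound u)) children-complete
                                        (v ∈? children u)
  ; neighbours          = λ u → children u ++ parents u
  ; neighbours-complete = λ { {u} (fwd e) → ∈-++⁺ˡ (children-complete e)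
                            ; {u} (bwd e) → ∈-++⁺ʳ (children u) (parents-complete e) }
  }
  where
  _≟ˢ_ : DecidableEquality Spine
  𝕡       ≟ˢ 𝕡       = yes refl
  𝕡       ≟ˢ 𝕢       = no λ ()
  𝕡       ≟ˢ new _ _ = no λ ()
  𝕢       ≟ˢ 𝕡       = no λ ()
  𝕢       ≟ˢ 𝕢       = yes refl
  𝕢       ≟ˢ new _ _ = no λ ()
  new _ _ ≟ˢ 𝕡       = no λ ()
  new _ _ ≟ˢ 𝕢       = no λ ()
  new s i ≟ˢ new t j = map′ (λ { (refl , refl) → refl }) (λ { refl → refl , refl })
    ((s ≟ˢ t) ×-dec (i ℤ.≟ j))

  _≟_ : DecidableEquality LimitVertex
  ρ₀       ≟ ρ₀       = yes refl
  ρ₀       ≟ ℓ₀       = no λ ()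
  ρ₀       ≟ node _ _ = no λ ()
  ρ₀       ≟ ρ _ _    = no λ ()
  ρ₀       ≟ ℓ _ _    = no λ ()
  ℓ₀       ≟ ρ₀       = no λ ()
  ℓ₀       ≟ ℓ₀       = yes refl
  ℓ₀       ≟ node _ _ = no λ ()
  ℓ₀       ≟ ρ _ _    = no λ ()
  ℓ₀       ≟ ℓ _ _    = no λ ()
  node _ _ ≟ ρ₀       = no λ ()
  node _ _ ≟ ℓ₀       = no λ ()
  node s i ≟ node t j = map′ (λ { (refl , refl) → refl }) (λ { refl → refl , refl })
    ((s ≟ˢ t) ×-dec (i ℤ.≟ j))
  node _ _ ≟ ρ _ _    = no λ ()
  node _ _ ≟ ℓ _ _    = no λ ()
  ρ _ _    ≟ ρ₀       = no λ ()
  ρ _ _    ≟ ℓ₀       = no λ ()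
  ρ _ _    ≟ node _ _ = no λ ()
  ρ s i    ≟ ρ t j    = map′ (λ { (refl , refl) → refl }) (λ { refl → refl , refl })
    ((s ≟ˢ t) ×-dec (i ℤ.≟ j))
  ρ _ _    ≟ ℓ _ _    = no λ ()
  ℓ _ _    ≟ ρ₀       = no λ ()
  ℓ _ _    ≟ ℓ₀       = no λ ()
  ℓ _ _    ≟ node _ _ = no λ ()
  ℓ _ _    ≟ ρ _ _    = no λ ()
  ℓ s i    ≟ ℓ t j    = map′ (λ { (refl , refl) → refl }) (λ { refl → refl , refl })
    ((s ≟ˢ t) ×-dec (i ℤ.≟ j))

  open DecMembership _≟_ using (_∈?_)

  reticulationChild : ℤ → Spine → LimitVertex
  reticulationChild +0       𝕡         = ρ₀
  reticulationChild +0       𝕢         = ρ₀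
  reticulationChild +0       (new s i) = ρ s i
  reticulationChild +[1+ k ] s         = ρ s +[1+ k ]
  reticulationChild -[1+ k ] s         = ρ s -[1+ k ]

  reticulationChild-edge : ∀ i s → node s i ⟶̂ reticulationChild i s
  reticulationChild-edge +0       𝕡         = p₀⟶ρ₀
  reticulationChild-edge +0       𝕢         = q₀⟶ρ₀
  reticulationChild-edge +0       (new s i) = w⟶ρ s i
  reticulationChild-edge +[1+ k ] s         = x⟶ρ s +[1+ k ]
  reticulationChild-edge -[1+ k ] s         = x⟶ρ s -[1+ k ]

  reticulationChild-≢0 : ∀ i s .{{_ : ℤ.NonZero i}} → ρ s i ≡ reticulationChild i s
  reticulationChild-≢0 +[1+ k ] s         = refl
  reticulationChild-≢0 -[1+ k ] s         = refl

  children parents : LimitVertex → List LimitVertex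
  children ρ₀         = ℓ₀ ∷ []
  children ℓ₀         = []
  children (node s i) = node s (ℤ.suc i) ∷ reticulationChild i s ∷ []
  children (ρ s i)    = ℓ s i ∷ []
  children (ℓ s i)    = []

  parents ρ₀         = node 𝕡 0ℤ ∷ node 𝕢 0ℤ ∷ []
  parents ℓ₀         = ρ₀ ∷ []
  parents (node s i) = node s (ℤ.pred i) ∷ []
  parents (ρ s i)    = node s i ∷ node (new s i) 0ℤ ∷ []
  parents (ℓ s i)    = ρ s i ∷ []

  children-sound : ∀ u → All (u ⟶̂_) (children u)
  children-sound ρ₀         = ρ₀⟶ℓ₀ ∷ []
  children-sound ℓ₀         = []
  children-sound (node s i) = spine s i ∷ reticulationChild-edge i s ∷ []
  children-sound (ρ s i)    = ρ⟶ℓ s i ∷ []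
  children-sound (ℓ s i)    = []

  children-complete : ∀ {u v} → u ⟶̂ v → v ∈ children u
  children-complete (spine s i) = here refl
  children-complete p₀⟶ρ₀       = there (here refl)
  children-complete q₀⟶ρ₀       = there (here refl)
  children-complete ρ₀⟶ℓ₀       = here refl
  children-complete (x⟶ρ s i)   = there (here (reticulationChild-≢0 i s))
  children-complete (w⟶ρ s i)   = there (here refl)
  children-complete (ρ⟶ℓ s i)   = here refl

  parents-complete : ∀ {u v} → v ⟶̂ u → v ∈ parents u
  parents-complete (spine s i) = here (cong (node s) (sym (ℤ.pred-suc i)))
  parents-complete p₀⟶ρ₀       = here refl
  parents-complete q₀⟶ρ₀       = there (here refl)
  parents-complete ρ₀⟶ℓ₀       = here refl
  parents-complete (x⟶ρ s i)   = here refl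
  parents-complete (w⟶ρ s i)   = there (here refl)
  parents-complete (ρ⟶ℓ s i)   = here refl

U≅? : ∀ {H} → LocallyFinite H → ∀ R v (G : FiniteRootedDigraph) →
      Dec (U R H v ≅ FiniteRootedDigraph.rootedDigraph G)
U≅? lf R v G = ≅-dec (U-finite lf R v) (finite G)

-- The law of a random rooted graph (H , v):  R , G ↦ ℙ(U_R(H , v) ≅ G).
Law : Set
Law = ℕ → FiniteRootedDigraph → ℚ

_⟶∞_ : (ℕ → ℚ) → ℚ → Set
a ⟶∞ l = ∀ ε → 0ℚ ℚ.< ε → ∃[ n₀ ] (∀ n → n₀ ℕ.≤ n → ℚ.∣ a n ℚ.- l ∣ ℚ.< ε)

_⟶ᵈ_ : (ℕ → Law) → Law → Set
μ ⟶ᵈ ν = ∀ R G → (λ n → μ n R G) ⟶∞ ν R G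

indicator : ∀ {P : Set} → Dec P → ℚ
indicator P? = if does P? then 1ℚ else 0ℚ

-- The expectation of f at a uniformly random entry of the list; the value
-- at the empty list is a convention.
mean : ∀ {A : Set} → List A → (A → ℚ) → ℚ
mean []         f = 0ℚ
mean xs@(_ ∷ _) f = List.foldr ℚ._+_ 0ℚ (List.map f xs) ℚ.* (+ 1 / length xs)

dirac : ∀ {H} → LocallyFinite H → MarkedDigraph.Vertex H → Law
dirac lf v R G = indicator (U≅? lf R v G)

reticulations : ∀ {n} (N : Network n) → List (Fin (Network.size N))
reticulations N = filter (λ v → Network.mark N v ≟ᵗ reticulation) (allFin _)

-- The vertices among which r_n is uniformly chosen: the reticulations, or
-- only the given vertex v if there are none.
choices : ∀ {n} (N : Network n) → Fin (Network.size N) → List (Fin (Network.size N))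
choices N v with reticulations N
... | []     = v ∷ []
... | r ∷ rs = r ∷ rs

networkLaw : ∀ {n} → NetworkList n → ((N : Network n) → Fin (Network.size N)) → Law
networkLaw networks arbitrary R G =
  mean (NetworkList.list networks) λ N →
    mean (choices N (arbitrary N)) λ r →
      indicator (U≅? (network-locallyFinite N) R r G)

≅ₗ-dec : ∀ {n} → Decidable (_≅ₗ_ {n})
≅ₗ-dec {n} M N = map′
  (λ (b , e , t) → record { bijection = b ; to-edge = e ; to-taxon = t })
  (λ i → let open _≅ₗ_ i in bijection , to-edge , to-taxon)
  (bijection? (listingFin _) (listingFin _) Fin._≟_ Fin._≟_
    (λ f → (∀ u v → N.edge (f u) (f v) ≡ M.edge u v) × (∀ i → f (M.taxon i) ≡ N.taxon i))
    (λ f≗g (e , t) →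
        (λ u v → trans (cong₂ N.edge (sym (f≗g u)) (sym (f≗g v))) (e u v))
      , (λ i → trans (sym (f≗g _)) (t i)))
    (λ f → Fin.all? (λ u → Fin.all? λ v → N.edge (f u) (f v) Bool.≟ M.edge u v)
         ×-dec Fin.all? (λ i → f (M.taxon i) Fin.≟ N.taxon i)))
  where
  module M = Network M
  module N = Network N

-- Paths whose interior vertices belong to a given list.
module _ {A : Set} {_⟶_ : Rel A 0ℓ} where

  Via : List A → Rel A 0ℓ
  Via []       u v = u ⟶ v
  Via (x ∷ xs) u v = Via xs u v ⊎ (Via xs u x × Via xs x v)

  via-edge : ∀ xs {u v} → u ⟶ v → Via xs u v
  via-edge []       e = e
  via-edge (x ∷ xs) e = inj₁ (via-edge xs e)

  via-trans : ∀ {xs u v w} → v ∈ xs → Via xs u v → Via xs v w → Via xs u w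
  via-trans {_ ∷ _} (here refl) (inj₁ a)       (inj₁ b)       = inj₂ (a , b)
  via-trans {_ ∷ _} (here refl) (inj₁ a)       (inj₂ (_ , b)) = inj₂ (a , b)
  via-trans {_ ∷ _} (here refl) (inj₂ (a , _)) (inj₁ b)       = inj₂ (a , b)
  via-trans {_ ∷ _} (here refl) (inj₂ (a , _)) (inj₂ (_ , b)) = inj₂ (a , b)
  via-trans {_ ∷ _} (there v∈)  (inj₁ a)       (inj₁ b)       = inj₁ (via-trans v∈ a b)
  via-trans {_ ∷ _} (there v∈)  (inj₁ a)       (inj₂ (b , c)) = inj₂ (via-trans v∈ a b , c)
  via-trans {_ ∷ _} (there v∈)  (inj₂ (a , b)) (inj₁ c)       = inj₂ (a , via-trans v∈ b c)
  via-trans {_ ∷ _} (there v∈)  (inj₂ (a , _)) (inj₂ (_ , d)) = inj₂ (a , d)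

  via⇒⁺ : ∀ xs {u v} → Via xs u v → TransClosure _⟶_ u v
  via⇒⁺ []       e              = [ e ]
  via⇒⁺ (x ∷ xs) (inj₁ a)       = via⇒⁺ xs a
  via⇒⁺ (x ∷ xs) (inj₂ (a , b)) = via⇒⁺ xs a ++⁺ via⇒⁺ xs b

  ⁺⇒via : ∀ {u v} ((xs , _) : Listing A) → TransClosure _⟶_ u v → Via xs u v
  ⁺⇒via (xs , ∈xs) [ e ]   = via-edge xs e
  ⁺⇒via (xs , ∈xs) (e ∷ r) = via-trans (∈xs _) (via-edge xs e) (⁺⇒via (xs , ∈xs) r)

  via? : Decidable _⟶_ → ∀ xs → Decidable (Via xs)
  via? _⟶?_ []       u v = u ⟶? v
  via? _⟶?_ (x ∷ xs) u v = via? _⟶?_ xs u v ⊎-dec (via? _⟶?_ xs u x ×-dec via? _⟶?_ xs x v)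

  transClosure? : Listing A → Decidable _⟶_ → Decidable (TransClosure _⟶_)
  transClosure? L@(xs , _) _⟶?_ u v = map′ (via⇒⁺ xs) (⁺⇒via L) (via? _⟶?_ xs u v)

  star? : Listing A → DecidableEquality A → Decidable _⟶_ → Decidable (Star _⟶_)
  star? L _≟_ _⟶?_ u v = map′
    [ (λ { refl → ε }) , ⁺⇒star ]′
    (λ { ε → inj₁ refl ; (e ◅ es) → inj₂ (star⇒⁺ e es) })
    ((u ≟ v) ⊎-dec transClosure? L _⟶?_ u v)
    where
    ⁺⇒star : ∀ {u v} → TransClosure _⟶_ u v → Star _⟶_ u v
    ⁺⇒star [ e ]   = e ◅ ε
    ⁺⇒star (e ∷ r) = e ◅ ⁺⇒star r

    star⇒⁺ : ∀ {u v w} → u ⟶ v → Star _⟶_ v w → TransClosure _⟶_ u w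
    star⇒⁺ e ε        = [ e ]
    star⇒⁺ e (d ◅ es) = e ∷ star⇒⁺ d es

isSimplexTreeChild? : ∀ {n size} (G : LabelledDigraph n size) → Dec (IsSimplexTreeChild G)
isSimplexTreeChild? {n} {size} G = map′
  (λ (a , b , c , d , e , f , g , h , i , j) → record
    { typed = a ; origin-root = b ; root-unique = c ; acyclic = d ; reachable = e
    ; taxon-leaf = f ; taxon-injective = g ; taxon-surjective = h
    ; tree-child = i ; one-component = j })
  (λ s → let open IsSimplexTreeChild s in
    typed , origin-root , root-unique , acyclic , reachable
    , taxon-leaf , taxon-injective , taxon-surjective , tree-child , one-component)
  ( Fin.all? (λ v → Product.≡-dec ℕ._≟_ ℕ._≟_ _ _)
  ×-dec (mark origin ≟ᵗ root)
  ×-dec Fin.all? (λ v → (mark v ≟ᵗ root) →-dec (v Fin.≟ origin))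
  ×-dec Fin.all? (λ v → ¬? (transClosure? (listingFin size) _⟶?_ v v))
  ×-dec Fin.all? (λ v → star? (listingFin size) Fin._≟_ _⟶?_ origin v)
  ×-dec Fin.all? (λ i → mark (taxon i) ≟ᵗ leaf)
  ×-dec Fin.all? (λ i → Fin.all? λ j → (taxon i Fin.≟ taxon j) →-dec (i Fin.≟ j))
  ×-dec Fin.all? (λ v → (mark v ≟ᵗ leaf) →-dec Fin.any? λ i → taxon i Fin.≟ v)
  ×-dec Fin.all? (λ v → ¬? (mark v ≟ᵗ leaf) →-dec Fin.any? λ w →
          (v ⟶? w) ×-dec ((mark w ≟ᵗ tree) ⊎-dec (mark w ≟ᵗ leaf)))
  ×-dec Fin.all? (λ v → Fin.all? λ w →
          (mark v ≟ᵗ reticulation) →-dec ((v ⟶? w) →-dec (mark w ≟ᵗ leaf))))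
  where
  open LabelledDigraph G

  _⟶?_ : Decidable _⟶_
  u ⟶? v = T? (edge u v)

module SizeBound {n} (N : Network n) where
  open Network N
  open SemiringSum ℕ.+-*-semiring
  open ≡-Reasoning

  χ : Bool → ℕ
  χ b = if b then 1 else 0

  sum-mono : ∀ {m} {f g : Fin m → ℕ} → (∀ i → f i ℕ.≤ g i) → sum f ℕ.≤ sum g
  sum-mono {zero}  f≤g = z≤n
  sum-mono {suc m} f≤g = ℕ.+-mono-≤ (f≤g zero) (sum-mono (f≤g ∘ suc))

  sum-1 : ∀ m → sum {m} (λ _ → 1) ≡ m
  sum-1 zero    = refl
  sum-1 (suc m) = cong suc (sum-1 m)

  term≤sum : ∀ {m} (f : Fin m → ℕ) i → f i ℕ.≤ sum f
  term≤sum f zero    = ℕ.m≤m+n _ _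
  term≤sum f (suc i) = ℕ.≤-trans (term≤sum (f ∘ suc) i) (ℕ.m≤n+m _ _)

  sum-point : ∀ {m} (i : Fin m) → sum (λ j → χ (does (i Fin.≟ j))) ≡ 1
  sum-point {suc m} zero    = cong suc (sum-replicate-zero m)
  sum-point {suc m} (suc i) = sum-point i

  card-sum : ∀ {m} (f : Fin m → Bool) → ∣ tabulate f ∣ ≡ sum (χ ∘ f)
  card-sum {zero}  f = refl
  card-sum {suc m} f with f zero
  ... | true  = cong suc (card-sum (f ∘ suc))
  ... | false = card-sum (f ∘ suc)

  δ : VertexType → Fin size → ℕ
  δ t v = χ (does (mark v ≟ᵗ t))

  # : VertexType → ℕ
  # t = sum (δ t)

  size≡ : size ≡ (# root ℕ.+ # tree) ℕ.+ (# reticulation ℕ.+ # leaf)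
  size≡ = begin
    size
      ≡⟨ sum-1 size ⟨
    sum {size} (λ _ → 1)
      ≡⟨ sum-cong-≗ one ⟩
    sum (λ v → (δ root v ℕ.+ δ tree v) ℕ.+ (δ reticulation v ℕ.+ δ leaf v))
      ≡⟨ ∑-distrib-+ {size} _ _ ⟩
    sum (λ v → δ root v ℕ.+ δ tree v) ℕ.+ sum (λ v → δ reticulation v ℕ.+ δ leaf v)
      ≡⟨ cong₂ ℕ._+_ (∑-distrib-+ {size} _ _) (∑-distrib-+ {size} _ _) ⟩
    (# root ℕ.+ # tree) ℕ.+ (# reticulation ℕ.+ # leaf) ∎
    where
    one : ∀ v → 1 ≡ (δ root v ℕ.+ δ tree v) ℕ.+ (δ reticulation v ℕ.+ δ leaf v)
    one v with mark v
    ... | root         = refl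
    ... | tree         = refl
    ... | reticulation = refl
    ... | leaf         = refl

  handshake : sum indegree ≡ sum outdegree
  handshake = begin
    sum indegree                              ≡⟨ sum-cong-≗ (λ v → card-sum (λ u → edge u v)) ⟩
    sum (λ v → sum (λ u → χ (edge u v)))      ≡⟨ ∑-comm {size} (λ v u → χ (edge u v)) ⟩
    sum (λ u → sum (λ v → χ (edge u v)))      ≡⟨ sum-cong-≗ (λ u → card-sum (λ v → edge u v)) ⟨
    sum outdegree                             ∎

  balance : # root ℕ.+ # tree ≡ # reticulation ℕ.+ # leaf
  balance = ℕ.+-cancelˡ-≡ (sum outdegree) _ _ (begin
    sum outdegree ℕ.+ (# root ℕ.+ # tree)
      ≡⟨ cong₂ ℕ._+_ (sym handshake) (sym (∑-distrib-+ {size} _ _)) ⟩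
    sum indegree ℕ.+ sum (λ v → δ root v ℕ.+ δ tree v)
      ≡⟨ ∑-distrib-+ {size} _ _ ⟨
    sum (λ v → indegree v ℕ.+ (δ root v ℕ.+ δ tree v))
      ≡⟨ sum-cong-≗ local ⟩
    sum (λ v → outdegree v ℕ.+ (δ reticulation v ℕ.+ δ leaf v))
      ≡⟨ ∑-distrib-+ {size} _ _ ⟩
    sum outdegree ℕ.+ sum (λ v → δ reticulation v ℕ.+ δ leaf v)
      ≡⟨ cong (sum outdegree ℕ.+_) (∑-distrib-+ {size} _ _) ⟩
    sum outdegree ℕ.+ (# reticulation ℕ.+ # leaf) ∎)
    where
    degreesOf : ∀ {i o i′ o′ a b} → (i , o) ≡ (i′ , o′) → i′ ℕ.+ a ≡ o′ ℕ.+ b →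
                i ℕ.+ a ≡ o ℕ.+ b
    degreesOf refl eq = eq

    local : ∀ v → indegree v ℕ.+ (δ root v ℕ.+ δ tree v)
                ≡ outdegree v ℕ.+ (δ reticulation v ℕ.+ δ leaf v)
    local v with mark v | typed v
    ... | root         | d = degreesOf d refl
    ... | tree         | d = degreesOf d refl
    ... | reticulation | d = degreesOf d refl
    ... | leaf         | d = degreesOf d refl

  #reticulation≤#leaf : # reticulation ℕ.≤ # leaf
  #reticulation≤#leaf = subst₂ ℕ._≤_ out in′
    (sum-mono λ v → sum-mono λ w → local v w)
    where
    local : ∀ v w → δ reticulation v ℕ.* χ (edge v w) ℕ.≤ δ leaf w ℕ.* χ (edge v w)
    local v w with edge v w | one-component v w
    ... | false | _ = ℕ.≤-reflexive (trans (ℕ.*-zeroʳ (δ reticulation v)) (sym (ℕ.*-zeroʳ (δ leaf w))))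
    ... | true  | oc with mark v
    ...   | root         = z≤n
    ...   | tree         = z≤n
    ...   | leaf         = z≤n
    ...   | reticulation rewrite oc refl _ = s≤s z≤n

    out : sum (λ v → sum (λ w → δ reticulation v ℕ.* χ (edge v w))) ≡ # reticulation
    out = sum-cong-≗ λ v → begin
      sum (λ w → δ reticulation v ℕ.* χ (edge v w)) ≡⟨ *-distribˡ-sum (δ reticulation v) (λ w → χ (edge v w)) ⟨
      δ reticulation v ℕ.* sum (λ w → χ (edge v w)) ≡⟨ cong (δ reticulation v ℕ.*_) (card-sum (edge v)) ⟨
      δ reticulation v ℕ.* outdegree v              ≡⟨ one v ⟩
      δ reticulation v                              ∎
      where
      one : ∀ v → δ reticulation v ℕ.* outdegree v ≡ δ reticulation v
      one v with mark v | typed v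
      ... | root         | _ = refl
      ... | tree         | _ = refl
      ... | reticulation | d = cong (1 ℕ.*_) (cong proj₂ d)
      ... | leaf         | _ = refl

    in′ : sum (λ v → sum (λ w → δ leaf w ℕ.* χ (edge v w))) ≡ # leaf
    in′ = trans (∑-comm {size} (λ v w → δ leaf w ℕ.* χ (edge v w))) (sum-cong-≗ λ w → begin
      sum (λ v → δ leaf w ℕ.* χ (edge v w)) ≡⟨ *-distribˡ-sum (δ leaf w) (λ v → χ (edge v w)) ⟨
      δ leaf w ℕ.* sum (λ v → χ (edge v w)) ≡⟨ cong (δ leaf w ℕ.*_) (card-sum (λ v → edge v w)) ⟨
      δ leaf w ℕ.* indegree w               ≡⟨ one w ⟩
      δ leaf w                              ∎)
      where
      one : ∀ w → δ leaf w ℕ.* indegree w ≡ δ leaf w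
      one w with mark w | typed w
      ... | root         | _ = refl
      ... | tree         | _ = refl
      ... | reticulation | _ = refl
      ... | leaf         | d = cong (1 ℕ.*_) (cong proj₁ d)

  #leaf≤n : # leaf ℕ.≤ n
  #leaf≤n = subst (# leaf ℕ.≤_)
    (trans (∑-comm {size} {n} _) (trans (sum-cong-≗ (λ i → sum-point (taxon i))) (sum-1 n)))
    (sum-mono local)
    where
    local : ∀ v → δ leaf v ℕ.≤ sum (λ i → χ (does (taxon i Fin.≟ v)))
    local v with mark v | taxon-surjective v
    ... | root         | _ = z≤n
    ... | tree         | _ = z≤n
    ... | reticulation | _ = z≤n
    ... | leaf         | s with s refl
    ...   | i , refl = subst (ℕ._≤ sum (λ j → χ (does (taxon j Fin.≟ taxon i)))) at-i
                         (term≤sum (λ j → χ (does (taxon j Fin.≟ taxon i))) i)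
      where
      at-i : χ (does (taxon i Fin.≟ taxon i)) ≡ 1
      at-i with taxon i Fin.≟ taxon i
      ... | yes _ = refl
      ... | no ¬r = contradiction refl ¬r

  size≤4n : size ℕ.≤ (n ℕ.+ n) ℕ.+ (n ℕ.+ n)
  size≤4n = subst (ℕ._≤ (n ℕ.+ n) ℕ.+ (n ℕ.+ n)) (sym size≡)
    (ℕ.+-mono-≤ (subst (ℕ._≤ n ℕ.+ n) (sym balance) half) half)
    where
    half : # reticulation ℕ.+ # leaf ℕ.≤ n ℕ.+ n
    half = ℕ.+-mono-≤ (ℕ.≤-trans #reticulation≤#leaf #leaf≤n) #leaf≤n

record _≈_ {n size} (G H : LabelledDigraph n size) : Set where
  private
    module G = LabelledDigraph G
    module H = LabelledDigraph H
  field
    edge≡   : ∀ u v → G.edge u v ≡ H.edge u v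
    origin≡ : G.origin ≡ H.origin
    mark≡   : ∀ v → G.mark v ≡ H.mark v
    taxon≡  : ∀ i → G.taxon i ≡ H.taxon i

≈-resp : ∀ {n size} {G H : LabelledDigraph n size} → G ≈ H →
         IsSimplexTreeChild G → IsSimplexTreeChild H
≈-resp {G = G} {H} G≈H s = record
  { typed            = λ v → trans (cong₂ _,_
      (cong ∣_∣ (tabulate-cong λ u → sym (edge≡ u v)))
      (cong ∣_∣ (tabulate-cong λ w → sym (edge≡ v w))))
      (trans (s.typed v) (cong degrees (mark≡ v)))
  ; origin-root      = trans (sym (mark≡ _)) (trans (cong G.mark (sym origin≡)) s.origin-root)
  ; root-unique      = λ v m → trans (s.root-unique v (trans (mark≡ v) m)) origin≡
  ; acyclic          = λ v c → s.acyclic v (closure c)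
  ; reachable        = λ v → subst (λ o → Star H._⟶_ o v) origin≡
                               (Star.map (λ {u} {v} → subst T (edge≡ u v)) (s.reachable v))
  ; taxon-leaf       = λ i → trans (cong H.mark (sym (taxon≡ i)))
                               (trans (sym (mark≡ _)) (s.taxon-leaf i))
  ; taxon-injective  = λ i j t → s.taxon-injective i j (trans (taxon≡ i) (trans t (sym (taxon≡ j))))
  ; taxon-surjective = λ v m → let i , t = s.taxon-surjective v (trans (mark≡ v) m)
                               in i , trans (sym (taxon≡ i)) t
  ; tree-child       = λ v m →
      let w , e , t = s.tree-child v (m ∘ trans (sym (mark≡ v)))
      in w , subst T (edge≡ v w) e , Sum.map (trans (sym (mark≡ w))) (trans (sym (mark≡ w))) t
  ; one-component    = λ v w m e → trans (sym (mark≡ w))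
      (s.one-component v w (trans (mark≡ v) m) (subst T (sym (edge≡ v w)) e))
  }
  where
  module G = LabelledDigraph G
  module H = LabelledDigraph H
  module s = IsSimplexTreeChild s
  open _≈_ G≈H

  closure : ∀ {u v} → TransClosure H._⟶_ u v → TransClosure G._⟶_ u v
  closure [ e ]   = [ subst T (sym (edge≡ _ _)) e ]
  closure (e ∷ r) = subst T (sym (edge≡ _ _)) e ∷ closure r

labelledDigraphs : ∀ n size → List (LabelledDigraph n size)
labelledDigraphs n size = List.map
  (λ (e , o , m , t) → record { edge = e ; origin = o ; mark = m ; taxon = t })
  (cartesianProduct (functions size (functions size (true ∷ false ∷ [])))
  (cartesianProduct (allFin size)
  (cartesianProduct (functions size (root ∷ tree ∷ reticulation ∷ leaf ∷ []))
                    (functions n (allFin size)))))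

labelledDigraphs-complete : ∀ {n size} (G : LabelledDigraph n size) →
                            Any (G ≈_) (labelledDigraphs n size)
labelledDigraphs-complete {n} {size} G = Any.map⁺ (Any.map
  (λ (e , o , m , t) → record { edge≡ = e ; origin≡ = o ; mark≡ = m ; taxon≡ = t })
  (Any.cartesianProduct⁺
    (functions-complete (λ f g → ∀ v → f v ≡ g v) size edge
      λ u → functions-complete _≡_ size (edge u) λ v → bools (edge u v))
  (Any.cartesianProduct⁺ (∈-allFin origin)
  (Any.cartesianProduct⁺ (functions-complete _≡_ size mark (types ∘ mark))
                         (functions-complete _≡_ n taxon (∈-allFin ∘ taxon))))))
  where
  open LabelledDigraph G

  bools : ∀ b → b ∈ true ∷ false ∷ []
  bools true  = here refl
  bools false = there (here refl)

  types : ∀ t → t ∈ root ∷ tree ∷ reticulation ∷ leaf ∷ []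
  types root         = here refl
  types tree         = there (here refl)
  types reticulation = there (there (here refl))
  types leaf         = there (there (there (here refl)))

networks : ∀ n → NetworkList n
networks n = record
  { list     = deduplicate ≅ₗ-dec all
  ; complete = EnumeratesP.deduplicate⁺ ≅ₗ-decSetoid complete
  ; unique   = UniqueP.deduplicate-! ≅ₗ-decSetoid all
  }
  where
  ≅ₗ-decSetoid : DecSetoid 0ℓ 0ℓ
  ≅ₗ-decSetoid = record
    { isDecEquivalence = record
        { isEquivalence = Setoid.isEquivalence (≅ₗ-setoid n) ; _≟_ = ≅ₗ-dec } }

  select : ∀ {size} → List (LabelledDigraph n size) → List (Network n)
  select [] = []
  select (G ∷ Gs) with isSimplexTreeChild? G
  ... | yes s = record { labelledDigraph = G ; isSimplexTreeChild = s } ∷ select Gs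
  ... | no  _ = select Gs

  select-complete : ∀ (N : Network n) {Gs} → Any (Network.labelledDigraph N ≈_) Gs →
                    Any (N ≅ₗ_) (select Gs)
  select-complete N {G ∷ Gs} i with isSimplexTreeChild? G
  select-complete N (here N≈G) | yes _ = here (record
    { bijection = Identity.↔-id _
    ; to-edge   = λ u v → sym (_≈_.edge≡ N≈G u v)
    ; to-taxon  = _≈_.taxon≡ N≈G
    })
  select-complete N (there i)  | yes _ = there (select-complete N i)
  select-complete N (here N≈G) | no ¬s = contradiction (≈-resp N≈G (Network.isSimplexTreeChild N)) ¬s
  select-complete N (there i)  | no _  = select-complete N i

  ofSize : ℕ → List (Network n)
  ofSize size = select (labelledDigraphs n size)

  all : List (Network n)
  all = concatMap ofSize (upTo (suc ((n ℕ.+ n) ℕ.+ (n ℕ.+ n))))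

  complete : ∀ N → Any (N ≅ₗ_) all
  complete N = Any.concat⁺ (Any.map⁺ {f = ofSize} (Any.map
    (λ { refl → select-complete N (labelledDigraphs-complete (Network.labelledDigraph N)) })
    (∈-upTo⁺ (s≤s (SizeBound.size≤4n N)))))

{-# OPTIONS --safe #-}
-- Call a leaf normal if its parent is not a reticulation.  A network with J normal
-- leaves has n − J reticulations and 2J irregular vertices: the root, the normal
-- leaves and the branchings (tree vertices without reticulation child).  Degrees are
-- at most 3, so few reticulations have an irregular vertex or a short undirected
-- cycle nearby as soon as J and the number of short cycles are small compared
-- with n.  Around every other reticulation the limit is the universal cover,
-- so that the balls agree.
--
-- Both numbers are bounded on average by switchings, i.e. by injections between
-- networks with marked vertices; marks are harmless because networks are rigid.
-- Call a leaf direct if its parent is a branching.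
--   * Making a direct leaf reticulate, with its second parent on any of the
--     at least n − 1 arcs into tree vertices, marks one of at most 2n arcs into
--     reticulations: the mean number of direct leaves is at most 4.
--   * Hanging a normal leaf at a branching instead of one of its subtrees,
--     which is moved to the former parent of the leaf, makes it direct; undoing this
--     takes the choice of an arc.  So the mean of J (J − 2) is O(n).
--   * Exchanging the heads of an arc on a short cycle and of a remote arc,
--     both into reticulations, breaks the cycle but leaves a short walk between its
--     ends.  So on average O(1 + J) such arcs lie on short cycles.
module Submission where

open import Data.Bool.Base using (Bool; true; false; T; not; _∧_; _∨_; _xor_; if_then_else_)
import Data.Bool.Properties as Bool
open import Data.Fin.Base using (Fin; zero; suc)
import Data.Fin.Induction as Fin
import Data.Fin.Properties as Fin
open import Data.Fin.Subset using (∣_∣)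
open import Data.Integer.Base as ℤ using (ℤ)
import Data.Integer.Properties as ℤ
open import Data.Irrelevant using ([_])
open import Data.List.Base as List using (List; []; _∷_; _++_; allFin; filter; concatMap; length; lookup)
import Data.List.Membership.DecPropositional as DecMembership
open import Data.List.Membership.Propositional using (_∈_; _∉_)
open import Data.List.Membership.Propositional.Properties
open import Data.List.Properties using (length-++; length-filter; length-map; length-tabulate)
open import Data.List.Relation.Unary.All as All using ([]; _∷_)
open import Data.List.Relation.Unary.AllPairs using (AllPairs; []; _∷_)
open import Data.List.Relation.Unary.Any as Any using (Any; here; there)
import Data.List.Relation.Unary.Any.Properties as Any
open import Data.List.Relation.Unary.Unique.Propositional using (Unique)
import Data.List.Relation.Unary.Unique.Propositional.Properties as Unique
open import Data.Nat.Base as ℕ using (ℕ; zero; suc; _+_; _*_; _∸_; _≤_; _<_; z≤n; s≤s)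
open import Data.Nat.Induction using (<-wellFounded)
import Data.Nat.Properties as ℕ
open import Data.Nat.Solver using (module +-*-Solver)
open import Data.Product.Base using (Σ; ∃-syntax; _×_; _,_; proj₁; proj₂)
open import Data.Rational.Base as ℚ using (ℚ; 0ℚ; 1ℚ)
import Data.Rational.Properties as ℚ
import Data.Rational.Solver as ℚ
import Data.Rational.Unnormalised.Base as ℚᵘ
import Data.Rational.Unnormalised.Properties as ℚᵘ
open import Data.Refinement using (_,_; value)
open import Data.Refinement.Properties using (value-injective)
open import Data.Sum.Base using (_⊎_; inj₁; inj₂; [_,_]′)
import Data.Vec.Base as Vec
open import Data.Vec.Properties using (tabulate-cong)
open import Function.Base using (_∘_; flip; id)
open import Function.Bundles using (mk⇔; mk↔ₛ′; Equivalence; Inverse)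
import Function.Construct.Composition as Composition
open import Function.Definitions using (Injective)
import Induction.WellFounded as WF
open import Induction.WellFounded using (Acc; acc; WellFounded)
open import Level using (0ℓ)
open import Relation.Binary.Construct.Closure.ReflexiveTransitive using (Star; ε; _◅_; _◅◅_)
open import Relation.Binary.Construct.Closure.Symmetric using (SymClosure; fwd; bwd)
open import Relation.Binary.Construct.Closure.Transitive as Plus using (TransClosure; [_]; _∷_; _∷ʳ_)
open import Relation.Binary.Core using (Rel)
open import Relation.Binary.Definitions using (tri<; tri≈; tri>)
open import Relation.Binary.PropositionalEquality
  using (_≡_; _≢_; _≗_; refl; sym; trans; cong; cong₂; subst; subst₂; module ≡-Reasoning)
open import Relation.Binary.PropositionalEquality.Properties using (isEquivalence)
open import Relation.Nullary using (¬_; Dec; yes; no; ¬?; contradiction)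
open import Relation.Nullary.Decidable using (does; map′; _×-dec_; _⊎-dec_; _→-dec_; recompute; from-yes)
open import Relation.Unary using (Decidable)
open import Defs

-- Counting with lists

-- Only first moments of the errors are used: every estimate is an inequality between sums over a
-- list of representatives of the isomorphism classes. The reticulation is chosen after the network,
-- so its error is a fraction of the random number k = n - J; one extra summand J in `defect` turns
-- this into a fraction of n. Since J (J - 2) has mean O(n), J has mean O(√n); instead of a square
-- root, a large constant M is multiplied through.
--
-- A switched network is in general only isomorphic to an entry of the list. The marks therefore
-- have to determine the switching up to isomorphism, which is easy if the switching is its own
-- inverse on adjacency matrices.
--
-- Acyclicity is the only requirement on a network that cannot be checked locally, and it decides
-- which switchings are allowed. Arcs into reticulations are unproblematic, as only a leaf lies
-- below a reticulation. In a regrafting, it dictates which subtree of the branching is moved.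

lookup-AllPairs : ∀ {A : Set} {_~_ : Rel A 0ℓ} → (∀ {x y} → x ~ y → y ~ x) →
                  ∀ {xs} → AllPairs _~_ xs → ∀ i j → i ≢ j → lookup xs i ~ lookup xs j
lookup-AllPairs ~-sym (p ∷ ps) zero    zero    i≢j = contradiction refl i≢j
lookup-AllPairs ~-sym (p ∷ ps) zero    (suc j) i≢j = All.lookup p (∈-lookup j)
lookup-AllPairs ~-sym (p ∷ ps) (suc i) zero    i≢j = ~-sym (All.lookup p (∈-lookup i))
lookup-AllPairs ~-sym (p ∷ ps) (suc i) (suc j) i≢j = lookup-AllPairs ~-sym ps i j (i≢j ∘ cong suc)

lookup-reflects : ∀ {A : Set} {_≈_ : Rel A 0ℓ} → (∀ {x y} → x ≈ y → y ≈ x) →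
                  ∀ {xs} → AllPairs (λ x y → ¬ x ≈ y) xs →
                  ∀ i j → lookup xs i ≈ lookup xs j → i ≡ j
lookup-reflects ≈-sym ps i j eq with i Fin.≟ j
... | yes i≡j = i≡j
... | no  i≢j = contradiction eq (lookup-AllPairs (_∘ ≈-sym) ps i j i≢j)

-- Stated for a relation instead of a function: an image may depend on choices, such as the
-- representative of an isomorphism class, and injectivity only asks that a `y` determines the `x`
-- related to it.
length-≤ : ∀ {A B : Set} {xs : List A} {ys : List B} (R : A → B → Set) → Unique xs →
           (∀ {x} → x ∈ xs → ∃[ y ] y ∈ ys × R x y) →
           (∀ {x x′ y} → x ∈ xs → x′ ∈ xs → R x y → R x′ y → x ≡ x′) →
           length xs ≤ length ys
length-≤ {xs = xs} {ys} R xs! image injective = Fin.injective⇒≤ {f = f} f-injective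
  where
  f : Fin (length xs) → Fin (length ys)
  f i = Any.index (proj₁ (proj₂ (image (∈-lookup i))))

  at : ∀ i → R (lookup xs i) (lookup ys (f i))
  at i = let y , y∈ , r = image (∈-lookup i) in subst (R _) (Any.lookup-index y∈) r

  f-injective : Injective _≡_ _≡_ f
  f-injective {i} {j} eq = lookup-reflects sym xs! i j
    (injective (∈-lookup i) (∈-lookup j) (at i) (subst (R _ ∘ lookup ys) (sym eq) (at j)))

⊆-length : ∀ {A : Set} {xs ys : List A} → Unique xs → (∀ {x} → x ∈ xs → x ∈ ys) →
           length xs ≤ length ys
⊆-length xs! xs⊆ys = length-≤ _≡_ xs! (λ x∈ → _ , xs⊆ys x∈ , refl)
  λ _ _ x≡y x′≡y → trans x≡y (sym x′≡y)

length-filter-split : ∀ {A : Set} {P : A → Set} (P? : Decidable P) xs →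
                      length (filter P? xs) + length (filter (¬? ∘ P?) xs) ≡ length xs
length-filter-split P? [] = refl
length-filter-split P? (x ∷ xs) with does (P? x)
... | true  = cong suc (length-filter-split P? xs)
... | false = trans (ℕ.+-suc _ _) (cong suc (length-filter-split P? xs))

-- Dependent, because the marks of a network are vertices of that network, and because the
-- admissible second arcs of a switching depend on the first.
pairs : ∀ {A : Set} {B : A → Set} → List A → (∀ a → List (B a)) → List (Σ A B)
pairs []       f = []
pairs (x ∷ xs) f = List.map (x ,_) (f x) ++ pairs xs f

∈-pairs⁺ : ∀ {A : Set} {B : A → Set} {xs} {f : ∀ a → List (B a)} {a b} →
           a ∈ xs → b ∈ f a → (a , b) ∈ pairs xs f
∈-pairs⁺ (here refl) b∈ = ∈-++⁺ˡ (∈-map⁺ _ b∈)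
∈-pairs⁺ (there a∈)  b∈ = ∈-++⁺ʳ _ (∈-pairs⁺ a∈ b∈)

∈-pairs⁻ : ∀ {A : Set} {B : A → Set} xs {f : ∀ a → List (B a)} {p} →
           p ∈ pairs xs f → proj₁ p ∈ xs × proj₂ p ∈ f (proj₁ p)
∈-pairs⁻ (x ∷ xs) {f} p∈ with ∈-++⁻ (List.map (x ,_) (f x)) p∈
... | inj₂ q∈ = let a∈ , b∈ = ∈-pairs⁻ xs q∈ in there a∈ , b∈
... | inj₁ q∈ with ∈-map⁻ (x ,_) q∈
...   | b , b∈ , refl = here refl , b∈

pairs-unique : ∀ {A : Set} {B : A → Set} {xs} {f : ∀ a → List (B a)} →
               Unique xs → (∀ a → Unique (f a)) → Unique (pairs xs f)
pairs-unique [] f! = []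
pairs-unique {xs = x ∷ xs} {f} (x∉ ∷ xs!) f! = Unique.++⁺
  (Unique.map⁺ (λ { refl → refl }) (f! x)) (pairs-unique xs! f!) disjoint
  where
  disjoint : ∀ {p} → ¬ (p ∈ List.map (x ,_) (f x) × p ∈ pairs xs f)
  disjoint (p∈ , p∈′) with ∈-map⁻ (x ,_) p∈
  ... | b , _ , refl = All.lookup x∉ (proj₁ (∈-pairs⁻ xs p∈′)) refl

total : ∀ {A : Set} → List A → (A → ℕ) → ℕ
total []       f = 0
total (x ∷ xs) f = f x + total xs f

length-pairs : ∀ {A : Set} {B : A → Set} xs (f : ∀ a → List (B a)) →
               length (pairs xs f) ≡ total xs (length ∘ f)
length-pairs []       f = refl
length-pairs {A} {B} (x ∷ xs) f = trans (length-++ (List.map here-pair (f x)) {pairs xs f})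
  (cong₂ _+_ (length-map here-pair (f x)) (length-pairs xs f))
  where
  here-pair : B x → Σ A B
  here-pair b = x , b

length-concatMap : ∀ {A B : Set} (f : A → List B) xs → length (concatMap f xs) ≡ total xs (length ∘ f)
length-concatMap f []       = refl
length-concatMap f (x ∷ xs) = trans (length-++ (f x)) (cong (length (f x) +_) (length-concatMap f xs))

total-mono : ∀ {A : Set} xs {f g : A → ℕ} → (∀ {x} → x ∈ xs → f x ≤ g x) → total xs f ≤ total xs g
total-mono []       f≤g = z≤n
total-mono (x ∷ xs) f≤g = ℕ.+-mono-≤ (f≤g (here refl)) (total-mono xs (f≤g ∘ there))

total-const : ∀ {A : Set} (xs : List A) c → total xs (λ _ → c) ≡ length xs * c
total-const []       c = refl
total-const (x ∷ xs) c = cong (c +_) (total-const xs c)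

total-+ : ∀ {A : Set} xs (f g : A → ℕ) → total xs (λ x → f x + g x) ≡ total xs f + total xs g
total-+ []       f g = refl
total-+ (x ∷ xs) f g = trans (cong (f x + g x +_) (total-+ xs f g)) (interchange (f x) (g x) _ _)
  where open import Algebra.Properties.CommutativeSemigroup ℕ.+-commutativeSemigroup using (interchange)

total-* : ∀ {A : Set} xs (f : A → ℕ) c → total xs (λ x → f x * c) ≡ total xs f * c
total-* []       f c = refl
total-* (x ∷ xs) f c = trans (cong (f x * c +_) (total-* xs f c)) (sym (ℕ.*-distribʳ-+ c (f x) _))

total-≤ : ∀ {A : Set} xs {f : A → ℕ} {c} → (∀ {x} → x ∈ xs → f x ≤ c) → total xs f ≤ length xs * c
total-≤ xs {c = c} f≤c = subst (_ ≤_) (total-const xs c) (total-mono xs f≤c)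

total-≥ : ∀ {A : Set} xs {f : A → ℕ} {c} → (∀ {x} → x ∈ xs → c ≤ f x) → length xs * c ≤ total xs f
total-≥ xs {c = c} c≤f = subst (_≤ _) (total-const xs c) (total-mono xs c≤f)

total-lookup : ∀ {A : Set} (xs : List A) (f : A → ℕ) →
               total (allFin (length xs)) (f ∘ lookup xs) ≡ total xs f
total-lookup xs f = trans (total-tabulate id (f ∘ lookup xs)) (by-lookup xs)
  where
  open import Algebra.Properties.Semiring.Sum ℕ.+-*-semiring using (sum)
  total-tabulate : ∀ {m} {A : Set} (g : Fin m → A) (f : A → ℕ) → total (List.tabulate g) f ≡ sum (f ∘ g)
  total-tabulate {zero}  g f = refl
  total-tabulate {suc m} g f = cong (f (g zero) +_) (total-tabulate (g ∘ suc) f)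
  by-lookup : ∀ xs → sum (f ∘ lookup xs) ≡ total xs f
  by-lookup []       = refl
  by-lookup (x ∷ xs) = cong (f x +_) (by-lookup xs)

-- Degrees

length-filter-tabulate : ∀ {m} {A : Set} {P : A → Set} (P? : Decidable P) (g : Fin m → A) →
                         length (filter P? (List.tabulate g)) ≡ ∣ Vec.tabulate (does ∘ P? ∘ g) ∣
length-filter-tabulate {zero}  P? g = refl
length-filter-tabulate {suc m} P? g with does (P? (g zero))
... | true  = cong suc (length-filter-tabulate P? (g ∘ suc))
... | false = length-filter-tabulate P? (g ∘ suc)

no-member : ∀ {A : Set} {xs : List A} {x} → length xs ≡ 0 → x ∉ xs
no-member {xs = []} _ ()

some-member : ∀ {A : Set} {xs : List A} {k} → length xs ≡ suc k → ∃[ x ] x ∈ xs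
some-member {xs = x ∷ xs} _ = x , here refl

singleton-unique : ∀ {A : Set} {xs : List A} {x y} → length xs ≡ 1 → x ∈ xs → y ∈ xs → x ≡ y
singleton-unique {xs = _ ∷ []} _ (here refl) (here refl) = refl

other-member : ∀ {A : Set} {xs : List A} {x} → length xs ≡ 2 → Unique xs → x ∈ xs →
               ∃[ y ] y ∈ xs × x ≢ y
other-member {xs = _ ∷ y ∷ []} _ ((x≢y ∷ []) ∷ _) (here refl)         = y , there (here refl) , x≢y
other-member {xs = x ∷ _ ∷ []} _ ((x≢y ∷ []) ∷ _) (there (here refl)) = x , here refl , x≢y ∘ sym

one-of-two : ∀ {A : Set} {xs : List A} {x y z} → length xs ≡ 2 → x ∈ xs → y ∈ xs → x ≢ y →
             z ∈ xs → z ≡ x ⊎ z ≡ y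
one-of-two {xs = _ ∷ _ ∷ []} _ (here refl) (here refl) x≢y _ = contradiction refl x≢y
one-of-two {xs = _ ∷ _ ∷ []} _ (there (here refl)) (there (here refl)) x≢y _ = contradiction refl x≢y
one-of-two {xs = _ ∷ _ ∷ []} _ (here refl) (there (here refl)) _ (here z≡) = inj₁ z≡
one-of-two {xs = _ ∷ _ ∷ []} _ (here refl) (there (here refl)) _ (there (here z≡)) = inj₂ z≡
one-of-two {xs = _ ∷ _ ∷ []} _ (there (here refl)) (here refl) _ (here z≡) = inj₂ z≡
one-of-two {xs = _ ∷ _ ∷ []} _ (there (here refl)) (here refl) _ (there (here z≡)) = inj₁ z≡

-- On a finite set the transitive closure of an acyclic relation is a strict partial order, hence
-- well-founded in both directions; single arcs inherit this.
acyclic⇒wellFounded : ∀ {m} {_⟶_ : Rel (Fin m) 0ℓ} → (∀ v → ¬ TransClosure _⟶_ v v) →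
                      WellFounded _⟶_ × WellFounded (flip _⟶_)
acyclic⇒wellFounded {_⟶_ = _⟶_} acyclic =
    WF.Subrelation.wellFounded [_] (Fin.spo-wellFounded isSPO)
  , WF.Subrelation.wellFounded {_<₁_ = flip _⟶_} {_<₂_ = flip (TransClosure _⟶_)} [_]
      (Fin.spo-noetherian isSPO)
  where
  open import Relation.Binary.Structures using (IsStrictPartialOrder)
  isSPO : IsStrictPartialOrder _≡_ (TransClosure _⟶_)
  isSPO = record
    { isEquivalence = isEquivalence
    ; irrefl        = λ { refl c → acyclic _ c }
    ; trans         = Plus._++_
    ; <-resp-≈      = (λ { refl c → c }) , (λ { refl c → c })
    }

-- Moving the first arc of a cycle to its end gives a cycle at a child of `v`, so that the descent
-- would never stop.
wellFounded⇒acyclic : ∀ {A : Set} {_⟶_ : Rel A 0ℓ} {v} → Acc (flip _⟶_) v → ¬ TransClosure _⟶_ v v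
wellFounded⇒acyclic (acc rs) [ e ]   = wellFounded⇒acyclic (rs e) [ e ]
wellFounded⇒acyclic (acc rs) (e ∷ c) = wellFounded⇒acyclic (rs e) (c ∷ʳ e)

module Degrees {n size} (G : LabelledDigraph n size) where
  open LabelledDigraph G

  ins outs : Fin size → List (Fin size)
  ins  v = filter (λ u → Bool.T? (edge u v)) (allFin size)
  outs v = filter (λ w → Bool.T? (edge v w)) (allFin size)

  ∈-ins : ∀ {u v} → u ⟶ v → u ∈ ins v
  ∈-ins = ∈-filter⁺ _ (∈-allFin _)

  ∈-outs : ∀ {u v} → u ⟶ v → v ∈ outs u
  ∈-outs = ∈-filter⁺ _ (∈-allFin _)

  ins⇒⟶ : ∀ {u v} → u ∈ ins v → u ⟶ v
  ins⇒⟶ {u} {v} u∈ = proj₂ (∈-filter⁻ (λ u → Bool.T? (edge u v)) {xs = allFin size} u∈)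

  outs⇒⟶ : ∀ {u v} → v ∈ outs u → u ⟶ v
  outs⇒⟶ {u} {v} v∈ = proj₂ (∈-filter⁻ (λ w → Bool.T? (edge u w)) {xs = allFin size} v∈)

  ins-unique : ∀ v → Unique (ins v)
  ins-unique v = Unique.filter⁺ _ (Unique.allFin⁺ size)

  outs-unique : ∀ v → Unique (outs v)
  outs-unique v = Unique.filter⁺ _ (Unique.allFin⁺ size)

  length-ins : ∀ v → length (ins v) ≡ indegree v
  length-ins v = length-filter-tabulate (λ u → Bool.T? (edge u v)) id

  length-outs : ∀ v → length (outs v) ≡ outdegree v
  length-outs v = length-filter-tabulate (λ w → Bool.T? (edge v w)) id

-- What has to be checked for a modified network. Well-foundedness replaces acyclicity, since
-- accessibility in the new graph can be proved by recursion on accessibility in the old one.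
record IsAcyclicTyped {n size} (G : LabelledDigraph n size) : Set where
  open LabelledDigraph G
  field
    typed            : ∀ v → (indegree v , outdegree v) ≡ degrees (mark v)
    origin-root      : mark origin ≡ root
    root-unique      : ∀ v → mark v ≡ root → v ≡ origin
    noetherian       : WellFounded (flip _⟶_)
    taxon-leaf       : ∀ i → mark (taxon i) ≡ leaf
    taxon-injective  : ∀ i j → taxon i ≡ taxon j → i ≡ j
    taxon-surjective : ∀ v → mark v ≡ leaf → ∃[ i ] taxon i ≡ v
    tree-child       : ∀ v → mark v ≢ leaf →
                       ∃[ w ] v ⟶ w × (mark w ≡ tree ⊎ mark w ≡ leaf)
    one-component    : ∀ v w → mark v ≡ reticulation → v ⟶ w → mark w ≡ leaf

  open Degrees G

  acyclic : ∀ v → ¬ TransClosure _⟶_ v v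
  acyclic v = wellFounded⇒acyclic (noetherian v)

  parent-exists : ∀ {v} → mark v ≢ root → ∃[ u ] u ⟶ v
  parent-exists {v} v≢root = let u , u∈ = parent (mark v) v≢root indeg in u , ins⇒⟶ u∈
    where
    indeg : length (ins v) ≡ proj₁ (degrees (mark v))
    indeg = trans (length-ins v) (cong proj₁ (typed v))
    parent : ∀ t → t ≢ root → length (ins v) ≡ proj₁ (degrees t) → ∃[ u ] u ∈ ins v
    parent root         t≢ _ = contradiction refl t≢
    parent tree         _  d = some-member d
    parent reticulation _  d = some-member d
    parent leaf         _  d = some-member d

  -- Climbing to a parent can only stop at the root, so reachability is automatic.
  reachable : ∀ v → Star _⟶_ origin v
  reachable v = climb v (proj₁ (acyclic⇒wellFounded acyclic) v)
    where
    climb : ∀ v → Acc _⟶_ v → Star _⟶_ origin v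
    climb v (acc rs) with mark v ≟ᵗ root
    ... | yes m = subst (Star _⟶_ origin) (sym (root-unique v m)) ε
    ... | no  m = let u , e = parent-exists m in climb u (rs e) ◅◅ e ◅ ε

  isSimplexTreeChild : IsSimplexTreeChild G
  isSimplexTreeChild = record
    { typed = typed ; origin-root = origin-root ; root-unique = root-unique ; acyclic = acyclic
    ; reachable = reachable ; taxon-leaf = taxon-leaf ; taxon-injective = taxon-injective
    ; taxon-surjective = taxon-surjective ; tree-child = tree-child ; one-component = one-component }

module Structure {n} (N : Network n) where
  open Network N
  open Degrees labelledDigraph public

  descending : WellFounded (flip _⟶_)
  descending = proj₂ (acyclic⇒wellFounded acyclic)

  indeg : ∀ {v t} → mark v ≡ t → length (ins v) ≡ proj₁ (degrees t)
  indeg {v} refl = trans (length-ins v) (cong proj₁ (typed v))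

  outdeg : ∀ {v t} → mark v ≡ t → length (outs v) ≡ proj₂ (degrees t)
  outdeg {v} refl = trans (length-outs v) (cong proj₂ (typed v))

  indegree≤2 : ∀ v → length (ins v) ≤ 2
  indegree≤2 v = subst (_≤ 2) (sym (indeg {v} refl)) (bound (mark v))
    where
    bound : ∀ t → proj₁ (degrees t) ≤ 2
    bound root         = z≤n
    bound tree         = s≤s z≤n
    bound reticulation = s≤s (s≤s z≤n)
    bound leaf         = s≤s z≤n

  outdegree≤2 : ∀ v → length (outs v) ≤ 2
  outdegree≤2 v = subst (_≤ 2) (sym (outdeg {v} refl)) (bound (mark v))
    where
    bound : ∀ t → proj₂ (degrees t) ≤ 2
    bound root         = s≤s z≤n
    bound tree         = s≤s (s≤s z≤n)
    bound reticulation = s≤s z≤n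
    bound leaf         = z≤n

  root-parentless : ∀ {u v} → mark v ≡ root → ¬ (u ⟶ v)
  root-parentless m e = no-member (indeg m) (∈-ins e)

  leaf-childless : ∀ {u v} → mark u ≡ leaf → ¬ (u ⟶ v)
  leaf-childless m e = no-member (outdeg m) (∈-outs e)

  parent-exists : ∀ {v} → mark v ≢ root → ∃[ u ] u ⟶ v
  parent-exists {v} v≢root with mark v in m
  ... | root         = contradiction refl v≢root
  ... | tree         = let u , u∈ = some-member (indeg m) in u , ins⇒⟶ u∈
  ... | reticulation = let u , u∈ = some-member (indeg m) in u , ins⇒⟶ u∈
  ... | leaf         = let u , u∈ = some-member (indeg m) in u , ins⇒⟶ u∈

  parent-unique : ∀ {u u′ v} → mark v ≢ reticulation → u ⟶ v → u′ ⟶ v → u ≡ u′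
  parent-unique {v = v} v≢ret e e′ with mark v in m
  ... | root         = contradiction e (root-parentless m)
  ... | tree         = singleton-unique (indeg m) (∈-ins e) (∈-ins e′)
  ... | reticulation = contradiction refl v≢ret
  ... | leaf         = singleton-unique (indeg m) (∈-ins e) (∈-ins e′)

  ret-child-unique : ∀ {r u v} → mark r ≡ reticulation → r ⟶ u → r ⟶ v → u ≡ v
  ret-child-unique m e e′ = singleton-unique (outdeg m) (∈-outs e) (∈-outs e′)

  treeOrLeaf⇒≢ret : ∀ {v} → mark v ≡ tree ⊎ mark v ≡ leaf → mark v ≢ reticulation
  treeOrLeaf⇒≢ret {v} (inj₁ m) m′ with mark v
  treeOrLeaf⇒≢ret (inj₁ refl) () | _
  treeOrLeaf⇒≢ret {v} (inj₂ m) m′ with mark v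
  treeOrLeaf⇒≢ret (inj₂ refl) () | _

  ≢ret⇒treeOrLeaf : ∀ {u v} → u ⟶ v → mark v ≢ reticulation → mark v ≡ tree ⊎ mark v ≡ leaf
  ≢ret⇒treeOrLeaf {v = v} e v≢ret with mark v in m
  ... | root         = contradiction e (root-parentless m)
  ... | tree         = inj₁ refl
  ... | reticulation = contradiction refl v≢ret
  ... | leaf         = inj₂ refl

  ret-parent-tree : ∀ {u r} → mark r ≡ reticulation → u ⟶ r → mark u ≡ tree
  ret-parent-tree {u} {r} mr e with mark u in m
  ... | tree = refl
  ... | leaf = contradiction e (leaf-childless m)
  ... | reticulation with () ← trans (sym mr) (one-component u r m e)
  ... | root with tree-child u (λ m′ → contradiction (trans (sym m) m′) λ ())
  ...   | w , e′ , mw = contradiction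
          (subst (λ x → mark x ≡ reticulation) (singleton-unique (outdeg m) (∈-outs e) (∈-outs e′)) mr)
          (treeOrLeaf⇒≢ret mw)

  tree≢leaf : ∀ {v} → mark v ≡ tree → mark v ≢ leaf
  tree≢leaf m m′ with () ← trans (sym m) m′

  tree≢ret : ∀ {v} → mark v ≡ tree → mark v ≢ reticulation
  tree≢ret m m′ with () ← trans (sym m) m′

  leaf≢ret : ∀ {v} → mark v ≡ leaf → mark v ≢ reticulation
  leaf≢ret m m′ with () ← trans (sym m) m′

  nonret-child : ∀ {v} → mark v ≢ leaf → ∃[ w ] v ⟶ w × mark w ≢ reticulation
  nonret-child {v} m = let w , e , mw = tree-child v m in w , e , treeOrLeaf⇒≢ret mw

  -- One of the two children of a tree vertex is not a reticulation, by `tree-child`. Hence an arc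
  -- into a reticulation is determined by its tail.
  reticulate-child-unique : ∀ {v r r′} → mark r ≡ reticulation → mark r′ ≡ reticulation →
                            v ⟶ r → v ⟶ r′ → r ≡ r′
  reticulate-child-unique m m′ e e′ =
    let mv = ret-parent-tree m e
        w , d , mw = nonret-child (tree≢leaf mv)
    in [ sym , (λ eq → contradiction (subst (λ x → mark x ≡ reticulation) eq m′) mw) ]′
         (one-of-two (outdeg mv) (∈-outs e) (∈-outs d)
          (λ eq → mw (subst (λ x → mark x ≡ reticulation) eq m)) (∈-outs e′))

-- Isomorphisms

degrees-injective : ∀ s t → degrees s ≡ degrees t → s ≡ t
degrees-injective root         root         _ = refl
degrees-injective tree         tree         _ = refl
degrees-injective reticulation reticulation _ = refl
degrees-injective leaf         leaf         _ = refl
degrees-injective root         tree         ()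
degrees-injective root         reticulation ()
degrees-injective root         leaf         ()
degrees-injective tree         root         ()
degrees-injective tree         reticulation ()
degrees-injective tree         leaf         ()
degrees-injective reticulation root         ()
degrees-injective reticulation tree         ()
degrees-injective reticulation leaf         ()
degrees-injective leaf         root         ()
degrees-injective leaf         tree         ()
degrees-injective leaf         reticulation ()

module Iso {n} {M N : Network n} (f : M ≅ₗ N) where
  private
    module M = Network M
    module N = Network N
    module SM = Structure M
    module SN = Structure N
  open _≅ₗ_ f public

  edge⁺ : ∀ {u v} → u M.⟶ v → to u N.⟶ to v
  edge⁺ {u} {v} = subst T (sym (to-edge u v))

  edge⁻ : ∀ {u v} → to u N.⟶ to v → u M.⟶ v
  edge⁻ {u} {v} = subst T (to-edge u v)

  to-injective : ∀ {u v} → to u ≡ to v → u ≡ v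
  to-injective {u} {v} eq = trans (sym (strictlyInverseʳ u)) (trans (cong from eq) (strictlyInverseʳ v))

  ins-≤ : ∀ v → length (SM.ins v) ≤ length (SN.ins (to v))
  ins-≤ v = length-≤ (λ u u′ → to u ≡ u′) (SM.ins-unique v)
    (λ u∈ → _ , SN.∈-ins (edge⁺ (SM.ins⇒⟶ u∈)) , refl)
    (λ _ _ eq eq′ → to-injective (trans eq (sym eq′)))

  outs-≤ : ∀ v → length (SM.outs v) ≤ length (SN.outs (to v))
  outs-≤ v = length-≤ (λ u u′ → to u ≡ u′) (SM.outs-unique v)
    (λ u∈ → _ , SN.∈-outs (edge⁺ (SM.outs⇒⟶ u∈)) , refl)
    (λ _ _ eq eq′ → to-injective (trans eq (sym eq′)))

-- `_≅ₗ_` does not mention marks. Comparing parents and children along `f` and its inverse shows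
-- that both degrees are preserved, and these determine the mark.
mark-to : ∀ {n} {M N : Network n} (f : M ≅ₗ N) v →
          Network.mark N (_≅ₗ_.to f v) ≡ Network.mark M v
mark-to {M = M} {N} f v = degrees-injective _ _
  (trans (sym (N.typed (to v))) (trans (cong₂ _,_ indegree≡ outdegree≡) (M.typed v)))
  where
  module M = Network M
  module N = Network N
  module SM = Structure M
  module SN = Structure N
  open Iso f
  open Iso (≅ₗ-sym f) using () renaming (ins-≤ to ins-≤⁻; outs-≤ to outs-≤⁻)

  indegree≡ : N.indegree (to v) ≡ M.indegree v
  indegree≡ = trans (sym (SN.length-ins (to v))) (trans (ℕ.≤-antisym
    (subst (λ w → length (SN.ins (to v)) ≤ length (SM.ins w)) (strictlyInverseʳ v) (ins-≤⁻ (to v)))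
    (ins-≤ v)) (SM.length-ins v))

  outdegree≡ : N.outdegree (to v) ≡ M.outdegree v
  outdegree≡ = trans (sym (SN.length-outs (to v))) (trans (ℕ.≤-antisym
    (subst (λ w → length (SN.outs (to v)) ≤ length (SM.outs w)) (strictlyInverseʳ v) (outs-≤⁻ (to v)))
    (outs-≤ v)) (SM.length-outs v))

-- Every vertex is the unique parent of some child, and leaves are fixed by
-- their labels.
rigid : ∀ {n} {N : Network n} (f : N ≅ₗ N) v → _≅ₗ_.to f v ≡ v
rigid {N = N} f v = fixed v (descending v)
  where
  open Network N
  open Structure N
  open Iso f
  fixed : ∀ v → Acc (flip _⟶_) v → to v ≡ v
  fixed v (acc rs) with mark v ≟ᵗ leaf
  ... | yes m = let i , eq = taxon-surjective v m in
        trans (cong to (sym eq)) (trans (to-taxon i) eq)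
  ... | no  m = let w , e , mw = tree-child v m in
        parent-unique (treeOrLeaf⇒≢ret mw) (subst (to v ⟶_) (fixed w (rs e)) (edge⁺ e)) e

-- Undirected walks

mapWithin : ∀ {G H : MarkedDigraph} (f : MarkedDigraph.Vertex G → MarkedDigraph.Vertex H) →
            (∀ {u v} → MarkedDigraph._⟶_ G u v → MarkedDigraph._⟶_ H (f u) (f v)) →
            ∀ {R u v} → Within G R u v → Within H R (f u) (f v)
mapWithin f f⟶ here             = here
mapWithin f f⟶ (step (fwd e) p) = step (fwd (f⟶ e)) (mapWithin f f⟶ p)
mapWithin f f⟶ (step (bwd e) p) = step (bwd (f⟶ e)) (mapWithin f f⟶ p)

within-weaken : ∀ {G R S v w} → R ≤ S → Within G R v w → Within G S v w
within-weaken _         here       = here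
within-weaken (s≤s R≤S) (step e p) = step e (within-weaken R≤S p)

within-++ : ∀ {G R S u v w} → Within G R u v → Within G S v w → Within G (R + S) u w
within-++ {R = R} {S} here q = within-weaken (ℕ.m≤n+m S R) q
within-++ (step e p)  q = step e (within-++ p q)

within-edge : ∀ {G : MarkedDigraph} {u v} → SymClosure (MarkedDigraph._⟶_ G) u v → Within G 1 u v
within-edge e = step e here

within-snoc : ∀ {G R u v w} → Within G R u v → SymClosure (MarkedDigraph._⟶_ G) v w → Within G (suc R) u w
within-snoc {G} {R} {u} {w = w} p e = subst (λ k → Within G k u w) (ℕ.+-comm R 1) (within-++ p (within-edge e))

within-sym : ∀ {G R v w} → Within G R v w → Within G R w v
within-sym here = here
within-sym {G} (step e p) = within-snoc (within-sym p) (reverse e)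
  where
  reverse : ∀ {u v} → SymClosure (MarkedDigraph._⟶_ G) u v → SymClosure (MarkedDigraph._⟶_ G) v u
  reverse (fwd e) = bwd e
  reverse (bwd e) = fwd e

-- Injections between marked networks

module _ {n} (𝓛 : NetworkList n) where
  open NetworkList 𝓛 renaming (list to L)

  -- By rigidity, markings of one network that correspond under an
  -- automorphism are equal, so that marked networks can be counted up to isomorphism.
  total-≤-by-injection :
    {A B : Network n → Set} (X : ∀ N → List (A N)) (Y : ∀ N → List (B N)) →
    (∀ N → Unique (X N)) →
    (Matches : ∀ {M N} → M ≅ₗ N → A M → A N → Set) →
    (∀ {N} (f : N ≅ₗ N) {x y : A N} → (∀ v → _≅ₗ_.to f v ≡ v) → Matches f x y → x ≡ y) →
    (R : ∀ {M N} → A M → B N → Set) →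
    (∀ {M x} → x ∈ X M → Σ (Network n) λ M′ →
       ∀ {N} → M′ ≅ₗ N → ∃[ y ] y ∈ Y N × R {M} {N} x y) →
    (∀ {M M′ N x x′ y} → x ∈ X M → x′ ∈ X M′ → R {M} {N} x y → R {M′} {N} x′ y →
       Σ (M ≅ₗ M′) λ f → Matches f x x′) →
    total L (length ∘ X) ≤ total L (length ∘ Y)
  total-≤-by-injection {A} {B} X Y X! Matches matches⇒≡ R image reflect =
    subst₂ _≤_ (count X) (count Y)
      (length-≤ Related
        (pairs-unique (Unique.allFin⁺ _) (X! ∘ lookup L)) image′ injective)
    where
    marked : {A : Network n → Set} (X : ∀ N → List (A N)) → List (Σ (Fin (length L)) (A ∘ lookup L))
    marked X = pairs (allFin (length L)) (X ∘ lookup L)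

    count : {A : Network n → Set} (X : ∀ N → List (A N)) → length (marked X) ≡ total L (length ∘ X)
    count X = trans (length-pairs (allFin _) (X ∘ lookup L)) (total-lookup L (length ∘ X))

    Related : Σ (Fin (length L)) (A ∘ lookup L) → Σ (Fin (length L)) (B ∘ lookup L) → Set
    Related (i , x) (j , y) = R {lookup L i} {lookup L j} x y

    image′ : ∀ {p} → p ∈ marked X → ∃[ q ] q ∈ marked Y × Related p q
    image′ p∈ =
      let M′ , f = image (proj₂ (∈-pairs⁻ (allFin _) {X ∘ lookup L} p∈))
          -- The modified network need not be an entry of the list, only isomorphic to one.
          N∈     = complete M′
          y , y∈ , r = f (Any.lookup-index N∈)
      in (Any.index N∈ , y) , ∈-pairs⁺ (∈-allFin _) y∈ , r

    injective : ∀ {p p′ q} → p ∈ marked X → p′ ∈ marked X →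
                Related p q → Related p′ q → p ≡ p′
    injective {i , x} {j , x′} {k , _} p∈ p′∈ r r′
      with f , m ← reflect {N = lookup L k} (proj₂ (∈-pairs⁻ (allFin _) {X ∘ lookup L} p∈))
                           (proj₂ (∈-pairs⁻ (allFin _) {X ∘ lookup L} p′∈)) r r′
      with refl ← lookup-reflects ≅ₗ-sym unique i j f
      = cong (i ,_) (matches⇒≡ {lookup L i} f (rigid f) m)

-- Switching two arcs

χ : Bool → ℕ
χ b = if b then 1 else 0

card : ∀ {m} → (Fin m → Bool) → ℕ
card f = ∣ Vec.tabulate f ∣

card-∷ : ∀ {m} (f : Fin (suc m) → Bool) → card f ≡ χ (f zero) + card (f ∘ suc)
card-∷ f with f zero
... | true  = refl
... | false = refl

card-cong : ∀ {m} {f g : Fin m → Bool} → f ≗ g → card f ≡ card g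
card-cong f≗g = cong ∣_∣ (tabulate-cong f≗g)

_without_ : ∀ {m} → (Fin m → Bool) → Fin m → Fin m → Bool
(f without i) j = f j ∧ not (does (j Fin.≟ i))

card-without : ∀ {m} (f : Fin m → Bool) i → card f ≡ χ (f i) + card (f without i)
card-without {suc m} f zero = trans (card-∷ f) (cong (χ (f zero) +_) (sym (begin
  card (f without zero)                       ≡⟨ card-∷ (f without zero) ⟩
  χ (f zero ∧ false) + card ((f without zero) ∘ suc)                 ≡⟨ cong₂ _+_ (cong χ (Bool.∧-zeroʳ (f zero)))
                                                          (card-cong {g = f ∘ suc} λ j → Bool.∧-identityʳ (f (suc j))) ⟩
  card (f ∘ suc)                              ∎)))
  where open ≡-Reasoning
card-without {suc m} f (suc i) = begin
  card f                                                  ≡⟨ card-∷ f ⟩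
  χ (f zero) + card (f ∘ suc)                             ≡⟨ cong (χ (f zero) +_) (card-without (f ∘ suc) i) ⟩
  χ (f zero) + (χ (f (suc i)) + card ((f ∘ suc) without i)) ≡⟨ x∙yz≈y∙xz (χ (f zero)) (χ (f (suc i))) _ ⟩
  χ (f (suc i)) + (χ (f zero) + card ((f ∘ suc) without i)) ≡⟨ cong (λ b → χ (f (suc i)) + (χ b + card ((f ∘ suc) without i))) (Bool.∧-identityʳ (f zero)) ⟨
  χ (f (suc i)) + (χ ((f without suc i) zero) + card ((f ∘ suc) without i)) ≡⟨ cong (χ (f (suc i)) +_) (card-∷ (f without suc i)) ⟨
  χ (f (suc i)) + card (f without suc i)                  ∎
  where
  open ≡-Reasoning
  open import Algebra.Properties.CommutativeSemigroup ℕ.+-commutativeSemigroup using (x∙yz≈y∙xz)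

card-without₂ : ∀ {m} (f : Fin m → Bool) {i j} → i ≢ j →
                card f ≡ (χ (f i) + χ (f j)) + card ((f without i) without j)
card-without₂ f {i} {j} i≢j = begin
  card f                                                          ≡⟨ card-without f i ⟩
  χ (f i) + card (f without i)                                    ≡⟨ cong (χ (f i) +_) (card-without (f without i) j) ⟩
  χ (f i) + (χ ((f without i) j) + card ((f without i) without j)) ≡⟨ ℕ.+-assoc (χ (f i)) _ _ ⟨
  χ (f i) + χ ((f without i) j) + card ((f without i) without j)
    ≡⟨ cong (λ b → χ (f i) + χ b + card ((f without i) without j)) away ⟩
  χ (f i) + χ (f j) + card ((f without i) without j)              ∎
  where
  open ≡-Reasoning
  away : (f without i) j ≡ f j
  away with j Fin.≟ i
  ... | yes j≡i = contradiction (sym j≡i) i≢j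
  ... | no  _   = Bool.∧-identityʳ (f j)

T⇒≡ : ∀ {b} → T b → b ≡ true
T⇒≡ {true} _ = refl

¬T⇒≡ : ∀ {b} → ¬ T b → b ≡ false
¬T⇒≡ {true}  ¬t = contradiction _ ¬t
¬T⇒≡ {false} _  = refl

card-exchange : ∀ {m} {f g : Fin m → Bool} {i j} → i ≢ j → χ (f i) + χ (f j) ≡ χ (g i) + χ (g j) →
                (∀ k → k ≢ i → k ≢ j → f k ≡ g k) → card f ≡ card g
card-exchange {f = f} {g} {i} {j} i≢j eq agree = begin
  card f                                                   ≡⟨ card-without₂ f i≢j ⟩
  (χ (f i) + χ (f j)) + card ((f without i) without j)     ≡⟨ cong₂ _+_ eq (card-cong off) ⟩
  (χ (g i) + χ (g j)) + card ((g without i) without j)     ≡⟨ card-without₂ g i≢j ⟨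
  card g                                                   ∎
  where
  open ≡-Reasoning
  off : ((f without i) without j) ≗ ((g without i) without j)
  off k with k Fin.≟ i | k Fin.≟ j
  ... | yes _   | _       = cong (_∧ _) (trans (Bool.∧-zeroʳ (f k)) (sym (Bool.∧-zeroʳ (g k))))
  ... | no  _   | yes _   = trans (Bool.∧-zeroʳ _) (sym (Bool.∧-zeroʳ _))
  ... | no  k≢i | no  k≢j = cong (λ b → (b ∧ true) ∧ true) (agree k k≢i k≢j)

_∈₂_,_ : ∀ {m} → Fin m → Fin m → Fin m → Bool
u ∈₂ v , w = does (u Fin.≟ v) ∨ does (u Fin.≟ w)

∈₂-true : ∀ {m} {u v w : Fin m} → T (u ∈₂ v , w) → u ≡ v ⊎ u ≡ w
∈₂-true {u = u} {v} {w} t with u Fin.≟ v | u Fin.≟ w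
... | yes p | _     = inj₁ p
... | no _  | yes q = inj₂ q

∈₂-left : ∀ {m} (v w : Fin m) → (v ∈₂ v , w) ≡ true
∈₂-left v w with v Fin.≟ v
... | yes _   = refl
... | no  v≢v = contradiction refl v≢v

∈₂-right : ∀ {m} (v w : Fin m) → (w ∈₂ v , w) ≡ true
∈₂-right v w with w Fin.≟ w | w Fin.≟ v
... | yes _   | yes _ = refl
... | yes _   | no  _ = refl
... | no  w≢w | _ = contradiction refl w≢w

∈₂-false : ∀ {m} {u v w : Fin m} → u ≢ v → u ≢ w → (u ∈₂ v , w) ≡ false
∈₂-false {u = u} {v} {w} u≢v u≢w with u Fin.≟ v | u Fin.≟ w
... | yes p | _     = contradiction p u≢v
... | no _  | yes q = contradiction q u≢w
... | no _  | no _  = refl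

∈₂-map : ∀ {m k} (h : Fin m → Fin k) → (∀ {u v} → h u ≡ h v → u ≡ v) →
         ∀ u v w → (h u ∈₂ h v , h w) ≡ (u ∈₂ v , w)
∈₂-map h h-inj u v w = cong₂ _∨_ (same u v) (same u w)
  where
  same : ∀ u v → does (h u Fin.≟ h v) ≡ does (u Fin.≟ v)
  same u v with h u Fin.≟ h v | u Fin.≟ v
  ... | yes _ | yes _ = refl
  ... | yes p | no ¬q = contradiction (h-inj p) ¬q
  ... | no ¬p | yes q = contradiction (cong h q) ¬p
  ... | no _  | no _  = refl

Arc : ∀ {n} → Network n → Set
Arc N = Σ (Fin (Network.size N)) λ _ → Fin (Network.size N)

ArcPair : ∀ {n} → Network n → Set
ArcPair N = Σ (Arc N) λ _ → Arc N

-- The two absent arcs keep the graph simple and the degrees unchanged, tails that are not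
-- reticulations preserve `one-component`, and heads of the same kind (`alike`) preserve
-- `tree-child`. Acyclicity is not implied and is treated separately.
record Switchable {n} (N : Network n) (x : ArcPair N) : Set where
  open Network N
  v  = proj₁ (proj₁ x)
  y  = proj₂ (proj₁ x)
  v′ = proj₁ (proj₂ x)
  y′ = proj₂ (proj₂ x)
  field
    arc     : v ⟶ y
    arc′    : v′ ⟶ y′
    v≢v′    : v ≢ v′
    y≢y′    : y ≢ y′
    no-arc  : ¬ (v ⟶ y′)
    no-arc′ : ¬ (v′ ⟶ y)
    v≢ret   : mark v ≢ reticulation
    v′≢ret  : mark v′ ≢ reticulation
    alike   : ((mark y ≡ tree ⊎ mark y ≡ leaf) × (mark y′ ≡ tree ⊎ mark y′ ≡ leaf))
              ⊎ (mark y ≡ reticulation × mark y′ ≡ reticulation)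

rectangle : ∀ {m} → (Σ (Σ (Fin m) λ _ → Fin m) λ _ → Σ (Fin m) λ _ → Fin m) → Fin m → Fin m → Bool
rectangle x u z = (u ∈₂ proj₁ (proj₁ x) , proj₁ (proj₂ x)) ∧ (z ∈₂ proj₂ (proj₁ x) , proj₂ (proj₂ x))

-- The arcs v → y and v′ → y′ become v → y′ and v′ → y: the adjacency
-- matrix is complemented on the rectangle {v , v′} × {y , y′}.
module Switch {n} {N : Network n} {x : ArcPair N} (s : Switchable N x) where
  open Network N
  open Structure N
  open Switchable s

  rect : Fin size → Fin size → Bool
  rect = rectangle x

  switched : LabelledDigraph n size
  switched = record { edge = λ u z → edge u z xor rect u z ; origin = origin ; mark = mark ; taxon = taxon }

  private module S = LabelledDigraph switched

  rect-no-row : ∀ {u z} → u ≢ v → u ≢ v′ → rect u z ≡ false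
  rect-no-row p q = cong (_∧ _) (∈₂-false p q)

  rect-no-col : ∀ {u z} → z ≢ y → z ≢ y′ → rect u z ≡ false
  rect-no-col p q = trans (cong (_ ∧_) (∈₂-false p q)) (Bool.∧-zeroʳ _)

  keep : ∀ {u z} → rect u z ≡ false → S.edge u z ≡ edge u z
  keep {u} {z} p = trans (cong (edge u z xor_) p) (Bool.xor-identityʳ (edge u z))

  keep⁺ : ∀ {u z} → rect u z ≡ false → u ⟶ z → u S.⟶ z
  keep⁺ p = subst T (sym (keep p))

  at : ∀ {b u z} → rect u z ≡ true → edge u z ≡ b → S.edge u z ≡ not b
  at {b} {u} {z} p q = trans (cong₂ _xor_ q p) (Bool.xor-comm b true)

  rect-vy : rect v y ≡ true
  rect-vy = cong₂ _∧_ (∈₂-left v v′) (∈₂-left y y′)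
  rect-vy′ : rect v y′ ≡ true
  rect-vy′ = cong₂ _∧_ (∈₂-left v v′) (∈₂-right y y′)
  rect-v′y : rect v′ y ≡ true
  rect-v′y = cong₂ _∧_ (∈₂-right v v′) (∈₂-left y y′)
  rect-v′y′ : rect v′ y′ ≡ true
  rect-v′y′ = cong₂ _∧_ (∈₂-right v v′) (∈₂-right y y′)

  e-vy : edge v y ≡ true
  e-vy = T⇒≡ arc
  e-vy′ : edge v y′ ≡ false
  e-vy′ = ¬T⇒≡ no-arc
  e-v′y : edge v′ y ≡ false
  e-v′y = ¬T⇒≡ no-arc′
  e-v′y′ : edge v′ y′ ≡ true
  e-v′y′ = T⇒≡ arc′

  fresh : v S.⟶ y′
  fresh = subst T (sym (at rect-vy′ e-vy′)) _

  fresh′ : v′ S.⟶ y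
  fresh′ = subst T (sym (at rect-v′y e-v′y)) _

  view : ∀ {u z} → u S.⟶ z → (u ⟶ z) ⊎ (u ≡ v × z ≡ y′) ⊎ (u ≡ v′ × z ≡ y)
  view {u} {z} e with rect u z in p
  ... | false = inj₁ (subst T (Bool.xor-identityʳ (edge u z)) e)
  ... | true with ∈₂-true {u = u} (proj₁ (Equivalence.to Bool.T-∧ (subst T (sym p) _)))
               | ∈₂-true {u = z} (proj₂ (Equivalence.to (Bool.T-∧ {u ∈₂ v , v′}) (subst T (sym p) _)))
  ...   | inj₁ refl | inj₂ refl = inj₂ (inj₁ (refl , refl))
  ...   | inj₂ refl | inj₁ refl = inj₂ (inj₂ (refl , refl))
  ...   | inj₁ refl | inj₁ refl with () ← subst T (cong (_xor true) e-vy) e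
  ...   | inj₂ refl | inj₂ refl with () ← subst T (cong (_xor true) e-v′y′) e

  row : ∀ u → S.outdegree u ≡ outdegree u
  row u = by-cases (u Fin.≟ v) (u Fin.≟ v′)
    where
    by-cases : Dec (u ≡ v) → Dec (u ≡ v′) → S.outdegree u ≡ outdegree u
    by-cases (yes refl) _ = card-exchange y≢y′
      (trans (cong₂ (λ a b → χ a + χ b) (at rect-vy e-vy) (at rect-vy′ e-vy′))
             (sym (cong₂ (λ a b → χ a + χ b) e-vy e-vy′)))
      (λ z p q → keep {v} {z} (rect-no-col {v} {z} p q))
    by-cases (no _) (yes refl) = card-exchange y≢y′
      (trans (cong₂ (λ a b → χ a + χ b) (at rect-v′y e-v′y) (at rect-v′y′ e-v′y′))
             (sym (cong₂ (λ a b → χ a + χ b) e-v′y e-v′y′)))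
      (λ z p q → keep {v′} {z} (rect-no-col {v′} {z} p q))
    by-cases (no p) (no q) = card-cong λ z → keep {u} {z} (rect-no-row {u} {z} p q)

  col : ∀ z → S.indegree z ≡ indegree z
  col z = by-cases (z Fin.≟ y) (z Fin.≟ y′)
    where
    by-cases : Dec (z ≡ y) → Dec (z ≡ y′) → S.indegree z ≡ indegree z
    by-cases (yes refl) _ = card-exchange v≢v′
      (trans (cong₂ (λ a b → χ a + χ b) (at rect-vy e-vy) (at rect-v′y e-v′y))
             (sym (cong₂ (λ a b → χ a + χ b) e-vy e-v′y)))
      (λ u p q → keep {u} {y} (rect-no-row {u} {y} p q))
    by-cases (no _) (yes refl) = card-exchange v≢v′
      (trans (cong₂ (λ a b → χ a + χ b) (at rect-vy′ e-vy′) (at rect-v′y′ e-v′y′))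
             (sym (cong₂ (λ a b → χ a + χ b) e-vy′ e-v′y′)))
      (λ u p q → keep {u} {y′} (rect-no-row {u} {y′} p q))
    by-cases (no p) (no q) = card-cong λ u → keep {u} {z} (rect-no-col {u} {z} p q)

  -- The old witness is lost only if its arc is one of the two switched ones; the head replacing it
  -- is of the same kind by `alike`.
  tree-child′ : ∀ u → mark u ≢ leaf → ∃[ w ] u S.⟶ w × (mark w ≡ tree ⊎ mark w ≡ leaf)
  tree-child′ u m with tree-child u m
  ... | w , e , mw with rect u w in p
  ...   | false = w , keep⁺ p e , mw
  ...   | true with ∈₂-true {u = u} (proj₁ (Equivalence.to Bool.T-∧ (subst T (sym p) _)))
                  | ∈₂-true {u = w} (proj₂ (Equivalence.to (Bool.T-∧ {u ∈₂ v , v′}) (subst T (sym p) _)))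
                  | alike
  ...     | inj₁ refl | inj₁ refl | inj₁ (_ , my′) = y′ , fresh , my′
  ...     | inj₁ refl | inj₁ refl | inj₂ (my , _)  = contradiction my (treeOrLeaf⇒≢ret mw)
  ...     | inj₁ refl | inj₂ refl | _              = contradiction e no-arc
  ...     | inj₂ refl | inj₁ refl | _              = contradiction e no-arc′
  ...     | inj₂ refl | inj₂ refl | inj₁ (my , _)  = y , fresh′ , my
  ...     | inj₂ refl | inj₂ refl | inj₂ (_ , my′) = contradiction my′ (treeOrLeaf⇒≢ret mw)

  -- The condition that depends on more than the four switched vertices is an argument, since it
  -- holds for different reasons in the two applications.
  network : WellFounded (flip S._⟶_) → Network n
  network noetherian = record
    { labelledDigraph = switched
    ; isSimplexTreeChild = IsAcyclicTyped.isSimplexTreeChild record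
        { typed            = λ u → trans (cong₂ _,_ (col u) (row u)) (typed u)
        ; origin-root      = origin-root
        ; root-unique      = root-unique
        ; noetherian       = noetherian
        ; taxon-leaf       = taxon-leaf
        ; taxon-injective  = taxon-injective
        ; taxon-surjective = taxon-surjective
        ; tree-child       = tree-child′
        ; one-component    = λ u z m e → [ one-component u z m
            , [ (λ { (refl , refl) → contradiction m v≢ret })
              , (λ { (refl , refl) → contradiction m v′≢ret }) ]′ ]′ (view e)
        }
    }

Matches : ∀ {n} {M N : Network n} → M ≅ₗ N → ArcPair M → ArcPair N → Set
Matches f ((v , y) , (v′ , y′)) x = ((to v , to y) , (to v′ , to y′)) ≡ x
  where open _≅ₗ_ f

-- Complementing twice on a rectangle restores the matrix. As `f` carries the four marked vertices
-- to `x′`, it carries rectangle to rectangle, and so it is also an isomorphism of the networks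
-- before the switching.
unswitch : ∀ {n} {M N : Network n} {x : ArcPair M} {x′ : ArcPair N}
           (s : Switchable M x) (s′ : Switchable N x′) {wf wf′}
           (f : Switch.network s wf ≅ₗ Switch.network s′ wf′) →
           ((_≅ₗ_.to f (Switchable.v s) , _≅ₗ_.to f (Switchable.y s))
           , (_≅ₗ_.to f (Switchable.v′ s) , _≅ₗ_.to f (Switchable.y′ s))) ≡ x′ →
           Σ (M ≅ₗ N) λ g → Matches g x x′
unswitch {M = M} {N} s s′ f eq = record
  { bijection = bijection
  ; to-edge   = λ u z → begin
      N.edge (to u) (to z)
        ≡⟨ undo (N.edge (to u) (to z)) (S′.rect (to u) (to z)) ⟨
      (N.edge (to u) (to z) xor S′.rect (to u) (to z)) xor S′.rect (to u) (to z)
        ≡⟨ cong₂ _xor_ (to-edge u z) (trans (cong (λ q → rectangle q (to u) (to z)) (sym eq))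
             (cong₂ _∧_ (∈₂-map to to-injective u _ _) (∈₂-map to to-injective z _ _))) ⟩
      (M.edge u z xor S.rect u z) xor S.rect u z
        ≡⟨ undo (M.edge u z) (S.rect u z) ⟩
      M.edge u z ∎
  ; to-taxon  = to-taxon
  } , eq
  where
  open ≡-Reasoning
  module M = Network M
  module N = Network N
  module S = Switch s
  module S′ = Switch s′
  open Iso f
  undo : ∀ a b → (a xor b) xor b ≡ a
  undo a b = trans (Bool.xor-assoc a b b) (trans (cong (a xor_) (Bool.xor-same b)) (Bool.xor-identityʳ a))

module _ {n} (𝓛 : NetworkList n) where
  open NetworkList 𝓛 renaming (list to L)

  -- The positions of the four vertices are kept as `marks b`, from which `unswitch` recovers the
  -- source. So `Y` only has to list candidates for these positions that can be found in the
  -- switched network alone.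
  switch-total-≤ :
    {B : Network n → Set} (X : ∀ N → List (ArcPair N)) (Y : ∀ N → List (B N)) →
    (∀ N → Unique (X N)) → (marks : ∀ {N} → B N → ArcPair N) →
    (valid : ∀ {M x} → x ∈ X M →
       Σ (Switchable M x) λ s → WellFounded (flip (LabelledDigraph._⟶_ (Switch.switched s)))) →
    (∀ {M N x} (x∈ : x ∈ X M) →
       (f : Switch.network (proj₁ (valid x∈)) (proj₂ (valid x∈)) ≅ₗ N) →
       let open _≅ₗ_ f ; (v , y) , (v′ , y′) = x in
       ∃[ b ] b ∈ Y N × ((to v , to y) , (to v′ , to y′)) ≡ marks b) →
    total L (length ∘ X) ≤ total L (length ∘ Y)
  switch-total-≤ {B} X Y X! marks valid image =
    total-≤-by-injection 𝓛 X Y X! (λ {M} {N} → Matches {n} {M} {N}) fixed Related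
      (λ {M} {x} x∈ → image′ {M} {x} x∈)
      (λ { {M} {M′} {N} {x} {x′} _ _ r r′ → reflect {M} {M′} {N} {x} {x′} r r′ })
    where
    fixed : ∀ {N : Network n} (f : N ≅ₗ N) {x y : ArcPair N} → (∀ v → _≅ₗ_.to f v ≡ v) → Matches f x y → x ≡ y
    fixed f id refl = cong₂ _,_ (cong₂ _,_ (sym (id _)) (sym (id _))) (cong₂ _,_ (sym (id _)) (sym (id _)))

    Related : ∀ {M N} → ArcPair M → B N → Set
    Related {M} {N} x b =
      Σ (Switchable M x) λ s → Σ _ λ wf → Σ (Switch.network s wf ≅ₗ N) λ f →
        let open _≅ₗ_ f ; (v , y) , (v′ , y′) = x in
        ((to v , to y) , (to v′ , to y′)) ≡ marks b

    image′ : ∀ {M x} → x ∈ X M → Σ (Network n) λ M′ →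
             ∀ {N} → M′ ≅ₗ N → ∃[ b ] b ∈ Y N × Related {M} {N} x b
    image′ {M} x∈ = Switch.network (proj₁ (valid x∈)) (proj₂ (valid x∈)) , λ f →
      let b , b∈ , eq = image x∈ f in b , b∈ , proj₁ (valid x∈) , proj₂ (valid x∈) , f , eq

    reflect : ∀ {M M′ N x x′} {b : B N} → Related {M} {N} x b → Related {M′} {N} x′ b →
              Σ (M ≅ₗ M′) λ f → Matches f x x′
    reflect {x′ = (v , y) , (v′ , y′)} (s , wf , f , eq) (s′ , wf′ , f′ , eq′) =
      unswitch s s′ (≅ₗ-trans f (≅ₗ-sym f′))
        (trans (cong (λ { ((a , b) , (c , d)) → (from a , from b) , (from c , from d) }) (trans eq (sym eq′)))
          (cong₂ _,_ (cong₂ _,_ (strictlyInverseʳ v) (strictlyInverseʳ y))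
                     (cong₂ _,_ (strictlyInverseʳ v′) (strictlyInverseʳ y′))))
      where open _≅ₗ_ f′

-- Making a direct leaf reticulate

card-false : ∀ m → card {m} (λ _ → false) ≡ 0
card-false zero    = refl
card-false (suc m) = card-false m

≟-refl : ∀ {m} (i : Fin m) → does (i Fin.≟ i) ≡ true
≟-refl i with i Fin.≟ i
... | yes _   = refl
... | no  i≢i = contradiction refl i≢i

≟-≢ : ∀ {m} {i j : Fin m} → i ≢ j → does (i Fin.≟ j) ≡ false
≟-≢ {i = i} {j} i≢j with i Fin.≟ j
... | yes i≡j = contradiction i≡j i≢j
... | no  _   = refl

≟-T : ∀ {m} {i j : Fin m} → T (does (i Fin.≟ j)) → i ≡ j
≟-T {i = i} {j} t with i Fin.≟ j
... | yes i≡j = i≡j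

card-point : ∀ {m} (i : Fin m) → card (λ j → does (j Fin.≟ i)) ≡ 1
card-point {m} i = trans (card-without (λ j → does (j Fin.≟ i)) i) (cong₂ _+_ (cong χ (≟-refl i))
  (trans (card-cong λ j → Bool.∧-inverseʳ (does (j Fin.≟ i))) (card-false m)))

card-∷∷ : ∀ {m} (f : Fin (suc (suc m)) → Bool) →
          card f ≡ χ (f zero) + (χ (f (suc zero)) + card (λ i → f (suc (suc i))))
card-∷∷ f = trans (card-∷ f) (cong (χ (f zero) +_) (card-∷ (f ∘ suc)))

IsDirect : ∀ {n} (N : Network n) → Fin (Network.size N) → Set
IsDirect N a = mark a ≡ leaf × (∃[ b ] b ⟶ a × mark b ≡ tree × (∀ w → b ⟶ w → mark w ≢ reticulation))
  where open Network N

isDirect? : ∀ {n} (N : Network n) → Decidable (IsDirect N)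
isDirect? N a = (mark a ≟ᵗ leaf) ×-dec Fin.any? λ b → Bool.T? (edge b a) ×-dec (mark b ≟ᵗ tree) ×-dec
  Fin.all? λ w → Bool.T? (edge b w) →-dec ¬? (mark w ≟ᵗ reticulation)
  where open Network N

record Insertable {n} (N : Network n) (x : Arc N) : Set where
  constructor insertable
  field
    direct : IsDirect N (proj₁ x)
    subdivided : Network.mark N (proj₂ x) ≡ tree

-- A new reticulation 0 subdivides the arc into the leaf a, a new tree vertex 1
-- subdivides the arc into t, and 1 becomes the second parent of 0.
module Insert {n} {N : Network n} {x : Arc N} (s : Insertable N x) where
  open Network N
  open Structure N
  open Insertable s

  a t b : Fin size
  a = proj₁ x
  t = proj₂ x
  b = proj₁ (proj₂ direct)

  a-leaf : mark a ≡ leaf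
  a-leaf = proj₁ direct
  b⟶a : b ⟶ a
  b⟶a = proj₁ (proj₂ (proj₂ direct))
  b-tree : mark b ≡ tree
  b-tree = proj₁ (proj₂ (proj₂ (proj₂ direct)))
  b-children : ∀ w → b ⟶ w → mark w ≢ reticulation
  b-children = proj₂ (proj₂ (proj₂ (proj₂ direct)))
  t-tree : mark t ≡ tree
  t-tree = subdivided

  t≢a : t ≢ a
  t≢a eq = tree≢leaf t-tree (trans (cong mark eq) a-leaf)

  inserted-edge : Fin (suc (suc size)) → Fin (suc (suc size)) → Bool
  inserted-edge zero          zero          = false
  inserted-edge zero          (suc zero)    = false
  inserted-edge zero          (suc (suc v)) = does (v Fin.≟ a)
  inserted-edge (suc zero)    zero          = true
  inserted-edge (suc zero)    (suc zero)    = false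
  inserted-edge (suc zero)    (suc (suc v)) = does (v Fin.≟ t)
  -- The parent of `a` is redirected to 0 and the parent of `t` to 1; the last clause clears the
  -- columns of `a` and `t`, whose only parents are now 0 and 1.
  inserted-edge (suc (suc u)) zero          = edge u a
  inserted-edge (suc (suc u)) (suc zero)    = edge u t
  inserted-edge (suc (suc u)) (suc (suc v)) = ((edge u without a) without t) v

  inserted-mark : Fin (suc (suc size)) → VertexType
  inserted-mark zero          = reticulation
  inserted-mark (suc zero)    = tree
  inserted-mark (suc (suc v)) = mark v

  inserted : LabelledDigraph n (suc (suc size))
  inserted = record
    { edge = inserted-edge ; origin = suc (suc origin) ; mark = inserted-mark
    ; taxon = λ i → suc (suc (taxon i)) }

  private module I = LabelledDigraph inserted

  old : ∀ {u v} → suc (suc u) I.⟶ suc (suc v) → u ⟶ v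
  old {u} {v} e = proj₁ (Equivalence.to (Bool.T-∧ {edge u v}) (proj₁ (Equivalence.to Bool.T-∧ e)))

  kept : ∀ {u v} → v ≢ a → v ≢ t → I.edge (suc (suc u)) (suc (suc v)) ≡ edge u v
  kept {u} {v} v≢a v≢t = trans
    (cong₂ (λ p q → (edge u v ∧ not p) ∧ not q) (≟-≢ v≢a) (≟-≢ v≢t))
    (trans (Bool.∧-identityʳ _) (Bool.∧-identityʳ _))

  cut-a : ∀ u → I.edge (suc (suc u)) (suc (suc a)) ≡ false
  cut-a u = cong (_∧ _) (trans (cong (λ p → edge u a ∧ not p) (≟-refl a)) (Bool.∧-zeroʳ (edge u a)))

  cut-t : ∀ u → I.edge (suc (suc u)) (suc (suc t)) ≡ false
  cut-t u = trans (cong (λ p → (edge u without a) t ∧ not p) (≟-refl t)) (Bool.∧-zeroʳ ((edge u without a) t))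

  indegree-a : card (λ u → edge u a) ≡ 1
  indegree-a = cong proj₁ (trans (typed a) (cong degrees a-leaf))

  indegree-t : card (λ u → edge u t) ≡ 1
  indegree-t = cong proj₁ (trans (typed t) (cong degrees t-tree))

  outdegree′ : ∀ u → I.outdegree u ≡ proj₂ (degrees (inserted-mark u))
  outdegree′ zero          = trans (card-∷∷ (I.edge zero)) (card-point a)
  outdegree′ (suc zero)    = trans (card-∷∷ (I.edge (suc zero))) (cong suc (card-point t))
  outdegree′ (suc (suc u)) = begin
    I.outdegree (suc (suc u))                     ≡⟨ card-∷∷ (I.edge (suc (suc u))) ⟩
    χ (edge u a) + (χ (edge u t) + rest)          ≡⟨ ℕ.+-assoc (χ (edge u a)) _ _ ⟨
    χ (edge u a) + χ (edge u t) + rest            ≡⟨ card-without₂ (edge u) (t≢a ∘ sym) ⟨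
    outdegree u                                   ≡⟨ cong proj₂ (typed u) ⟩
    proj₂ (degrees (mark u))                      ∎
    where
    open ≡-Reasoning
    rest = card ((edge u without a) without t)

  indegree′ : ∀ v → I.indegree v ≡ proj₁ (degrees (inserted-mark v))
  indegree′ zero          = trans (card-∷∷ (λ u → I.edge u zero)) (cong suc indegree-a)
  indegree′ (suc zero)    = trans (card-∷∷ (λ u → I.edge u (suc zero))) indegree-t
  indegree′ (suc (suc v)) = trans (card-∷∷ (λ u → I.edge u (suc (suc v))))
    (trans (by-cases (v Fin.≟ a) (v Fin.≟ t)) (cong proj₁ (typed v)))
    where
    rest = card (λ u → I.edge (suc (suc u)) (suc (suc v)))
    by-cases : Dec (v ≡ a) → Dec (v ≡ t) →
               χ (does (v Fin.≟ a)) + (χ (does (v Fin.≟ t)) + rest) ≡ indegree v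
    by-cases (yes refl) _ = trans
      (cong₂ _+_ (cong χ (≟-refl a)) (cong₂ _+_ (cong χ (≟-≢ (t≢a ∘ sym)))
        (trans (card-cong cut-a) (card-false size)))) (sym indegree-a)
    by-cases (no v≢a) (yes refl) = trans
      (cong₂ _+_ (cong χ (≟-≢ v≢a)) (cong₂ _+_ (cong χ (≟-refl t))
        (trans (card-cong cut-t) (card-false size)))) (sym indegree-t)
    by-cases (no v≢a) (no v≢t) =
      cong₂ _+_ (cong χ (≟-≢ v≢a)) (cong₂ _+_ (cong χ (≟-≢ v≢t)) (card-cong λ u → kept {u} {v} v≢a v≢t))

  acc-ret : Acc (flip I._⟶_) zero
  acc-ret = acc λ { {suc (suc v)} e → subst (λ x → Acc (flip I._⟶_) (suc (suc x))) (sym (≟-T {i = v} {a} e)) (acc λ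
    { {zero}        e′ → contradiction e′ (leaf-childless a-leaf)
    ; {suc zero}    e′ → contradiction e′ (leaf-childless a-leaf)
    ; {suc (suc w)} e′ → contradiction (old {a} {w} e′) (leaf-childless a-leaf) }) }

  acc-subdivision : Acc (flip I._⟶_) (suc (suc t)) → Acc (flip I._⟶_) (suc zero)
  acc-subdivision acc-t = acc λ
    { {zero}        _ → acc-ret
    ; {suc (suc w)} e → subst (λ x → Acc (flip I._⟶_) (suc (suc x))) (sym (≟-T {i = w} {t} e)) acc-t }

  -- An arc into 1 is by definition an old arc into `t`, so that the old accessibility still covers
  -- it.
  acc-old : ∀ v → Acc (flip _⟶_) v → Acc (flip I._⟶_) (suc (suc v))
  acc-old v (acc rs) = acc λ
    { {zero}        e → acc-ret
    ; {suc zero}    e → acc-subdivision (acc-old t (rs e))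
    ; {suc (suc w)} e → acc-old w (rs (old {v} {w} e)) }

  noetherian : WellFounded (flip I._⟶_)
  noetherian zero          = acc-ret
  noetherian (suc zero)    = acc-subdivision (acc-old t (descending t))
  noetherian (suc (suc v)) = acc-old v (descending v)

  TreeOrLeafChild : Fin (suc (suc size)) → Set
  TreeOrLeafChild u = ∃[ w ] u I.⟶ w × (inserted-mark w ≡ tree ⊎ inserted-mark w ≡ leaf)

  -- The critical vertex is `b`, whose leaf child is replaced by the reticulation 0: as `a` is
  -- direct, the other child of `b` is a tree vertex or a leaf. Wherever the witness would be `t`,
  -- the tree vertex 1 takes its place.
  tree-child′ : ∀ u → inserted-mark u ≢ leaf → TreeOrLeafChild u
  tree-child′ zero          _ = suc (suc a) , subst T (sym (≟-refl a)) _ , inj₂ a-leaf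
  tree-child′ (suc zero)    _ = suc (suc t) , subst T (sym (≟-refl t)) _ , inj₁ t-tree
  tree-child′ (suc (suc u)) m with tree-child u m
  ... | w , e , mw with w Fin.≟ a
  ...   | no  w≢a = via w w≢a e mw
    where
    via : ∀ w → w ≢ a → u ⟶ w → mark w ≡ tree ⊎ mark w ≡ leaf → TreeOrLeafChild (suc (suc u))
    via w w≢a e mw with w Fin.≟ t
    ... | yes w≡t = suc zero , subst (u ⟶_) w≡t e , inj₁ refl
    ... | no  w≢t = suc (suc w) , subst T (sym (kept w≢a w≢t)) e , mw
  ...   | yes w≡a with other-member (outdeg b-tree) (outs-unique b) (∈-outs b⟶a)
  ...     | c , c∈ , a≢c with c Fin.≟ t
  ...       | yes c≡t = suc zero , subst (u ⟶_) c≡t u⟶c , inj₁ refl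
    where
    u⟶c = subst (_⟶ c) (parent-unique (leaf≢ret a-leaf) b⟶a (subst (u ⟶_) w≡a e)) (outs⇒⟶ c∈)
  ...       | no c≢t = suc (suc c) , subst T (sym (kept (a≢c ∘ sym) c≢t)) u⟶c
                     , ≢ret⇒treeOrLeaf (outs⇒⟶ c∈) (b-children c (outs⇒⟶ c∈))
    where
    u⟶c = subst (_⟶ c) (parent-unique (leaf≢ret a-leaf) b⟶a (subst (u ⟶_) w≡a e)) (outs⇒⟶ c∈)

  network : Network n
  network = record
    { labelledDigraph = inserted
    ; isSimplexTreeChild = IsAcyclicTyped.isSimplexTreeChild record
        { typed            = λ v → cong₂ _,_ (indegree′ v) (outdegree′ v)
        ; origin-root      = origin-root
        ; root-unique      = λ { (suc (suc v)) m → cong (λ x → suc (suc x)) (root-unique v m) }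
        ; noetherian       = noetherian
        ; taxon-leaf       = taxon-leaf
        ; taxon-injective  = λ { i j eq → taxon-injective i j (Fin.suc-injective (Fin.suc-injective eq)) }
        ; taxon-surjective = λ { (suc (suc v)) m → let i , eq = taxon-surjective v m in i , cong (λ x → suc (suc x)) eq }
        ; tree-child       = tree-child′
        ; one-component    = λ
            { zero (suc (suc w)) _ e → trans (cong mark (≟-T {i = w} {a} e)) a-leaf
            ; (suc (suc u)) zero m e → contradiction m
                (subst (λ v → mark v ≢ reticulation) (parent-unique (leaf≢ret a-leaf) b⟶a e) (tree≢ret b-tree))
            ; (suc (suc u)) (suc zero) m e → contradiction (one-component u t m e) (tree≢leaf t-tree)
            ; (suc (suc u)) (suc (suc w)) m e → one-component u w m (old {u} {w} e) }
        }
    }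

  -- An old arc either survives or is subdivided by one of the new vertices. This expresses the old
  -- matrix through the new one, in a form that isomorphisms matching 0 and 1 preserve.
  recover : ∀ u v → edge u v ≡ I.edge (suc (suc u)) (suc (suc v))
                             ∨ ((I.edge (suc (suc u)) zero ∧ I.edge zero (suc (suc v)))
                             ∨ (I.edge (suc (suc u)) (suc zero) ∧ I.edge (suc zero) (suc (suc v))))
  recover u v with v Fin.≟ a | v Fin.≟ t
  ... | yes v≡a | yes v≡t = contradiction (trans (sym v≡t) v≡a) t≢a
  ... | yes refl | no  _ with edge u a | edge u t
  ...   | true  | _     = refl
  ...   | false | true  = refl
  ...   | false | false = refl
  recover u v | no  _   | yes refl with edge u a | edge u t
  ...   | true  | true  = refl
  ...   | true  | false = refl
  ...   | false | true  = refl
  ...   | false | false = refl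
  recover u v | no  _   | no  _ with edge u v | edge u a | edge u t
  ...   | true  | _     | _     = refl
  ...   | false | true  | true  = refl
  ...   | false | true  | false = refl
  ...   | false | false | true  = refl
  ...   | false | false | false = refl

strip : ∀ {k} (i : Fin (suc (suc k))) → i ≢ zero → i ≢ suc zero → ∃[ j ] i ≡ suc (suc j)
strip zero          i≢0 _   = contradiction refl i≢0
strip (suc zero)    _   i≢1 = contradiction refl i≢1
strip (suc (suc j)) _   _   = j , refl

MatchesArc : ∀ {n} {M N : Network n} → M ≅ₗ N → Arc M → Arc N → Set
MatchesArc f (a , t) x = (to a , to t) ≡ x
  where open _≅ₗ_ f

-- An isomorphism matching the new vertices restricts to the old ones and preserves the old arcs by
-- `recover`. It also matches `a` and `t`, the only old children of 0 and 1.
uninsert : ∀ {n} {M N : Network n} {x : Arc M} {x′ : Arc N}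
           (s : Insertable M x) (s′ : Insertable N x′)
           (f : Insert.network s ≅ₗ Insert.network s′) →
           _≅ₗ_.to f zero ≡ zero → _≅ₗ_.to f (suc zero) ≡ suc zero →
           Σ (M ≅ₗ N) λ g → MatchesArc g x x′
uninsert {n} {M} {N} {x} {x′} s s′ f 0↦0 1↦1 = record
  { bijection = mk↔ₛ′ (down f 0↦0 1↦1) (down f⁻¹ 0↤0 1↤1) to∘from from∘to
  ; to-edge   = λ u v → begin
      N.edge (⌊ u ⌋) (⌊ v ⌋)
        ≡⟨ S′.recover (⌊ u ⌋) (⌊ v ⌋) ⟩
      (S′.inserted-edge (suc (suc ⌊ u ⌋)) (suc (suc ⌊ v ⌋))
        ∨ ((S′.inserted-edge (suc (suc ⌊ u ⌋)) zero ∧ S′.inserted-edge zero (suc (suc ⌊ v ⌋)))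
        ∨ (S′.inserted-edge (suc (suc ⌊ u ⌋)) (suc zero) ∧ S′.inserted-edge (suc zero) (suc (suc ⌊ v ⌋)))))
        ≡⟨ cong₂ _∨_ (moved (old u) (old v))
             (cong₂ _∨_ (cong₂ _∧_ (moved (old u) 0↦0) (moved 0↦0 (old v)))
                        (cong₂ _∧_ (moved (old u) 1↦1) (moved 1↦1 (old v)))) ⟩
      (S.inserted-edge (suc (suc u)) (suc (suc v))
        ∨ ((S.inserted-edge (suc (suc u)) zero ∧ S.inserted-edge zero (suc (suc v)))
        ∨ (S.inserted-edge (suc (suc u)) (suc zero) ∧ S.inserted-edge (suc zero) (suc (suc v)))))
        ≡⟨ S.recover u v ⟨
      M.edge u v ∎
  ; to-taxon  = λ i → Fin.suc-injective (Fin.suc-injective (trans (sym (old (M.taxon i))) (f.to-taxon i)))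
  } , cong₂ _,_ (≟-T (subst T (sym (trans (moved 0↦0 (old S.a)) (≟-refl S.a))) _))
                (≟-T (subst T (sym (trans (moved 1↦1 (old S.t)) (≟-refl S.t))) _))
  where
  open ≡-Reasoning
  module M = Network M
  module N = Network N
  module S = Insert s
  module S′ = Insert s′
  module f = Iso f

  f⁻¹ : S′.network ≅ₗ S.network
  f⁻¹ = ≅ₗ-sym f

  0↤0 : f.from zero ≡ zero
  0↤0 = trans (cong f.from (sym 0↦0)) (f.strictlyInverseʳ zero)

  1↤1 : f.from (suc zero) ≡ suc zero
  1↤1 = trans (cong f.from (sym 1↦1)) (f.strictlyInverseʳ (suc zero))

  module _ {P Q : Network n} {p q} {σ : Insertable P p} {τ : Insertable Q q}
           (g : Insert.network σ ≅ₗ Insert.network τ)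
           (0↦ : _≅ₗ_.to g zero ≡ zero) (1↦ : _≅ₗ_.to g (suc zero) ≡ suc zero) where
    private module g = Iso g

    stripped : ∀ u → ∃[ v ] g.to (suc (suc u)) ≡ suc (suc v)
    stripped u = strip (g.to (suc (suc u)))
      (λ eq → contradiction (g.to-injective (trans eq (sym 0↦))) λ ())
      (λ eq → contradiction (g.to-injective (trans eq (sym 1↦))) λ ())

    down : Fin (Network.size P) → Fin (Network.size Q)
    down u = proj₁ (stripped u)

    down-to : ∀ u → g.to (suc (suc u)) ≡ suc (suc (down u))
    down-to u = proj₂ (stripped u)

  ⌊_⌋ : Fin M.size → Fin N.size
  ⌊_⌋ = down {σ = s} {τ = s′} f 0↦0 1↦1

  old : ∀ u → f.to (suc (suc u)) ≡ suc (suc ⌊ u ⌋)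
  old = down-to {σ = s} {τ = s′} f 0↦0 1↦1

  moved : ∀ {u u′ v v′} → f.to u ≡ u′ → f.to v ≡ v′ → S′.inserted-edge u′ v′ ≡ S.inserted-edge u v
  moved refl refl = f.to-edge _ _

  to∘from : ∀ v → ⌊ down {σ = s′} {τ = s} f⁻¹ 0↤0 1↤1 v ⌋ ≡ v
  to∘from v = Fin.suc-injective (Fin.suc-injective (trans (sym (old _))
    (trans (cong f.to (sym (down-to {σ = s′} {τ = s} f⁻¹ 0↤0 1↤1 v))) (f.strictlyInverseˡ _))))

  from∘to : ∀ u → down {σ = s′} {τ = s} f⁻¹ 0↤0 1↤1 ⌊ u ⌋ ≡ u
  from∘to u = Fin.suc-injective (Fin.suc-injective (trans (sym (down-to {σ = s′} {τ = s} f⁻¹ 0↤0 1↤1 _))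
    (trans (cong f.from (sym (old u))) (f.strictlyInverseʳ _))))

directs trees : ∀ {n} (N : Network n) → List (Fin (Network.size N))
directs N = filter (isDirect? N) (allFin _)
trees   N = filter (λ v → Network.mark N v ≟ᵗ tree) (allFin _)

arcs retArcs : ∀ {n} (N : Network n) → List (Arc N)
arcs N    = pairs (allFin _) (Structure.outs N)
retArcs N = filter (λ x → Network.mark N (proj₂ x) ≟ᵗ reticulation) (arcs N)

∈-arcs : ∀ {n} {N : Network n} {u v} → Network._⟶_ N u v → (u , v) ∈ arcs N
∈-arcs {N = N} e = ∈-pairs⁺ (∈-allFin _) (Structure.∈-outs N e)

arcs⇒⟶ : ∀ {n} {N : Network n} {x} → x ∈ arcs N → Network._⟶_ N (proj₁ x) (proj₂ x)
arcs⇒⟶ {N = N} x∈ = Structure.outs⇒⟶ N (proj₂ (∈-pairs⁻ (allFin _) x∈))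

arcs-unique : ∀ {n} (N : Network n) → Unique (arcs N)
arcs-unique N = pairs-unique (Unique.allFin⁺ _) (Structure.outs-unique N)

∈-retArcs : ∀ {n} {N : Network n} {u v} → Network._⟶_ N u v → Network.mark N v ≡ reticulation →
            (u , v) ∈ retArcs N
∈-retArcs {N = N} e m = ∈-filter⁺ _ (∈-arcs {N = N} e) m

retArcs⁻ : ∀ {n} {N : Network n} {x} → x ∈ retArcs N →
           Network._⟶_ N (proj₁ x) (proj₂ x) × Network.mark N (proj₂ x) ≡ reticulation
retArcs⁻ {N = N} x∈ = let x∈′ , m = ∈-filter⁻ (λ x → Network.mark N (proj₂ x) ≟ᵗ reticulation) {xs = arcs N} x∈
                      in arcs⇒⟶ {N = N} x∈′ , m

module _ {n} (𝓛 : NetworkList n) where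
  open NetworkList 𝓛 renaming (list to L)

  -- The mark left behind is the arc from 1 to 0: its head is a reticulation, and its two ends are
  -- all that `uninsert` asks for.
  total-direct : total L (λ N → length (directs N) * length (trees N)) ≤ total L (length ∘ retArcs)
  total-direct = ℕ.≤-trans (total-mono L λ {N} _ → ℕ.≤-reflexive (sym
      (trans (length-pairs (directs N) (λ _ → trees N)) (total-const (directs N) _))))
    (total-≤-by-injection 𝓛 X retArcs
      (λ N → pairs-unique (Unique.filter⁺ _ (Unique.allFin⁺ _)) (λ _ → Unique.filter⁺ _ (Unique.allFin⁺ _)))
      (λ {M} {N} → MatchesArc {n} {M} {N})
      (λ { f id refl → cong₂ _,_ (sym (id _)) (sym (id _)) }) Related
      (λ {M} {x} x∈ → Insert.network (valid {M} x∈) , λ {N} f →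
         let open Iso f in
         (to (suc zero) , to zero)
         , ∈-retArcs {N = N} (edge⁺ {suc zero} {zero} _) (mark-to f zero)
         , valid {M} x∈ , f , refl)
      (λ { {M} {M′} {N} {x} {x′} {b} _ _ r r′ → reflect {M} {M′} {N} {x} {x′} {b} r r′ }))
    where
    X : ∀ N → List (Arc N)
    X N = pairs (directs N) (λ _ → trees N)

    valid : ∀ {M x} → x ∈ X M → Insertable M x
    valid {M} x∈ = let a∈ , t∈ = ∈-pairs⁻ (directs M) x∈ in
      insertable (proj₂ (∈-filter⁻ (isDirect? M) {xs = allFin _} a∈))
      (proj₂ (∈-filter⁻ (λ v → Network.mark M v ≟ᵗ tree) {xs = allFin _} t∈))

    Related : ∀ {M N} → Arc M → Arc N → Set
    Related {M} {N} x b = Σ (Insertable M x) λ s → Σ (Insert.network s ≅ₗ N) λ f →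
      (_≅ₗ_.to f (suc zero) , _≅ₗ_.to f zero) ≡ b

    reflect : ∀ {M M′ N x x′ b} → Related {M} {N} x b → Related {M′} {N} x′ b →
              Σ (M ≅ₗ M′) λ f → MatchesArc f x x′
    reflect (s , f , eq) (s′ , f′ , eq′) = uninsert s s′ (≅ₗ-trans f (≅ₗ-sym f′))
      (trans (cong (from ∘ proj₂) (trans eq (sym eq′))) (strictlyInverseʳ _))
      (trans (cong (from ∘ proj₁) (trans eq (sym eq′))) (strictlyInverseʳ _))
      where open _≅ₗ_ f′

-- Vertex counts of a network

module Counts {n} (N : Network n) where
  open Network N
  open Structure N
  open SizeBound N using (#; balance; card-sum; size≤4n)

  rets : List (Fin size)
  rets = reticulations N

  k : ℕ
  k = length rets

  withMark : VertexType → List (Fin size)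
  withMark t = filter (λ v → mark v ≟ᵗ t) (allFin size)

  ∈-withMark : ∀ {v t} → mark v ≡ t → v ∈ withMark t
  ∈-withMark = ∈-filter⁺ _ (∈-allFin _)

  withMark⁻ : ∀ {v t} → v ∈ withMark t → mark v ≡ t
  withMark⁻ {t = t} v∈ = proj₂ (∈-filter⁻ (λ v → mark v ≟ᵗ t) {xs = allFin size} v∈)

  withMark-unique : ∀ t → Unique (withMark t)
  withMark-unique t = Unique.filter⁺ _ (Unique.allFin⁺ size)

  length-withMark : ∀ t → length (withMark t) ≡ # t
  length-withMark t = trans (length-filter-tabulate (λ v → mark v ≟ᵗ t) id) (card-sum λ v → does (mark v ≟ᵗ t))

  one-root : length (withMark root) ≡ 1
  one-root = ℕ.≤-antisym
    (⊆-length {ys = origin ∷ []} (withMark-unique root) λ v∈ → here (root-unique _ (withMark⁻ v∈)))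
    (⊆-length {xs = origin ∷ []} ([] ∷ []) λ { (here refl) → ∈-withMark origin-root })

  n-leaves : length (withMark leaf) ≡ n
  n-leaves = trans (ℕ.≤-antisym
    (length-≤ (λ v i → taxon i ≡ v) (withMark-unique leaf)
      (λ v∈ → let i , eq = taxon-surjective _ (withMark⁻ v∈) in i , ∈-allFin i , eq)
      (λ _ _ eq eq′ → trans (sym eq) eq′))
    (length-≤ (λ i v → taxon i ≡ v) (Unique.allFin⁺ n)
      (λ {i} _ → taxon i , ∈-withMark (taxon-leaf i) , refl)
      (λ _ _ eq eq′ → taxon-injective _ _ (trans eq (sym eq′)))))
    (length-tabulate id)

  tree-count : 1 + length (trees N) ≡ k + n
  tree-count = begin
    1 + length (withMark tree)                       ≡⟨ cong (_+ length (withMark tree)) one-root ⟨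
    length (withMark root) + length (withMark tree)  ≡⟨ cong₂ _+_ (length-withMark root) (length-withMark tree) ⟩
    # root + # tree                                  ≡⟨ balance ⟩
    # reticulation + # leaf                          ≡⟨ cong₂ _+_ (length-withMark reticulation) (length-withMark leaf) ⟨
    k + length (withMark leaf)                       ≡⟨ cong (k +_) n-leaves ⟩
    k + n                                            ∎
    where open ≡-Reasoning

  retArcs-unique : Unique (retArcs N)
  retArcs-unique = Unique.filter⁺ _ (arcs-unique N)

  length-retArcs : length (retArcs N) ≡ k * 2
  length-retArcs = trans (ℕ.≤-antisym
    (length-≤ (λ x y → (proj₂ x , proj₁ x) ≡ y) retArcs-unique
      (λ {(u , r)} x∈ → let e , m = retArcs⁻ {N = N} x∈ in (r , u) , ∈-pairs⁺ (∈-withMark m) (∈-ins e) , refl)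
      (λ { _ _ refl refl → refl }))
    (length-≤ (λ x y → (proj₂ x , proj₁ x) ≡ y) (pairs-unique (withMark-unique reticulation) ins-unique)
      (λ {(r , u)} x∈ → let r∈ , u∈ = ∈-pairs⁻ rets x∈ in (u , r) , ∈-retArcs {N = N} (ins⇒⟶ u∈) (withMark⁻ r∈) , refl)
      (λ { _ _ refl refl → refl })))
    (trans (length-pairs rets ins) (ℕ.≤-antisym
      (total-≤ rets λ r∈ → ℕ.≤-reflexive (indeg (withMark⁻ r∈)))
      (total-≥ rets λ r∈ → ℕ.≤-reflexive (sym (indeg (withMark⁻ r∈))))))

  HasRetChild : Fin size → Set
  HasRetChild v = ∃[ r ] v ⟶ r × mark r ≡ reticulation

  hasRetChild? : Decidable HasRetChild
  hasRetChild? v = Fin.any? λ r → Bool.T? (edge v r) ×-dec (mark r ≟ᵗ reticulation)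

  paths branchings : List (Fin size)
  paths      = filter hasRetChild? (trees N)
  branchings = filter (¬? ∘ hasRetChild?) (trees N)

  branchings⁻ : ∀ {v} → v ∈ branchings → mark v ≡ tree × ¬ HasRetChild v
  branchings⁻ v∈ = let v∈′ , p = ∈-filter⁻ (¬? ∘ hasRetChild?) {xs = trees N} v∈ in withMark⁻ v∈′ , p

  length-paths : length paths ≡ k * 2
  length-paths = trans (ℕ.≤-antisym
    (length-≤ (λ v x → v ≡ proj₁ x) (Unique.filter⁺ hasRetChild? (withMark-unique tree))
      (λ v∈ → let r , e , m = proj₂ (∈-filter⁻ hasRetChild? {xs = trees N} v∈)
              in (_ , r) , ∈-retArcs {N = N} e m , refl)
      (λ _ _ eq eq′ → trans eq (sym eq′)))
    (length-≤ (λ x v → proj₁ x ≡ v) retArcs-unique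
      (λ {(v , r)} x∈ → let e , m = retArcs⁻ {N = N} x∈ in
         v , ∈-filter⁺ hasRetChild? (∈-withMark (ret-parent-tree m e)) (r , e , m) , refl)
      (λ { x∈ x′∈ refl refl → let e , m = retArcs⁻ {N = N} x∈ ; e′ , m′ = retArcs⁻ {N = N} x′∈ in
           cong (_ ,_) (reticulate-child-unique m m′ e e′) })))
    length-retArcs

  leafArcs normalArcs : List (Arc N)
  leafArcs   = filter (λ x → mark (proj₂ x) ≟ᵗ leaf) (arcs N)
  normalArcs = filter (¬? ∘ λ x → mark (proj₁ x) ≟ᵗ reticulation) leafArcs

  ∈-leafArcs : ∀ {u v} → u ⟶ v → mark v ≡ leaf → (u , v) ∈ leafArcs
  ∈-leafArcs e = ∈-filter⁺ _ (∈-arcs {N = N} e)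

  leafArcs⁻ : ∀ {x} → x ∈ leafArcs → proj₁ x ⟶ proj₂ x × mark (proj₂ x) ≡ leaf
  leafArcs⁻ x∈ = let x∈′ , m = ∈-filter⁻ (λ x → mark (proj₂ x) ≟ᵗ leaf) {xs = arcs N} x∈
                 in arcs⇒⟶ {N = N} x∈′ , m

  normalArcs⁻ : ∀ {x} → x ∈ normalArcs →
                proj₁ x ⟶ proj₂ x × mark (proj₂ x) ≡ leaf × mark (proj₁ x) ≢ reticulation
  normalArcs⁻ x∈ =
    let x∈′ , p = ∈-filter⁻ (¬? ∘ λ x → mark (proj₁ x) ≟ᵗ reticulation) {xs = leafArcs} x∈
        e , m   = leafArcs⁻ x∈′
    in e , m , p

  leafArcs-unique : Unique leafArcs
  leafArcs-unique = Unique.filter⁺ _ (arcs-unique N)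

  length-leafArcs : length leafArcs ≡ n
  length-leafArcs = trans (ℕ.≤-antisym
    (length-≤ (λ x v → proj₂ x ≡ v) leafArcs-unique
      (λ x∈ → _ , ∈-withMark (proj₂ (leafArcs⁻ x∈)) , refl)
      (λ { x∈ x′∈ refl refl → let e , m = leafArcs⁻ x∈ in
           cong (_, _) (parent-unique (leaf≢ret m) e (proj₁ (leafArcs⁻ x′∈))) }))
    (length-≤ (λ v x → v ≡ proj₂ x) (withMark-unique leaf)
      (λ {v} v∈ → let m = withMark⁻ v∈
                      u , e = parent-exists (λ m′ → contradiction (trans (sym m) m′) λ ())
                  in (u , v) , ∈-leafArcs e m , refl)
      (λ _ _ eq eq′ → trans eq (sym eq′))))
    n-leaves

  J : ℕ
  J = length normalArcs

  k+J≡n : k + J ≡ n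
  k+J≡n = trans (cong (_+ J) (sym ret-part)) (trans
    (length-filter-split (λ x → mark (proj₁ x) ≟ᵗ reticulation) leafArcs) length-leafArcs)
    where
    retLeafArcs⁻ : ∀ {x} → x ∈ filter (λ x → mark (proj₁ x) ≟ᵗ reticulation) leafArcs →
                   proj₁ x ⟶ proj₂ x × mark (proj₁ x) ≡ reticulation
    retLeafArcs⁻ x∈ = let x∈′ , m = ∈-filter⁻ (λ x → mark (proj₁ x) ≟ᵗ reticulation) {xs = leafArcs} x∈
                      in proj₁ (leafArcs⁻ x∈′) , m
    ret-part : length (filter (λ x → mark (proj₁ x) ≟ᵗ reticulation) leafArcs) ≡ k
    ret-part = ℕ.≤-antisym
      (length-≤ (λ x v → proj₁ x ≡ v) (Unique.filter⁺ _ leafArcs-unique)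
        (λ x∈ → _ , ∈-withMark (proj₂ (retLeafArcs⁻ x∈)) , refl)
        (λ { x∈ x′∈ refl refl → let e , m = retLeafArcs⁻ x∈ in
             cong (_ ,_) (ret-child-unique m e (proj₁ (retLeafArcs⁻ x′∈))) }))
      (length-≤ (λ v x → v ≡ proj₁ x) (withMark-unique reticulation)
        (λ {v} v∈ → let m = withMark⁻ v∈
                        w , e , _ = nonret-child (λ m′ → contradiction (trans (sym m) m′) λ ())
                    in (v , w) , ∈-filter⁺ _ (∈-leafArcs e (one-component v w m e)) m , refl)
        (λ _ _ eq eq′ → trans eq (sym eq′)))

  -- The degree balance gives k + n - 1 tree vertices. Exactly 2 k of them have a reticulation
  -- child, because no vertex is a parent of two reticulations; n - k - 1 = J - 1 remain.
  1+branchings≡J : 1 + length branchings ≡ J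
  1+branchings≡J = ℕ.+-cancelˡ-≡ (k + k) _ _ (begin
    (k + k) + (1 + length branchings)            ≡⟨ cong (_+ (1 + length branchings)) k+k≡k*2 ⟩
    k * 2 + (1 + length branchings)              ≡⟨ ℕ.+-suc (k * 2) _ ⟩
    1 + (k * 2 + length branchings)              ≡⟨ cong (λ m → 1 + (m + length branchings)) length-paths ⟨
    1 + (length paths + length branchings)       ≡⟨ cong suc (length-filter-split hasRetChild? (trees N)) ⟩
    1 + length (trees N)                         ≡⟨ tree-count ⟩
    k + n                                        ≡⟨ cong (k +_) k+J≡n ⟨
    k + (k + J)                                  ≡⟨ ℕ.+-assoc k k J ⟨
    (k + k) + J                                  ∎)
    where
    open ≡-Reasoning
    k+k≡k*2 : k + k ≡ k * 2
    k+k≡k*2 = trans (cong (k +_) (sym (ℕ.+-identityʳ k))) (ℕ.*-comm 2 k)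

  irregular : List (Fin size)
  irregular = origin ∷ branchings ++ List.map proj₂ normalArcs

  length-irregular : length irregular ≡ J + J
  length-irregular = begin
    suc (length (branchings ++ List.map proj₂ normalArcs)) ≡⟨ cong suc (length-++ branchings) ⟩
    suc (length branchings) + length (List.map proj₂ normalArcs)
      ≡⟨ cong₂ _+_ 1+branchings≡J (length-map proj₂ normalArcs) ⟩
    J + J ∎
    where open ≡-Reasoning

  regular-≢root : ∀ {v} → v ∉ irregular → mark v ≢ root
  regular-≢root v∉ m = v∉ (here (root-unique _ m))

  regular-tree : ∀ {v} → v ∉ irregular → mark v ≡ tree → HasRetChild v
  regular-tree {v} v∉ m with hasRetChild? v
  ... | yes h = h
  ... | no ¬h = contradiction (there (∈-++⁺ˡ (∈-filter⁺ _ (∈-withMark m) ¬h))) v∉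

  regular-leaf : ∀ {u v} → v ∉ irregular → mark v ≡ leaf → u ⟶ v → mark u ≡ reticulation
  regular-leaf {u} {v} v∉ m e with mark u ≟ᵗ reticulation
  ... | yes mu = mu
  ... | no ¬mu = contradiction (there (∈-++⁺ʳ branchings (∈-map⁺ proj₂ (∈-filter⁺ _ (∈-leafArcs e m) ¬mu)))) v∉

  length-arcs : length (arcs N) ≤ n * 8
  length-arcs = begin
    length (arcs N)                 ≡⟨ length-pairs (allFin size) outs ⟩
    total (allFin size) (length ∘ outs) ≤⟨ total-≤ (allFin size) (λ {v} _ → outdegree≤2 v) ⟩
    length (allFin size) * 2        ≡⟨ cong (_* 2) (length-tabulate {n = size} id) ⟩
    size * 2                        ≤⟨ ℕ.*-monoˡ-≤ 2 size≤4n ⟩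
    ((n + n) + (n + n)) * 2         ≡⟨ solve 1 (λ n → ((n :+ n) :+ (n :+ n)) :* con 2 := n :* con 8) refl n ⟩
    n * 8                           ∎
    where
    open ℕ.≤-Reasoning
    open +-*-Solver

-- Regrafting a normal leaf

isDirect-to : ∀ {n} {M N : Network n} (f : M ≅ₗ N) {a} → IsDirect M a → IsDirect N (_≅ₗ_.to f a)
isDirect-to {M = M} {N} f (ma , b , e , mb , children) =
  trans (mark-to f _) ma , to b , edge⁺ e , trans (mark-to f b) mb , λ w e′ m →
    children (from w)
      (edge⁻ (subst (Network._⟶_ N (to b)) (sym (strictlyInverseˡ w)) e′))
      (trans (sym (mark-to f (from w))) (trans (cong (Network.mark N) (strictlyInverseˡ w)) m))
  where open Iso f

module _ {A : Set} {_⟶_ : Rel A 0ℓ} where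

  unsnoc : ∀ {u v} → Star _⟶_ u v → u ≡ v ⊎ (∃[ w ] Star _⟶_ u w × w ⟶ v)
  unsnoc ε = inj₁ refl
  unsnoc (e ◅ p) with unsnoc p
  ... | inj₁ refl        = inj₂ (_ , ε , e)
  ... | inj₂ (w , q , d) = inj₂ (w , e ◅ q , d)

  ⟶◅⇒⁺ : ∀ {u v w} → u ⟶ v → Star _⟶_ v w → TransClosure _⟶_ u w
  ⟶◅⇒⁺ e ε       = [ e ]
  ⟶◅⇒⁺ e (d ◅ p) = e ∷ ⟶◅⇒⁺ d p

-- Chains of ancestors

module Ancestors {n} (N : Network n) where
  open Network N
  open Structure N
  open Counts N

  -- Climbing from such a `z` never branches: a reticulation has only a leaf below it, so that no
  -- proper ancestor of `z` reached on the way has two parents.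
  comparable : ∀ {c c′} z → Acc _⟶_ z → mark z ≢ reticulation → mark z ≢ leaf →
               Star _⟶_ c z → Star _⟶_ c′ z → Star _⟶_ c c′ ⊎ Star _⟶_ c′ c
  comparable z (acc rs) mz lz p q with unsnoc p | unsnoc q
  ... | inj₁ refl | _ = inj₂ q
  ... | _ | inj₁ refl = inj₁ p
  ... | inj₂ (u , p′ , e) | inj₂ (u′ , q′ , e′) with parent-unique mz e e′
  ... | refl = comparable u (rs e) (λ mu → lz (one-component u z mu e))
                 (λ mu → leaf-childless mu e) p′ q′

  -- The last arc of a path into `c′` starts at its only parent `v`, and the path would close a
  -- directed cycle through `v`.
  siblings-not-comparable : ∀ {v c c′} → v ⟶ c → v ⟶ c′ → c ≢ c′ → mark c′ ≢ reticulation →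
                            ¬ Star _⟶_ c c′
  siblings-not-comparable {v} e e′ c≢c′ mc′ p with unsnoc p
  ... | inj₁ c≡c′ = c≢c′ c≡c′
  ... | inj₂ (u , p′ , d) with refl ← parent-unique mc′ d e′ = acyclic v (⟶◅⇒⁺ e p′)

  -- If both children of `v` were ancestors of `x`, they would be comparable, which siblings are
  -- not.
  nonancestral-child : ∀ {v x} → v ∈ branchings → mark x ≢ reticulation → mark x ≢ leaf →
                       ∃[ y ] v ⟶ y × ¬ Star _⟶_ y x
  nonancestral-child {v} {x} v∈ mx lx =
    let mv , nonret    = branchings⁻ v∈
        c , c∈         = some-member (outdeg mv)
        c′ , c′∈ , c≢c′ = other-member (outdeg mv) (outs-unique v) c∈
    in decide (outs⇒⟶ c∈) (outs⇒⟶ c′∈) c≢c′ (λ m → nonret (c , outs⇒⟶ c∈ , m)) (λ m → nonret (c′ , outs⇒⟶ c′∈ , m))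
    where
    star : ∀ u w → Dec (Star _⟶_ u w)
    star = star? (listingFin size) Fin._≟_ (λ u w → Bool.T? (edge u w))
    decide : ∀ {c c′} → v ⟶ c → v ⟶ c′ → c ≢ c′ → mark c ≢ reticulation → mark c′ ≢ reticulation →
             ∃[ y ] v ⟶ y × ¬ Star _⟶_ y x
    decide {c} {c′} e e′ c≢c′ mc mc′ with star c x | star c′ x
    ... | no ¬p | _     = c , e , ¬p
    ... | yes _ | no ¬q = c′ , e′ , ¬q
    ... | yes p | yes q = contradiction
          (comparable x (proj₁ (acyclic⇒wellFounded acyclic) x) mx lx p q)
          [ siblings-not-comparable e e′ c≢c′ mc′ , siblings-not-comparable e′ e (c≢c′ ∘ sym) mc ]′

-- A normal leaf a with parent x is hung at a branching v instead of a child y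
-- of v, which becomes a child of x.  No cycle arises if y is not an ancestor of x.
module Regraft {n} (N : Network n) where
  open Network N
  open Structure N
  open Counts N
  open Ancestors N

  Target : Arc N → Arc N → Set
  Target (x , a) (v , y) = v ≢ x × ¬ Star _⟶_ y x

  target? : ∀ p → Decidable (Target p)
  target? (x , a) (v , y) = ¬? (v Fin.≟ x) ×-dec
    ¬? (star? (listingFin size) Fin._≟_ (λ u w → Bool.T? (edge u w)) y x)

  targets : Arc N → List (Arc N)
  targets p = filter (target? p) (pairs branchings outs)

  branchings-unique : Unique branchings
  branchings-unique = Unique.filter⁺ _ (Unique.filter⁺ _ (Unique.allFin⁺ size))

  regrafts : List (ArcPair N)
  regrafts = pairs normalArcs targets

  regrafts-unique : Unique regrafts
  regrafts-unique = pairs-unique (Unique.filter⁺ _ leafArcs-unique)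
    λ p → Unique.filter⁺ (target? p) (pairs-unique branchings-unique outs-unique)

  -- Every branching other than `x` offers a target by `nonancestral-child`; at most one branching
  -- is lost.
  length-targets : ∀ {p} → p ∈ normalArcs → length branchings ≤ suc (length (targets p))
  length-targets {x , a} p∈ = begin
    length branchings                    ≡⟨ length-filter-split (Fin._≟ x) branchings ⟨
    length (filter (Fin._≟ x) branchings) + length (filter (¬? ∘ (Fin._≟ x)) branchings)
      ≤⟨ ℕ.+-mono-≤
        (⊆-length {ys = x ∷ []} (Unique.filter⁺ (Fin._≟ x) branchings-unique)
          λ v∈ → here (proj₂ (∈-filter⁻ (Fin._≟ x) {xs = branchings} v∈)))
        (length-≤ (λ v q → v ≡ proj₁ q) (Unique.filter⁺ (¬? ∘ (Fin._≟ x)) branchings-unique)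
          (λ {v} v∈ →
            let v∈′ , v≢x = ∈-filter⁻ (¬? ∘ (Fin._≟ x)) {xs = branchings} v∈
                e , m , mx = normalArcs⁻ p∈
                y , d , ¬p = nonancestral-child v∈′ mx (λ lx → leaf-childless lx e)
            in (v , y) , ∈-filter⁺ (target? (x , a)) (∈-pairs⁺ v∈′ (∈-outs d)) (v≢x , ¬p) , refl)
          (λ _ _ eq eq′ → trans eq (sym eq′))) ⟩
    suc (length (targets (x , a)))       ∎
    where open ℕ.≤-Reasoning

  -- With J - 1 branchings, the left side is J (J - 2).
  length-regrafts : J * (length branchings ∸ 1) ≤ length regrafts
  length-regrafts = subst (J * (length branchings ∸ 1) ≤_) (sym (length-pairs normalArcs targets))
    (total-≥ normalArcs λ p∈ → ℕ.∸-monoˡ-≤ 1 (length-targets p∈))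

  module _ {x a v y} (q∈ : ((x , a) , (v , y)) ∈ regrafts) where
    private
      p∈ : (x , a) ∈ normalArcs
      p∈ = proj₁ (∈-pairs⁻ normalArcs q∈)
      t∈ : (v , y) ∈ pairs branchings outs × Target (x , a) (v , y)
      t∈ = ∈-filter⁻ (target? (x , a)) {xs = pairs branchings outs} (proj₂ (∈-pairs⁻ normalArcs q∈))
      v∈ : v ∈ branchings
      v∈ = proj₁ (∈-pairs⁻ branchings (proj₁ t∈))
      x⟶a : x ⟶ a
      x⟶a = proj₁ (normalArcs⁻ p∈)
      ma : mark a ≡ leaf
      ma = proj₁ (proj₂ (normalArcs⁻ p∈))
      v⟶y : v ⟶ y
      v⟶y = outs⇒⟶ (proj₂ (∈-pairs⁻ branchings (proj₁ t∈)))
      v≢x : v ≢ x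
      v≢x = proj₁ (proj₂ t∈)
      my : mark y ≢ reticulation
      my m = proj₂ (branchings⁻ v∈) (y , v⟶y , m)

    regraft : Switchable N ((x , a) , (v , y))
    regraft = record
      { arc     = x⟶a
      ; arc′    = v⟶y
      ; v≢v′    = v≢x ∘ sym
      ; y≢y′    = λ { refl → v≢x (parent-unique my v⟶y x⟶a) }
      ; no-arc  = λ e → v≢x (parent-unique my v⟶y e)
      ; no-arc′ = λ e → v≢x (parent-unique (leaf≢ret ma) e x⟶a)
      ; v≢ret   = proj₂ (proj₂ (normalArcs⁻ p∈))
      ; v′≢ret  = tree≢ret (proj₁ (branchings⁻ v∈))
      ; alike   = inj₁ (inj₂ ma , ≢ret⇒treeOrLeaf v⟶y my)
      }

    private
      module S = Switch regraft
      _⟶ˢ_ = LabelledDigraph._⟶_ S.switched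

    acc-a : Acc (flip _⟶ˢ_) a
    acc-a = acc λ {z} e → case (S.view e)
      where
      case : ∀ {z} → (a ⟶ z) ⊎ (a ≡ x × z ≡ y) ⊎ (a ≡ v × z ≡ a) → Acc (flip _⟶ˢ_) z
      case (inj₁ e)                 = contradiction e (leaf-childless ma)
      case (inj₂ (inj₁ (refl , _))) = contradiction x⟶a (leaf-childless ma)
      case (inj₂ (inj₂ (refl , _))) = contradiction ma (tree≢leaf (proj₁ (branchings⁻ v∈)))

    -- Below `y` nothing leads back to `y`: the new arc into `y` leaves `x`, which is not a
    -- descendant of `y`, and the new arc out of `v` ends in the leaf `a`.
    acc-below : ∀ z → Acc (flip _⟶_) z → Star _⟶_ y z → Acc (flip _⟶ˢ_) z
    acc-below z (acc rs) p = acc λ e → case (S.view e)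
      where
      case : ∀ {w} → (z ⟶ w) ⊎ (z ≡ x × w ≡ y) ⊎ (z ≡ v × w ≡ a) → Acc (flip _⟶ˢ_) w
      case (inj₁ e)                    = acc-below _ (rs e) (p ◅◅ e ◅ ε)
      case (inj₂ (inj₁ (refl , _)))    = contradiction p (proj₂ (proj₂ t∈))
      case (inj₂ (inj₂ (refl , refl))) = acc-a

    regraft-wellFounded : WellFounded (flip _⟶ˢ_)
    regraft-wellFounded z = go z (descending z)
      where
      go : ∀ z → Acc (flip _⟶_) z → Acc (flip _⟶ˢ_) z
      go z (acc rs) = acc λ e → case (S.view e)
        where
        case : ∀ {w} → (z ⟶ w) ⊎ (z ≡ x × w ≡ y) ⊎ (z ≡ v × w ≡ a) → Acc (flip _⟶ˢ_) w
        case (inj₁ e)                    = go _ (rs e)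
        case (inj₂ (inj₁ (_ , refl)))    = acc-below y (descending y) ε
        case (inj₂ (inj₂ (_ , refl)))    = acc-a

    regrafted : Network n
    regrafted = S.network regraft-wellFounded

    regrafted-direct : IsDirect regrafted a
    regrafted-direct = ma , v , S.fresh′ , proj₁ (branchings⁻ v∈) , λ w e → case (S.view e)
      where
      case : ∀ {w} → (v ⟶ w) ⊎ (v ≡ x × w ≡ y) ⊎ (v ≡ v × w ≡ a) → mark w ≢ reticulation
      case (inj₁ e) m                  = proj₂ (branchings⁻ v∈) (_ , e , m)
      case (inj₂ (inj₁ (v≡x , _)))     = contradiction v≡x v≢x
      case (inj₂ (inj₂ (_ , refl)))    = leaf≢ret ma

-- The direct leaf `a` with its parent `v`, and the arc from `x` to `y`. Beyond the choice of a
-- direct leaf, only this arc costs a factor of order n.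
regraftMarks : ∀ {n} (N : Network n) → List (Σ (Arc N) λ _ → Arc N)
regraftMarks N = pairs (pairs (directs N) (Structure.ins N)) (λ _ → arcs N)

length-regraftMarks : ∀ {n} (N : Network n) → length (regraftMarks N) ≤ length (directs N) * 2 * (n * 8)
length-regraftMarks {n} N = begin
  length (regraftMarks N)                                   ≡⟨ length-pairs (pairs (directs N) ins) (λ _ → arcs N) ⟩
  total (pairs (directs N) ins) (λ _ → length (arcs N))     ≡⟨ total-const (pairs (directs N) ins) _ ⟩
  length (pairs (directs N) ins) * length (arcs N)          ≤⟨ ℕ.*-mono-≤ directs*2 (Counts.length-arcs N) ⟩
  length (directs N) * 2 * (n * 8)                          ∎
  where
  open ℕ.≤-Reasoning
  open Structure N
  directs*2 : length (pairs (directs N) ins) ≤ length (directs N) * 2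
  directs*2 = subst (_≤ length (directs N) * 2) (sym (length-pairs (directs N) ins)) (total-≤ (directs N) λ {v} _ → indegree≤2 v)

module _ {n} (𝓛 : NetworkList n) where
  open NetworkList 𝓛 renaming (list to L)

  total-regrafts : total L (λ N → length (Regraft.regrafts N)) ≤ total L (λ N → length (regraftMarks N))
  total-regrafts = switch-total-≤ 𝓛 Regraft.regrafts regraftMarks Regraft.regrafts-unique
    (λ { ((a , v) , (x , y)) → (x , a) , (v , y) })
    (λ {M} q∈ → Regraft.regraft M q∈ , Regraft.regraft-wellFounded M q∈)
    λ {M} {N} q∈ f →
      let open Iso f ; module S = Switch (Regraft.regraft M q∈) in
      _ , ∈-pairs⁺ (∈-pairs⁺ (∈-filter⁺ (isDirect? N) (∈-allFin _) (isDirect-to f (Regraft.regrafted-direct M q∈)))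
                             (Structure.∈-ins N (edge⁺ S.fresh′)))
                   (∈-arcs {N = N} (edge⁺ S.fresh)) , refl

-- Breaking short cycles

-- The factor 4 allows two parents and two children at every vertex.
ballSize : ℕ → ℕ
ballSize zero    = 1
ballSize (suc R) = 1 + 4 * ballSize R

cut : ∀ {n} (N : Network n) → Arc N → MarkedDigraph
cut N (v , r) = record
  { Vertex = Fin size ; _⟶_ = λ u w → u ⟶ w × ¬ (u ≡ v × w ≡ r) ; mark = mark }
  where open Network N

within-dec : ∀ {m} {_⟶_ : Rel (Fin m) 0ℓ} {mark} → (∀ u v → Dec (u ⟶ v)) →
             ∀ R u v → Dec (Within (record { Vertex = Fin m ; _⟶_ = _⟶_ ; mark = mark }) R u v)
within-dec _⟶?_ zero u v = map′ (λ { refl → here }) (λ { here → refl }) (u Fin.≟ v)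
within-dec _⟶?_ (suc R) u v = map′
  [ (λ { refl → here }) , (λ { (w , inj₁ e , p) → step (fwd e) p ; (w , inj₂ e , p) → step (bwd e) p }) ]′
  (λ { here → inj₁ refl ; (step (fwd e) p) → inj₂ (_ , inj₁ e , p) ; (step (bwd e) p) → inj₂ (_ , inj₂ e , p) })
  ((u Fin.≟ v) ⊎-dec Fin.any? λ w → ((u ⟶? w) ⊎-dec (w ⟶? u)) ×-dec within-dec _⟶?_ R w v)

-- The arc lies on an undirected cycle of length at most L + 1.
OnCycle : ∀ {n} (N : Network n) → ℕ → Arc N → Set
OnCycle N L x = Within (cut N x) L (proj₁ x) (proj₂ x)

onCycle? : ∀ {n} (N : Network n) L → Decidable (OnCycle N L)
onCycle? N L (v , r) = within-dec (λ u w → Bool.T? (edge u w) ×-dec ¬? ((u Fin.≟ v) ×-dec (w Fin.≟ r))) L v r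
  where open Network N

module Balls {n} (N : Network n) where
  open Network N
  open Structure N

  neighbours : Fin size → List (Fin size)
  neighbours v = ins v ++ outs v

  ball : ℕ → Fin size → List (Fin size)
  ball zero    v = v ∷ []
  ball (suc R) v = v ∷ concatMap (ball R) (neighbours v)

  ∈-ball : ∀ {R u v} → Within markedDigraph R u v → v ∈ ball R u
  ∈-ball {zero}  here = here refl
  ∈-ball {suc R} here = here refl
  ∈-ball {suc R} {u} (step e p) = there (∈-concatMap⁺ (ball R) (Any.map (λ { refl → ∈-ball p }) (adjacent e)))
    where
    adjacent : ∀ {w} → SymClosure _⟶_ u w → w ∈ neighbours u
    adjacent (fwd e) = ∈-++⁺ʳ (ins u) (∈-outs e)
    adjacent (bwd e) = ∈-++⁺ˡ (∈-ins e)

  length-ball : ∀ R v → length (ball R v) ≤ ballSize R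
  length-ball zero    v = s≤s z≤n
  length-ball (suc R) v = s≤s (begin
    length (concatMap (ball R) (neighbours v))     ≡⟨ length-concatMap (ball R) (neighbours v) ⟩
    total (neighbours v) (length ∘ ball R)         ≤⟨ total-≤ (neighbours v) (λ {w} _ → length-ball R w) ⟩
    length (neighbours v) * ballSize R             ≡⟨ cong (_* ballSize R) (length-++ (ins v)) ⟩
    (length (ins v) + length (outs v)) * ballSize R ≤⟨ ℕ.*-monoˡ-≤ (ballSize R) (ℕ.+-mono-≤ (indegree≤2 v) (outdegree≤2 v)) ⟩
    4 * ballSize R                                 ∎)
    where open ℕ.≤-Reasoning

-- An arc v → r on a short cycle is switched with an arc v′ → r′ away from
-- it.  The rest of the cycle survives as a short walk from v to r.
module Rewire {n} (l : ℕ) (N : Network n) where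
  open Network N
  open Structure N
  open Counts N
  open Balls N
  open DecMembership (Fin._≟_ {size}) using (_∈?_)

  L : ℕ
  -- At least 2, so that a tail outside the ball of radius `L` around `v` cannot be another parent
  -- of `r`.
  L = suc (suc l)

  cycleArcs : List (Arc N)
  cycleArcs = filter (onCycle? N L) (retArcs N)

  far? : (x : Arc N) → Decidable (λ (x′ : Arc N) → proj₁ x′ ∉ ball L (proj₁ x))
  far? x x′ = ¬? (proj₁ x′ ∈? ball L (proj₁ x))

  farArcs : Arc N → List (Arc N)
  farArcs x = filter (far? x) (retArcs N)

  rewirings : List (ArcPair N)
  rewirings = pairs cycleArcs farArcs

  rewirings-unique : Unique rewirings
  rewirings-unique = pairs-unique (Unique.filter⁺ _ retArcs-unique) λ x → Unique.filter⁺ (far? x) retArcs-unique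

  -- Arcs into reticulations are determined by their tails, so that no more of them start in a ball
  -- than it has vertices.
  length-farArcs : ∀ x → k * 2 ≤ ballSize L + length (farArcs x)
  length-farArcs x = begin
    k * 2                                       ≡⟨ length-retArcs ⟨
    length (retArcs N)                          ≡⟨ length-filter-split (far? x) (retArcs N) ⟨
    length (farArcs x) + length near            ≡⟨ ℕ.+-comm (length (farArcs x)) _ ⟩
    length near + length (farArcs x)            ≤⟨ ℕ.+-monoˡ-≤ (length (farArcs x)) (ℕ.≤-trans near≤ball (length-ball L (proj₁ x))) ⟩
    ballSize L + length (farArcs x)             ∎
    where
    open ℕ.≤-Reasoning
    near : List (Arc N)
    near = filter (¬? ∘ far? x) (retArcs N)
    near⁻ : ∀ {y} → y ∈ near → y ∈ retArcs N × proj₁ y ∈ ball L (proj₁ x)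
    near⁻ {y} y∈ with ∈-filter⁻ (¬? ∘ far? x) {xs = retArcs N} y∈
    ... | y∈′ , ¬far with proj₁ y ∈? ball L (proj₁ x)
    ...   | yes p = y∈′ , p
    ...   | no ¬p = contradiction ¬p ¬far
    near≤ball : length near ≤ length (ball L (proj₁ x))
    near≤ball = length-≤ (λ y v → proj₁ y ≡ v) (Unique.filter⁺ _ retArcs-unique)
      (λ y∈ → _ , proj₂ (near⁻ y∈) , refl)
      (λ { y∈ y∈′ refl refl → let e , m = retArcs⁻ {N = N} (proj₁ (near⁻ y∈)) ; e′ , m′ = retArcs⁻ {N = N} (proj₁ (near⁻ y∈′)) in
           cong (_ ,_) (reticulate-child-unique m m′ e e′) })

  length-rewirings : length cycleArcs * (k * 2 ∸ ballSize L) ≤ length rewirings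
  length-rewirings = subst (length cycleArcs * (k * 2 ∸ ballSize L) ≤_) (sym (length-pairs cycleArcs farArcs))
    (total-≥ cycleArcs λ {x} _ → ℕ.m≤n+o⇒m∸n≤o (k * 2) (ballSize L) (length-farArcs x))

  module _ {v r v′ r′} (q∈ : ((v , r) , (v′ , r′)) ∈ rewirings) where
    private
      x∈ : (v , r) ∈ retArcs N × OnCycle N L (v , r)
      x∈ = ∈-filter⁻ (onCycle? N L) {xs = retArcs N} (proj₁ (∈-pairs⁻ cycleArcs q∈))
      v⟶r : v ⟶ r
      v⟶r = proj₁ (retArcs⁻ {N = N} (proj₁ x∈))
      mr : mark r ≡ reticulation
      mr = proj₂ (retArcs⁻ {N = N} (proj₁ x∈))
      x′∈ : (v′ , r′) ∈ retArcs N × v′ ∉ ball L v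
      x′∈ = ∈-filter⁻ (far? (v , r)) {xs = retArcs N} (proj₂ (∈-pairs⁻ cycleArcs q∈))
      v′⟶r′ : v′ ⟶ r′
      v′⟶r′ = proj₁ (retArcs⁻ {N = N} (proj₁ x′∈))
      mr′ : mark r′ ≡ reticulation
      mr′ = proj₂ (retArcs⁻ {N = N} (proj₁ x′∈))
      far : ∀ {R} → R ≤ L → ¬ Within markedDigraph R v v′
      far R≤L p = proj₂ x′∈ (∈-ball (within-weaken R≤L p))
      r≢r′ : r ≢ r′
      r≢r′ refl = far (s≤s (s≤s z≤n)) (step (fwd v⟶r) (step (bwd v′⟶r′) (here {R = 0})))

    rewire : Switchable N ((v , r) , (v′ , r′))
    rewire = record
      { arc     = v⟶r
      ; arc′    = v′⟶r′
      ; v≢v′    = λ { refl → far {0} z≤n here }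
      ; y≢y′    = r≢r′
      ; no-arc  = λ e → r≢r′ (reticulate-child-unique mr mr′ v⟶r e)
      ; no-arc′ = λ e → r≢r′ (reticulate-child-unique mr mr′ e v′⟶r′)
      ; v≢ret   = tree≢ret (ret-parent-tree mr v⟶r)
      ; v′≢ret  = tree≢ret (ret-parent-tree mr′ v′⟶r′)
      ; alike   = inj₂ (mr , mr′)
      }

    private
      module S = Switch rewire
      _⟶ˢ_ = LabelledDigraph._⟶_ S.switched
      New : Fin size → Fin size → Set
      New u z = (u ≡ v × z ≡ r′) ⊎ (u ≡ v′ × z ≡ r)

    acc-leaf : ∀ {z} → mark z ≡ leaf → Acc (flip _⟶ˢ_) z
    acc-leaf {z} m = acc λ e → case (S.view e)
      where
      case : ∀ {w} → (z ⟶ w) ⊎ New z w → Acc (flip _⟶ˢ_) w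
      case (inj₁ e)                 = contradiction e (leaf-childless m)
      case (inj₂ (inj₁ (refl , _))) = contradiction m (tree≢leaf (ret-parent-tree mr v⟶r))
      case (inj₂ (inj₂ (refl , _))) = contradiction m (tree≢leaf (ret-parent-tree mr′ v′⟶r′))

    acc-ret : ∀ {z} → mark z ≡ reticulation → Acc (flip _⟶ˢ_) z
    acc-ret {z} m = acc λ e → case (S.view e)
      where
      case : ∀ {w} → (z ⟶ w) ⊎ New z w → Acc (flip _⟶ˢ_) w
      case (inj₁ e)                 = acc-leaf (one-component z _ m e)
      case (inj₂ (inj₁ (refl , _))) = contradiction m (tree≢ret (ret-parent-tree mr v⟶r))
      case (inj₂ (inj₂ (refl , _))) = contradiction m (tree≢ret (ret-parent-tree mr′ v′⟶r′))

    -- Both new arcs end in reticulations, below which there is only a leaf, so that no cycle can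
    -- pass through them.
    rewire-wellFounded : WellFounded (flip _⟶ˢ_)
    rewire-wellFounded z = go z (descending z)
      where
      go : ∀ z → Acc (flip _⟶_) z → Acc (flip _⟶ˢ_) z
      go z (acc rs) = acc λ e → case (S.view e)
        where
        case : ∀ {w} → (z ⟶ w) ⊎ New z w → Acc (flip _⟶ˢ_) w
        case (inj₁ e)                 = go _ (rs e)
        case (inj₂ (inj₁ (_ , refl))) = acc-ret mr′
        case (inj₂ (inj₂ (_ , refl))) = acc-ret mr

    rewired : Network n
    rewired = S.network rewire-wellFounded

    private
      forget : ∀ {u w} → SymClosure (MarkedDigraph._⟶_ (cut N (v , r))) u w → SymClosure _⟶_ u w
      forget (fwd e) = fwd (proj₁ e)
      forget (bwd e) = bwd (proj₁ e)

      -- Once the arc from `v` to `r` is cut, no remaining arc from `v` lies in the rectangle, so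
      -- that only arcs leaving `v′` can be affected.
      outside : ∀ {u z} → u ⟶ z × ¬ (u ≡ v × z ≡ r) → u ≢ v′ → S.rect u z ≡ false
      outside {u} {z} (e , ¬cut) u≢v′ with u Fin.≟ v | z Fin.≟ r | z Fin.≟ r′
      ... | no u≢v | _ | _ = trans (cong (λ b → b ∧ _) (≟-≢ u≢v′)) refl
      ... | yes refl | yes z≡r | _ = contradiction (refl , z≡r) ¬cut
      ... | yes refl | no _ | yes refl = contradiction (reticulate-child-unique mr mr′ v⟶r e) r≢r′
      ... | yes refl | no _ | no _ = refl

    -- The bound `i + j ≤ L` keeps the whole walk within distance `L` of `v`, so that it never meets
    -- the far vertex `v′` and `outside` applies to each of its arcs.
    walk-survives : ∀ {i j u w} → i + j ≤ L → Within markedDigraph i v u →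
                    Within (cut N (v , r)) j u w → Within (Network.markedDigraph rewired) j u w
    walk-survives _ _ here = here
    walk-survives {i} {suc j} {u} i+j≤L p (step {v = u′} e q) = step (survives e)
      (walk-survives (subst (_≤ L) (trans (ℕ.+-suc i j) (cong (_+ j) (ℕ.+-comm 1 i))) i+j≤L) p′ q)
      where
      p′ : Within markedDigraph (i + 1) v u′
      p′ = within-++ p (within-edge (forget e))
      i+1≤L : i + 1 ≤ L
      i+1≤L = ℕ.≤-trans (ℕ.+-monoʳ-≤ i (s≤s z≤n)) i+j≤L
      survives : SymClosure (MarkedDigraph._⟶_ (cut N (v , r))) u u′ → SymClosure _⟶ˢ_ u u′
      survives (fwd e) = fwd (S.keep⁺ {u} {u′} (outside e λ { refl → far (ℕ.≤-trans (ℕ.m≤m+n i 1) i+1≤L) p }) (proj₁ e))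
      survives (bwd e) = bwd (S.keep⁺ {u′} {u} (outside e λ { refl → far i+1≤L p′ }) (proj₁ e))

    rewired-within : Within (Network.markedDigraph rewired) L v r
    rewired-within = walk-survives {0} ℕ.≤-refl here (proj₂ x∈)

-- After the rewiring `r` is still in the ball around `v`, `v′` is a parent of `r` and `r′` a child
-- of `v`. So for each `v` the number of choices is bounded, whereas the far arc was one of order k.
rewireMarks : ∀ {n} (l : ℕ) (N : Network n) → List (ArcPair N)
rewireMarks l N = pairs (pairs (allFin _) (ball (suc (suc l)))) λ (v , r) → pairs (ins r) (λ _ → outs v)
  where
  open Balls N
  open Structure N

length-rewireMarks : ∀ {n} l (N : Network n) → length (rewireMarks l N) ≤ n * 4 * ballSize (suc (suc l)) * 4
length-rewireMarks {n} l N = begin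
  length (rewireMarks l N)           ≡⟨ length-pairs vr _ ⟩
  total vr (λ (v , r) → length (pairs (ins r) (λ _ → outs v)))
                                     ≤⟨ total-≤ vr (λ {(v , r)} _ → inner v r) ⟩
  length vr * 4                      ≤⟨ ℕ.*-monoˡ-≤ 4 outer ⟩
  n * 4 * ballSize (suc (suc l)) * 4 ∎
  where
  open ℕ.≤-Reasoning
  open Balls N
  open Structure N
  open Network N using (size)
  open +-*-Solver
  vr : List (Arc N)
  vr = pairs (allFin _) (ball (suc (suc l)))
  inner : ∀ v r → length (pairs (ins r) (λ _ → outs v)) ≤ 4
  inner v r = subst (_≤ 4) (sym (length-pairs (ins r) (λ _ → outs v)))
    (ℕ.≤-trans (total-≤ (ins r) (λ _ → outdegree≤2 v)) (ℕ.*-monoˡ-≤ 2 (indegree≤2 r)))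
  outer : length vr ≤ n * 4 * ballSize (suc (suc l))
  outer = begin
    length vr                                           ≡⟨ length-pairs (allFin _) (ball (suc (suc l))) ⟩
    total (allFin _) (length ∘ ball (suc (suc l)))      ≤⟨ total-≤ (allFin _) (λ {v} _ → length-ball (suc (suc l)) v) ⟩
    length (allFin size) * ballSize (suc (suc l))       ≡⟨ cong (_* ballSize (suc (suc l))) (length-tabulate {n = size} id) ⟩
    size * ballSize (suc (suc l))                       ≤⟨ ℕ.*-monoˡ-≤ (ballSize (suc (suc l))) (SizeBound.size≤4n N) ⟩
    ((n + n) + (n + n)) * ballSize (suc (suc l))        ≡⟨ cong (_* ballSize (suc (suc l))) (solve 1 (λ n → (n :+ n) :+ (n :+ n) := n :* con 4) refl n) ⟩
    n * 4 * ballSize (suc (suc l))                      ∎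

module _ {n} (l : ℕ) (𝓛 : NetworkList n) where
  open NetworkList 𝓛 renaming (list to nets)

  total-rewirings : total nets (λ N → length (Rewire.rewirings l N)) ≤ total nets (λ N → length (rewireMarks l N))
  total-rewirings = switch-total-≤ 𝓛 (Rewire.rewirings l) (rewireMarks l) (Rewire.rewirings-unique l) id
    (λ {M} q∈ → Rewire.rewire l M q∈ , Rewire.rewire-wellFounded l M q∈)
    λ {M} {N} q∈ f →
      let open Iso f ; module S = Switch (Rewire.rewire l M q∈) in
      _ , ∈-pairs⁺ (∈-pairs⁺ (∈-allFin _) (Balls.∈-ball N (mapWithin to edge⁺ (Rewire.rewired-within l M q∈))))
                   (∈-pairs⁺ (Structure.∈-ins N (edge⁺ S.fresh′)) (Structure.∈-outs N (edge⁺ S.fresh))) , refl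

-- The covering map

-- The default makes the covering map total; a value is meaningful only where `pick-spec` applies.
pick : ∀ {m} {P : Fin m → Set} → Decidable P → Fin m → Fin m
pick P? default with Fin.any? P?
... | yes (i , _) = i
... | no  _       = default

pick-spec : ∀ {m} {P : Fin m → Set} (P? : Decidable P) default {i} → P i → P (pick P? default)
pick-spec P? default {i} p with Fin.any? P?
... | yes (_ , q) = q
... | no  ¬p      = contradiction (i , p) ¬p

iterate : ∀ {A : Set} → (A → A) → ℕ → A → A
iterate f zero    x = x
iterate f (suc k) x = f (iterate f k x)

-- Distances and pieces in the limit

spineDepth : Spine → ℕ
spineDepth 𝕡         = 1
spineDepth 𝕢         = 1
spineDepth (new s i) = 2 + (spineDepth s + ℤ.∣ i ∣)

-- The distance from `ρ₀`. The vertex of index 0 on `new s i` is two steps beyond `node s i`, on the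
-- other side of `ρ s i`.
depth : LimitVertex → ℕ
depth ρ₀         = 0
depth ℓ₀         = 1
depth (node s i) = spineDepth s + ℤ.∣ i ∣
depth (ρ s i)    = 1 + (spineDepth s + ℤ.∣ i ∣)
depth (ℓ s i)    = 2 + (spineDepth s + ℤ.∣ i ∣)

∣suc∣≤ : ∀ i → ℤ.∣ ℤ.suc i ∣ ≤ suc ℤ.∣ i ∣
∣suc∣≤ i = ℤ.∣i+j∣≤∣i∣+∣j∣ (ℤ.+ 1) i

∣∣≤∣suc∣ : ∀ i → ℤ.∣ i ∣ ≤ suc ℤ.∣ ℤ.suc i ∣
∣∣≤∣suc∣ i = subst (λ j → ℤ.∣ j ∣ ≤ suc ℤ.∣ ℤ.suc i ∣) (ℤ.pred-suc i) (ℤ.∣i+j∣≤∣i∣+∣j∣ ℤ.-[1+ 0 ] (ℤ.suc i))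

depth-⟶ : ∀ {x y} → x ⟶̂ y → depth y ≤ suc (depth x) × depth x ≤ suc (depth y)
depth-⟶ (spine s i) =
    subst (depth (node s (ℤ.suc i)) ≤_) (ℕ.+-suc (spineDepth s) _) (ℕ.+-monoʳ-≤ (spineDepth s) (∣suc∣≤ i))
  , subst (depth (node s i) ≤_) (ℕ.+-suc (spineDepth s) _) (ℕ.+-monoʳ-≤ (spineDepth s) (∣∣≤∣suc∣ i))
depth-⟶ p₀⟶ρ₀     = z≤n , s≤s z≤n
depth-⟶ q₀⟶ρ₀     = z≤n , s≤s z≤n
depth-⟶ ρ₀⟶ℓ₀     = s≤s z≤n , z≤n
depth-⟶ (x⟶ρ s i) = ℕ.≤-refl , ℕ.m≤n⇒m≤1+n (ℕ.n≤1+n _)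
depth-⟶ (w⟶ρ s i) = s≤s (ℕ.≤-trans (ℕ.n≤1+n _) (ℕ.≤-trans (ℕ.n≤1+n _) (ℕ.m≤m+n _ 0)))
                  , ℕ.≤-reflexive (ℕ.+-identityʳ _)
depth-⟶ (ρ⟶ℓ s i) = ℕ.≤-refl , ℕ.m≤n⇒m≤1+n (ℕ.n≤1+n _)

depth-step : ∀ {x y} → SymClosure _⟶̂_ x y → depth y ≤ suc (depth x)
depth-step (fwd e) = proj₁ (depth-⟶ e)
depth-step (bwd e) = proj₂ (depth-⟶ e)

depth-within : ∀ {R x y} → Within R̂ R x y → depth y ≤ depth x + R
depth-within {R} {x} here = ℕ.m≤m+n (depth x) R
depth-within {suc R} {x} (step {v = v} e p) = ℕ.≤-trans (depth-within p)
  (subst (depth v + R ≤_) (sym (ℕ.+-suc (depth x) R)) (ℕ.+-monoˡ-≤ R (depth-step e)))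

reticulateChild : ∀ s i → ∃[ y ] node s i ⟶̂ y × limitMark y ≡ reticulation
reticulateChild 𝕡         ℤ.+0       = _ , p₀⟶ρ₀ , refl
reticulateChild 𝕢         ℤ.+0       = _ , q₀⟶ρ₀ , refl
reticulateChild (new s i) ℤ.+0       = _ , w⟶ρ s i , refl
reticulateChild s         ℤ.+[1+ k ] = _ , x⟶ρ s _ , refl
reticulateChild s         ℤ.-[1+ k ] = _ , x⟶ρ s _ , refl

limit-ret-child-unique : ∀ {x y y′} → x ⟶̂ y → x ⟶̂ y′ → limitMark y ≡ reticulation →
                         limitMark y′ ≡ reticulation → y ≡ y′
limit-ret-child-unique (spine s i) _ () _
limit-ret-child-unique _ (spine s i) _ ()
limit-ret-child-unique p₀⟶ρ₀ p₀⟶ρ₀ _ _ = refl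
limit-ret-child-unique p₀⟶ρ₀ (x⟶ρ _ _ {{()}}) _ _
limit-ret-child-unique q₀⟶ρ₀ q₀⟶ρ₀ _ _ = refl
limit-ret-child-unique q₀⟶ρ₀ (x⟶ρ _ _ {{()}}) _ _
limit-ret-child-unique (x⟶ρ s i) (x⟶ρ .s .i) _ _ = refl
limit-ret-child-unique (x⟶ρ _ _ {{()}}) p₀⟶ρ₀ _ _
limit-ret-child-unique (x⟶ρ _ _ {{()}}) q₀⟶ρ₀ _ _
limit-ret-child-unique (x⟶ρ _ _ {{()}}) (w⟶ρ _ _) _ _
limit-ret-child-unique (w⟶ρ s i) (w⟶ρ .s .i) _ _ = refl
limit-ret-child-unique (w⟶ρ _ _) (x⟶ρ _ _ {{()}}) _ _

-- Removing the arcs into reticulations splits the limit into these pieces: the spines, and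
-- the reticulations with their leaves.
piece : LimitVertex → LimitVertex
piece ρ₀         = ρ₀
piece ℓ₀         = ρ₀
piece (node s i) = node s ℤ.0ℤ
piece (ρ s i)    = ρ s i
piece (ℓ s i)    = ρ s i

piece-⟶ : ∀ {x y} → x ⟶̂ y → limitMark y ≡ reticulation ⊎ (limitMark y ≢ reticulation × piece x ≡ piece y)
piece-⟶ (spine s i) = inj₂ ((λ ()) , refl)
piece-⟶ p₀⟶ρ₀       = inj₁ refl
piece-⟶ q₀⟶ρ₀       = inj₁ refl
piece-⟶ ρ₀⟶ℓ₀       = inj₂ ((λ ()) , refl)
piece-⟶ (x⟶ρ s i)   = inj₁ refl
piece-⟶ (w⟶ρ s i)   = inj₁ refl
piece-⟶ (ρ⟶ℓ s i)   = inj₂ ((λ ()) , refl)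

-- Near r₀ the network has no irregular vertex and no short cycle, so that
-- the limit unfolds it: π is the covering map.
module Cover {n} (N : Network n) (R : ℕ) (r₀ : Fin (Network.size N))
  (r₀-ret : Network.mark N r₀ ≡ reticulation)
  (regular : ∀ {z} → Within (Network.markedDigraph N) (2 + R) r₀ z → z ∉ Counts.irregular N)
  (no-cycle : ∀ {v r} → Within (Network.markedDigraph N) (2 + R) r₀ v → Network._⟶_ N v r →
              Network.mark N r ≡ reticulation → ¬ OnCycle N (2 + (R + R)) (v , r))
  where
  open Network N
  open Structure N
  open Counts N using (HasRetChild; regular-≢root; regular-tree; regular-leaf)

  down ret up out : Fin size → Fin size
  down v = pick (λ w → Bool.T? (edge v w) ×-dec ¬? (mark w ≟ᵗ reticulation)) v
  ret  v = pick (λ w → Bool.T? (edge v w) ×-dec (mark w ≟ᵗ reticulation)) v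
  up   v = pick (λ u → Bool.T? (edge u v)) v
  out  v = pick (λ w → Bool.T? (edge v w)) v

  co : Fin size → Fin size → Fin size
  co r v = pick (λ u → Bool.T? (edge u r) ×-dec ¬? (v Fin.≟ u)) r

  travel : ℤ → Fin size → Fin size
  travel (ℤ.+ k)    = iterate down k
  travel ℤ.-[1+ k ] = iterate up (suc k)

  -- Which parent of `r₀` lies on `𝕡` is left to `pick`, as the two spines play the same part in the
  -- limit.
  start : Spine → Fin size
  start 𝕡         = up r₀
  start 𝕢         = co r₀ (up r₀)
  start (new s i) = co (ret (travel i (start s))) (travel i (start s))

  π : LimitVertex → Fin size
  π ρ₀         = r₀
  π ℓ₀         = out r₀
  π (node s i) = travel i (start s)
  π (ρ s i)    = ret (travel i (start s))
  π (ℓ s i)    = out (ret (travel i (start s)))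

  Near : ℕ → Fin size → Set
  Near d v = Within markedDigraph d r₀ v

  near-step : ∀ {d u v} → SymClosure _⟶_ u v → Near d u → Near (suc d) v
  near-step e p = within-snoc p e

  near-regular : ∀ {d v} → d ≤ 2 + R → Near d v → v ∉ Counts.irregular N
  near-regular d≤ p = regular (within-weaken d≤ p)

  up-spec : ∀ {v} → mark v ≢ root → up v ⟶ v
  up-spec {v} m = pick-spec (λ u → Bool.T? (edge u v)) v (proj₂ (parent-exists m))

  down-spec : ∀ {v} → mark v ≢ leaf → v ⟶ down v × mark (down v) ≢ reticulation
  down-spec {v} m = pick-spec (λ w → Bool.T? (edge v w) ×-dec ¬? (mark w ≟ᵗ reticulation)) v
    (proj₂ (nonret-child m))

  out-spec : ∀ {v} → mark v ≢ leaf → v ⟶ out v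
  out-spec {v} m = pick-spec (λ w → Bool.T? (edge v w)) v (proj₁ (proj₂ (nonret-child m)))

  ret-spec : ∀ {v} → HasRetChild v → v ⟶ ret v × mark (ret v) ≡ reticulation
  ret-spec {v} (_ , e , m) = pick-spec (λ w → Bool.T? (edge v w) ×-dec (mark w ≟ᵗ reticulation)) v (e , m)

  co-spec : ∀ {r v} → mark r ≡ reticulation → v ⟶ r → co r v ⟶ r × v ≢ co r v
  co-spec {r} {v} m e =
    let u , u∈ , v≢u = other-member (indeg m) (ins-unique r) (∈-ins e)
    in pick-spec (λ u → Bool.T? (edge u r) ×-dec ¬? (v Fin.≟ u)) r (ins⇒⟶ u∈ , v≢u)

  ret≢root : ∀ {v} → mark v ≡ reticulation → mark v ≢ root
  ret≢root m m′ with () ← trans (sym m) m′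

  tree≢root : ∀ {v} → mark v ≡ tree → mark v ≢ root
  tree≢root m m′ with () ← trans (sym m) m′

  ret≢leaf : ∀ {v} → mark v ≡ reticulation → mark v ≢ leaf
  ret≢leaf m m′ with () ← trans (sym m) m′

  Good : ℕ → Fin size → Set
  Good d v = mark v ≡ tree × Near d v

  good-ret : ∀ {d v} → d ≤ 2 + R → Good d v → HasRetChild v
  good-ret d≤ (m , p) = regular-tree (near-regular d≤ p) m

  -- The next vertex is again a tree vertex: a leaf below a tree vertex would be irregular, and it
  -- would be within reach.
  good-down : ∀ {d v} → suc d ≤ 2 + R → Good d v → Good (suc d) (down v)
  good-down {d} {v} d≤ (m , p) with down-spec (tree≢leaf m)
  ... | e , m′ with ≢ret⇒treeOrLeaf e m′
  ...   | inj₁ t = t , near-step (fwd e) p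
  ...   | inj₂ l = contradiction (regular-leaf (near-regular d≤ (near-step (fwd e) p)) l e) (tree≢ret m)

  -- The root is irregular, and a reticulation has only a leaf below it, so that the parent of a
  -- tree vertex is a tree vertex here.
  good-up : ∀ {d v} → suc d ≤ 2 + R → Good d v → Good (suc d) (up v)
  good-up {d} {v} d≤ (m , p) = u-tree , p′
    where
    e = up-spec (tree≢root m)
    p′ = near-step (bwd e) p
    u-tree : mark (up v) ≡ tree
    u-tree with mark (up v) in mu
    ... | tree         = refl
    ... | root         = contradiction mu (regular-≢root (near-regular d≤ p′))
    ... | leaf         = contradiction e (leaf-childless mu)
    ... | reticulation = contradiction (one-component (up v) v mu e) (tree≢leaf m)

  good-at-zero : ∀ s → Good (spineDepth s) (start s) → Good (spineDepth s + 0) (start s)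
  good-at-zero s = subst (λ d → Good d (start s)) (sym (ℕ.+-identityʳ _))

  good-start : ∀ s → spineDepth s ≤ 2 + R → Good (spineDepth s) (start s)
  good-node  : ∀ s i → spineDepth s + ℤ.∣ i ∣ ≤ 2 + R → Good (spineDepth s + ℤ.∣ i ∣) (travel i (start s))

  good-start 𝕡 _ = let e = up-spec (ret≢root r₀-ret) in ret-parent-tree r₀-ret e , near-step (bwd e) here
  good-start 𝕢 _ = let e = proj₁ (co-spec r₀-ret (up-spec (ret≢root r₀-ret)))
                   in ret-parent-tree r₀-ret e , near-step (bwd e) here
  good-start (new s i) d≤ =
    let d≤′   = ℕ.≤-trans (ℕ.n≤1+n _) (ℕ.≤-trans (ℕ.n≤1+n _) d≤)
        g     = good-node s i d≤′
        e , m = ret-spec (good-ret d≤′ g)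
        e′    = proj₁ (co-spec m e)
    in ret-parent-tree m e′ , near-step (bwd e′) (near-step (fwd e) (proj₂ g))

  good-node s ℤ.+0 d≤ = good-at-zero s (good-start s (subst (_≤ 2 + R) (ℕ.+-identityʳ _) d≤))
  good-node s ℤ.+[1+ k ] d≤ = subst (λ d → Good d (travel ℤ.+[1+ k ] (start s))) (sym (ℕ.+-suc (spineDepth s) k))
    (good-down d≤′ (good-node s (ℤ.+ k) (ℕ.≤-trans (ℕ.n≤1+n _) d≤′)))
    where d≤′ = subst (_≤ 2 + R) (ℕ.+-suc (spineDepth s) k) d≤
  good-node s ℤ.-[1+ zero ] d≤ = subst (λ d → Good d (travel ℤ.-[1+ zero ] (start s))) (sym (ℕ.+-suc (spineDepth s) 0))
    (good-up d≤′ (good-at-zero s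
      (good-start s (subst (_≤ 2 + R) (ℕ.+-identityʳ _) (ℕ.≤-trans (ℕ.n≤1+n _) d≤′)))))
    where d≤′ = subst (_≤ 2 + R) (ℕ.+-suc (spineDepth s) 0) d≤
  good-node s ℤ.-[1+ suc k ] d≤ = subst (λ d → Good d (travel ℤ.-[1+ suc k ] (start s))) (sym (ℕ.+-suc (spineDepth s) (suc k)))
    (good-up d≤′ (good-node s ℤ.-[1+ k ] (ℕ.≤-trans (ℕ.n≤1+n _) d≤′)))
    where d≤′ = subst (_≤ 2 + R) (ℕ.+-suc (spineDepth s) (suc k)) d≤

  Inside : LimitVertex → Set
  Inside x = depth x ≤ 2 + R

  pred-≤ : ∀ {a b} → suc a ≤ b → a ≤ b
  pred-≤ = ℕ.≤-trans (ℕ.n≤1+n _)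

  ret-arc : ∀ s i → spineDepth s + ℤ.∣ i ∣ ≤ 2 + R →
            travel i (start s) ⟶ ret (travel i (start s)) × mark (ret (travel i (start s))) ≡ reticulation
  ret-arc s i d≤ = ret-spec (good-ret d≤ (good-node s i d≤))

  π-mark : ∀ x → Inside x → mark (π x) ≡ limitMark x
  π-mark ρ₀         _  = r₀-ret
  π-mark ℓ₀         _  = one-component _ _ r₀-ret (out-spec (ret≢leaf r₀-ret))
  π-mark (node s i) d≤ = proj₁ (good-node s i d≤)
  π-mark (ρ s i)    d≤ = proj₂ (ret-arc s i (pred-≤ d≤))
  π-mark (ℓ s i)    d≤ = let m = proj₂ (ret-arc s i (pred-≤ (pred-≤ d≤)))
                         in one-component _ _ m (out-spec (ret≢leaf m))

  π-⟶ : ∀ {x y} → x ⟶̂ y → Inside x → Inside y → π x ⟶ π y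
  π-⟶ (spine s (ℤ.+ k)) dx dy = proj₁ (down-spec (tree≢leaf (proj₁ (good-node s (ℤ.+ k) dx))))
  π-⟶ (spine s ℤ.-[1+ zero ]) dx dy = up-spec (tree≢root (proj₁ (good-node s ℤ.+0 dy)))
  π-⟶ (spine s ℤ.-[1+ suc k ]) dx dy = up-spec (tree≢root (proj₁ (good-node s ℤ.-[1+ k ] dy)))
  π-⟶ p₀⟶ρ₀     dx dy = up-spec (ret≢root r₀-ret)
  π-⟶ q₀⟶ρ₀     dx dy = proj₁ (co-spec r₀-ret (up-spec (ret≢root r₀-ret)))
  π-⟶ ρ₀⟶ℓ₀     dx dy = out-spec (ret≢leaf r₀-ret)
  π-⟶ (x⟶ρ s i) dx dy = proj₁ (ret-arc s i dx)
  π-⟶ (w⟶ρ s i) dx dy = let e , m = ret-arc s i (pred-≤ dy) in proj₁ (co-spec m e)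
  π-⟶ (ρ⟶ℓ s i) dx dy = out-spec (ret≢leaf (proj₂ (ret-arc s i (pred-≤ dx))))

  π-parents-injective : ∀ {x x′ y} → x ⟶̂ y → x′ ⟶̂ y → limitMark y ≡ reticulation → Inside y →
                        π x ≡ π x′ → x ≡ x′
  π-parents-injective (spine s i) _ () _ _
  π-parents-injective p₀⟶ρ₀ p₀⟶ρ₀ _ _ _  = refl
  π-parents-injective q₀⟶ρ₀ q₀⟶ρ₀ _ _ _  = refl
  π-parents-injective p₀⟶ρ₀ q₀⟶ρ₀ _ _ eq = contradiction eq (proj₂ (co-spec r₀-ret (up-spec (ret≢root r₀-ret))))
  π-parents-injective q₀⟶ρ₀ p₀⟶ρ₀ _ _ eq = contradiction (sym eq) (proj₂ (co-spec r₀-ret (up-spec (ret≢root r₀-ret))))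
  π-parents-injective (x⟶ρ s i) (x⟶ρ .s .i) _ _ _ = refl
  π-parents-injective (w⟶ρ s i) (w⟶ρ .s .i) _ _ _ = refl
  π-parents-injective (x⟶ρ s i) (w⟶ρ .s .i) _ d≤ eq =
    let e , m = ret-arc s i (pred-≤ d≤) in contradiction eq (proj₂ (co-spec m e))
  π-parents-injective (w⟶ρ s i) (x⟶ρ .s .i) _ d≤ eq =
    let e , m = ret-arc s i (pred-≤ d≤) in contradiction (sym eq) (proj₂ (co-spec m e))

  inside-step : ∀ {x y} → suc (depth x) ≤ 2 + R → SymClosure _⟶̂_ x y → Inside y
  inside-step d≤ e = ℕ.≤-trans (depth-step e) d≤

  -- `π` preserves marks, hence degrees, and separates the children of `x`; their images are
  -- therefore all the children of `π x`. The bound on the depth keeps these children in the region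
  -- where `π` is meaningful.
  lift-child : ∀ x {z} → suc (depth x) ≤ 2 + R → π x ⟶ z → ∃[ y ] x ⟶̂ y × π y ≡ z
  lift-child ρ₀ d≤ e = ℓ₀ , ρ₀⟶ℓ₀ , ret-child-unique r₀-ret (out-spec (ret≢leaf r₀-ret)) e
  lift-child ℓ₀ d≤ e = contradiction e (leaf-childless (π-mark ℓ₀ (pred-≤ d≤)))
  lift-child (ℓ s i) d≤ e = contradiction e (leaf-childless (π-mark (ℓ s i) (pred-≤ d≤)))
  lift-child (ρ s i) d≤ e = ℓ s i , ρ⟶ℓ s i ,
    ret-child-unique (π-mark (ρ s i) (pred-≤ d≤)) (π-⟶ (ρ⟶ℓ s i) (pred-≤ d≤) (inside-step d≤ (fwd (ρ⟶ℓ s i)))) e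
  lift-child (node s i) {z} d≤ e with reticulateChild s i
  ... | y , d , my = choose (one-of-two (outdeg (π-mark (node s i) (pred-≤ d≤))) (∈-outs next) (∈-outs other) distinct (∈-outs e))
    where
    inside-y = inside-step d≤ (fwd d)
    inside-next = inside-step d≤ (fwd (spine s i))
    next = π-⟶ (spine s i) (pred-≤ d≤) inside-next
    other = π-⟶ d (pred-≤ d≤) inside-y
    distinct : π (node s (ℤ.suc i)) ≢ π y
    distinct eq = tree≢ret (π-mark (node s (ℤ.suc i)) inside-next) (trans (cong mark eq) (trans (π-mark y inside-y) my))
    choose : z ≡ π (node s (ℤ.suc i)) ⊎ z ≡ π y → ∃[ y ] node s i ⟶̂ y × π y ≡ z
    choose (inj₁ eq) = _ , spine s i , sym eq
    choose (inj₂ eq) = y , d , sym eq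

  lift-parent : ∀ x {z} → suc (depth x) ≤ 2 + R → z ⟶ π x → ∃[ y ] y ⟶̂ x × π y ≡ z
  lift-parent ρ₀ {z} d≤ e = choose (one-of-two (indeg r₀-ret) (∈-ins p) (∈-ins (proj₁ q)) (proj₂ q) (∈-ins e))
    where
    p = up-spec (ret≢root r₀-ret)
    q = co-spec r₀-ret p
    choose : z ≡ π (node 𝕡 ℤ.0ℤ) ⊎ z ≡ π (node 𝕢 ℤ.0ℤ) → ∃[ y ] y ⟶̂ ρ₀ × π y ≡ z
    choose (inj₁ eq) = _ , p₀⟶ρ₀ , sym eq
    choose (inj₂ eq) = _ , q₀⟶ρ₀ , sym eq
  lift-parent (ρ s i) {z} d≤ e = choose (one-of-two (indeg (proj₂ a)) (∈-ins (proj₁ a)) (∈-ins (proj₁ q)) (proj₂ q) (∈-ins e))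
    where
    a = ret-arc s i (pred-≤ (pred-≤ d≤))
    q = co-spec (proj₂ a) (proj₁ a)
    choose : z ≡ π (node s i) ⊎ z ≡ π (node (new s i) ℤ.0ℤ) → ∃[ y ] y ⟶̂ ρ s i × π y ≡ z
    choose (inj₁ eq) = _ , x⟶ρ s i , sym eq
    choose (inj₂ eq) = _ , w⟶ρ s i , sym eq
  lift-parent ℓ₀ d≤ e = ρ₀ , ρ₀⟶ℓ₀ ,
    parent-unique (leaf≢ret (π-mark ℓ₀ (pred-≤ d≤))) (π-⟶ ρ₀⟶ℓ₀ z≤n (pred-≤ d≤)) e
  lift-parent (ℓ s i) d≤ e = ρ s i , ρ⟶ℓ s i ,
    parent-unique (leaf≢ret (π-mark (ℓ s i) (pred-≤ d≤)))
      (π-⟶ (ρ⟶ℓ s i) (inside-step d≤ (bwd (ρ⟶ℓ s i))) (pred-≤ d≤)) e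
  lift-parent (node s i) d≤ e = node s (ℤ.pred i) , d ,
    parent-unique (tree≢ret (π-mark (node s i) (pred-≤ d≤))) (π-⟶ d (inside-step d≤ (bwd d)) (pred-≤ d≤)) e
    where
    d : node s (ℤ.pred i) ⟶̂ node s i
    d = subst (λ j → node s (ℤ.pred i) ⟶̂ node s j) (ℤ.suc-pred i) (spine s (ℤ.pred i))

  -- Outside this region π may take the default values of pick.
  data Walk : ℕ → Rel LimitVertex 0ℓ where
    []  : ∀ {x} → Walk 0 x x
    _∷_ : ∀ {k x y z} → SymClosure _⟶̂_ x y × Inside y → Walk k y z → Walk (suc k) x z

  _++ʷ_ : ∀ {k l x y z} → Walk k x y → Walk l y z → Walk (k + l) x z
  []      ++ʷ q = q
  (e ∷ p) ++ʷ q = e ∷ (p ++ʷ q)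

  flip-step : ∀ {x y} → SymClosure _⟶̂_ x y → SymClosure _⟶̂_ y x
  flip-step (fwd e) = bwd e
  flip-step (bwd e) = fwd e

  reverseʷ : ∀ {k x y} → Inside x → Walk k x y → Walk k y x
  reverseʷ dx [] = []
  reverseʷ {suc k} {x} {y} dx ((e , dy) ∷ p) =
    subst (λ m → Walk m y x) (ℕ.+-comm k 1) (reverseʷ dy p ++ʷ ((flip-step e , dx) ∷ []))

  inside-end : ∀ {k x y} → Inside x → Walk k x y → Inside y
  inside-end dx []             = dx
  inside-end dx ((_ , dy) ∷ p) = inside-end dy p

  fromWithin : ∀ {j x y} → depth x + j ≤ 2 + R → Within R̂ j x y → ∃[ k ] k ≤ j × Walk k x y
  fromWithin d≤ here = 0 , z≤n , []
  fromWithin {suc j} {x} d≤ (step {v = y} e p) =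
    let d≤′     = ℕ.≤-trans (ℕ.+-monoˡ-≤ j (depth-step e)) (subst (_≤ 2 + R) (ℕ.+-suc (depth x) j) d≤)
        k , k≤ , w = fromWithin d≤′ p
    in suc k , s≤s k≤ , (e , ℕ.≤-trans (ℕ.m≤m+n (depth y) j) d≤′) ∷ w

  π-walk : ∀ {k x y} → Inside x → Walk k x y → Within markedDigraph k (π x) (π y)
  π-walk dx []                 = here
  π-walk dx ((fwd e , dy) ∷ p) = step (fwd (π-⟶ e dx dy)) (π-walk dy p)
  π-walk dx ((bwd e , dy) ∷ p) = step (bwd (π-⟶ e dy dx)) (π-walk dy p)

  π-within : ∀ {j x y} → depth x + j ≤ 2 + R → Within R̂ j x y → Within markedDigraph j (π x) (π y)
  π-within {j} {x} d≤ p =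
    let k , k≤ , w = fromWithin d≤ p in within-weaken k≤ (π-walk (ℕ.≤-trans (ℕ.m≤m+n (depth x) j) d≤) w)

  near-π : ∀ x → Inside x → Near (2 + R) (π x)
  near-π x d≤ = let p = from-ρ₀ x in within-weaken d≤ (π-within d≤ p)
    where
    along : ∀ s i → Within R̂ ℤ.∣ i ∣ (node s ℤ.0ℤ) (node s i)
    along s ℤ.+0 = here
    along s ℤ.+[1+ k ] = within-snoc (along s (ℤ.+ k)) (fwd (spine s (ℤ.+ k)))
    along s ℤ.-[1+ zero ] = within-edge (bwd (spine s ℤ.-[1+ 0 ]))
    along s ℤ.-[1+ suc k ] = within-snoc (along s ℤ.-[1+ k ]) (bwd (spine s ℤ.-[1+ suc k ]))
    to-start : ∀ s → Within R̂ (spineDepth s) ρ₀ (node s ℤ.0ℤ)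
    to-start 𝕡 = within-edge (bwd p₀⟶ρ₀)
    to-start 𝕢 = within-edge (bwd q₀⟶ρ₀)
    to-start (new s i) = within-snoc (within-snoc (within-++ (to-start s) (along s i)) (fwd (x⟶ρ s i))) (bwd (w⟶ρ s i))
    from-ρ₀ : ∀ x → Within R̂ (depth x) ρ₀ x
    from-ρ₀ ρ₀         = here
    from-ρ₀ ℓ₀         = within-edge (fwd ρ₀⟶ℓ₀)
    from-ρ₀ (node s i) = within-++ (to-start s) (along s i)
    from-ρ₀ (ρ s i)    = within-snoc (within-++ (to-start s) (along s i)) (fwd (x⟶ρ s i))
    from-ρ₀ (ℓ s i)    = within-snoc (within-snoc (within-++ (to-start s) (along s i)) (fwd (x⟶ρ s i))) (fwd (ρ⟶ℓ s i))

  -- Injectivity of the covering map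

  ascend : ∀ s {a b} → a < b → spineDepth s + b ≤ 2 + R →
           TransClosure _⟶_ (π (node s (ℤ.+ a))) (π (node s (ℤ.+ b)))
  ascend s {a} {suc b} (s≤s a≤b) d≤ with ℕ.m≤n⇒m<n∨m≡n a≤b
  ... | inj₂ refl = [ e ]
    where e = π-⟶ (spine s (ℤ.+ a)) (ℕ.≤-trans (ℕ.+-monoʳ-≤ (spineDepth s) (ℕ.n≤1+n a)) d≤) d≤
  ... | inj₁ a<b = ascend s a<b d≤′ ∷ʳ π-⟶ (spine s (ℤ.+ b)) d≤′ d≤
    where d≤′ = ℕ.≤-trans (ℕ.+-monoʳ-≤ (spineDepth s) (ℕ.n≤1+n b)) d≤

  descend : ∀ s {a b} → a < b → spineDepth s + suc b ≤ 2 + R →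
            TransClosure _⟶_ (π (node s ℤ.-[1+ b ])) (π (node s ℤ.-[1+ a ]))
  descend s {a} {suc b} (s≤s a≤b) d≤ with ℕ.m≤n⇒m<n∨m≡n a≤b
  ... | inj₂ refl = [ e ]
    where e = π-⟶ (spine s ℤ.-[1+ suc a ]) d≤ (ℕ.≤-trans (ℕ.+-monoʳ-≤ (spineDepth s) (ℕ.n≤1+n (suc a))) d≤)
  ... | inj₁ a<b = π-⟶ (spine s ℤ.-[1+ suc b ]) d≤ d≤′ ∷ descend s a<b d≤′
    where d≤′ = ℕ.≤-trans (ℕ.+-monoʳ-≤ (spineDepth s) (ℕ.n≤1+n (suc b))) d≤

  to-zero : ∀ s b → spineDepth s + suc b ≤ 2 + R → TransClosure _⟶_ (π (node s ℤ.-[1+ b ])) (π (node s ℤ.+0))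
  to-zero s zero    d≤ = [ π-⟶ (spine s ℤ.-[1+ 0 ]) d≤ (ℕ.≤-trans (ℕ.+-monoʳ-≤ (spineDepth s) z≤n) d≤) ]
  to-zero s (suc b) d≤ = π-⟶ (spine s ℤ.-[1+ suc b ]) d≤ d≤′ ∷ to-zero s b d≤′
    where d≤′ = ℕ.≤-trans (ℕ.+-monoʳ-≤ (spineDepth s) (ℕ.n≤1+n (suc b))) d≤

  crossing : ∀ s b a → spineDepth s + suc b ≤ 2 + R → spineDepth s + a ≤ 2 + R →
             TransClosure _⟶_ (π (node s ℤ.-[1+ b ])) (π (node s (ℤ.+ a)))
  crossing s b zero    d≤ d≤′ = to-zero s b d≤
  crossing s b (suc a) d≤ d≤′ = to-zero s b d≤ Plus.++ ascend s (s≤s z≤n) d≤′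

  cyclic : ∀ {u v} → u ≡ v → ¬ TransClosure _⟶_ u v
  cyclic refl = acyclic _

  -- A spine is mapped along directed walks, so that two of its vertices with the same image would
  -- lie on a directed cycle; the length of this cycle does not matter.
  π-spine-injective : ∀ s i j → Inside (node s i) → Inside (node s j) →
                      π (node s i) ≡ π (node s j) → i ≡ j
  π-spine-injective s (ℤ.+ a) (ℤ.+ b) da db eq with ℕ.<-cmp a b
  ... | tri< a<b _ _ = contradiction (ascend s a<b db) (cyclic eq)
  ... | tri≈ _ a≡b _ = cong ℤ.+_ a≡b
  ... | tri> _ _ b<a = contradiction (ascend s b<a da) (cyclic (sym eq))
  π-spine-injective s (ℤ.+ a) ℤ.-[1+ b ] da db eq = contradiction (crossing s b a db da) (cyclic (sym eq))
  π-spine-injective s ℤ.-[1+ a ] (ℤ.+ b) da db eq = contradiction (crossing s a b da db) (cyclic eq)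
  π-spine-injective s ℤ.-[1+ a ] ℤ.-[1+ b ] da db eq with ℕ.<-cmp a b
  ... | tri< a<b _ _ = contradiction (descend s a<b db) (cyclic (sym eq))
  ... | tri≈ _ a≡b _ = cong ℤ.-[1+_] a≡b
  ... | tri> _ _ b<a = contradiction (descend s b<a da) (cyclic eq)

  marks-agree : ∀ x y → Inside x → Inside y → π x ≡ π y → limitMark x ≡ limitMark y
  marks-agree x y dx dy eq = trans (sym (π-mark x dx)) (trans (cong mark eq) (π-mark y dy))

  π-piece-injective : ∀ x y → piece x ≡ piece y → Inside x → Inside y → π x ≡ π y → x ≡ y
  π-piece-injective x y p dx dy eq with marks-agree x y dx dy eq
  π-piece-injective ρ₀         ρ₀          p    dx dy eq | _ = refl
  π-piece-injective ρ₀         ℓ₀          p    dx dy eq | ()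
  π-piece-injective ρ₀         (node _ _)  ()   dx dy eq | _
  π-piece-injective ρ₀         (ρ _ _)     ()   dx dy eq | _
  π-piece-injective ρ₀         (ℓ _ _)     ()   dx dy eq | _
  π-piece-injective ℓ₀         ρ₀          p    dx dy eq | ()
  π-piece-injective ℓ₀         ℓ₀          p    dx dy eq | _ = refl
  π-piece-injective ℓ₀         (node _ _)  ()   dx dy eq | _
  π-piece-injective ℓ₀         (ρ _ _)     ()   dx dy eq | _
  π-piece-injective ℓ₀         (ℓ _ _)     ()   dx dy eq | _
  π-piece-injective (node s i) (node .s j) refl dx dy eq | _ = cong (node s) (π-spine-injective s i j dx dy eq)
  π-piece-injective (node s i) ρ₀          ()   dx dy eq | _
  π-piece-injective (node s i) ℓ₀          ()   dx dy eq | _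
  π-piece-injective (node s i) (ρ _ _)     ()   dx dy eq | _
  π-piece-injective (node s i) (ℓ _ _)     ()   dx dy eq | _
  π-piece-injective (ρ s i)    (ρ .s .i)   refl dx dy eq | _ = refl
  π-piece-injective (ρ s i)    ρ₀          ()   dx dy eq | _
  π-piece-injective (ρ s i)    ℓ₀          ()   dx dy eq | _
  π-piece-injective (ρ s i)    (node _ _)  ()   dx dy eq | _
  π-piece-injective (ρ s i)    (ℓ _ _)     p    dx dy eq | ()
  π-piece-injective (ℓ s i)    (ℓ .s .i)   refl dx dy eq | _ = refl
  π-piece-injective (ℓ s i)    ρ₀          ()   dx dy eq | _
  π-piece-injective (ℓ s i)    ℓ₀          ()   dx dy eq | _
  π-piece-injective (ℓ s i)    (node _ _)  ()   dx dy eq | _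
  π-piece-injective (ℓ s i)    (ρ _ _)     p    dx dy eq | ()

  RetStep : Rel LimitVertex 0ℓ
  RetStep t h = (t ⟶̂ h × limitMark h ≡ reticulation) ⊎ (h ⟶̂ t × limitMark t ≡ reticulation)

  Avoiding : Arc N → ℕ → Rel (Fin size) 0ℓ
  Avoiding a = Within (cut N a)

  -- Before its first passage along an arc into a reticulation, in either direction, a walk stays in
  -- one piece. Its image up to there avoids all arcs into reticulations at once, which is why
  -- `avoiding` is quantified over them.
  record FirstRetStep (k : ℕ) (x y : LimitVertex) : Set where
    field
      {i j}    : ℕ
      {t h}    : LimitVertex
      before   : Walk i x t
      avoiding : ∀ {v r} → mark r ≡ reticulation → Avoiding (v , r) i (π x) (π t)
      retStep  : RetStep t h
      inside   : Inside h
      after    : Walk j h y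
      length≡  : i + suc j ≡ k

  firstRetStep : ∀ {k x y} → Inside x → Walk k x y → piece x ≡ piece y ⊎ FirstRetStep k x y
  firstRetStep dx [] = inj₁ refl
  firstRetStep {x = x} dx (_∷_ {y = w} (fwd e , dw) p) with piece-⟶ e
  ... | inj₁ m = inj₂ record
    { before = [] ; avoiding = λ _ → here ; retStep = inj₁ (e , m) ; inside = dw ; after = p ; length≡ = refl }
  ... | inj₂ (m , same) with firstRetStep dw p
  ...   | inj₁ same′ = inj₁ (trans same same′)
  ...   | inj₂ f = inj₂ record
    { before = (fwd e , dw) ∷ before
    ; avoiding = λ mr → step (fwd (π-⟶ e dx dw , λ (_ , eq) → m (trans (sym (π-mark w dw)) (trans (cong mark eq) mr))))
                             (avoiding mr)
    ; retStep = retStep ; inside = inside ; after = after ; length≡ = cong suc length≡ }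
    where open FirstRetStep f
  firstRetStep {x = x} dx (_∷_ {y = w} (bwd e , dw) p) with piece-⟶ e
  ... | inj₁ m = inj₂ record
    { before = [] ; avoiding = λ _ → here ; retStep = inj₂ (e , m) ; inside = dw ; after = p ; length≡ = refl }
  ... | inj₂ (m , same) with firstRetStep dw p
  ...   | inj₁ same′ = inj₁ (trans (sym same) same′)
  ...   | inj₂ f = inj₂ record
    { before = (bwd e , dw) ∷ before
    ; avoiding = λ mr → step (bwd (π-⟶ e dw dx , λ (_ , eq) → m (trans (sym (π-mark x dx)) (trans (cong mark eq) mr))))
                             (avoiding mr)
    ; retStep = retStep ; inside = inside ; after = after ; length≡ = cong suc length≡ }
    where open FirstRetStep f

  Hits : Arc N → Rel LimitVertex 0ℓ
  Hits (v , r) t h = (t ⟶̂ h × π t ≡ v × π h ≡ r) ⊎ (h ⟶̂ t × π h ≡ v × π t ≡ r)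

  record FirstHit (a : Arc N) (k : ℕ) (x y : LimitVertex) : Set where
    field
      {i j}    : ℕ
      {t h}    : LimitVertex
      before   : Walk i x t
      avoiding : Avoiding a i (π x) (π t)
      hits     : Hits a t h
      inside   : Inside h
      after    : Walk j h y
      length≡  : i + suc j ≡ k

  firstHit : ∀ a {k x y} → Inside x → Walk k x y → Avoiding a k (π x) (π y) ⊎ FirstHit a k x y
  firstHit a dx [] = inj₁ here
  firstHit a@(v , r) {x = x} dx (_∷_ {y = w} (fwd e , dw) p) with (π x Fin.≟ v) ×-dec (π w Fin.≟ r)
  ... | yes (eq , eq′) = inj₂ record
    { before = [] ; avoiding = here ; hits = inj₁ (e , eq , eq′) ; inside = dw ; after = p ; length≡ = refl }
  ... | no ¬hit with firstHit a dw p
  ...   | inj₁ q = inj₁ (step (fwd (π-⟶ e dx dw , ¬hit)) q)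
  ...   | inj₂ f = inj₂ record
    { before = (fwd e , dw) ∷ before ; avoiding = step (fwd (π-⟶ e dx dw , ¬hit)) avoiding
    ; hits = hits ; inside = inside ; after = after ; length≡ = cong suc length≡ }
    where open FirstHit f
  firstHit a@(v , r) {x = x} dx (_∷_ {y = w} (bwd e , dw) p) with (π w Fin.≟ v) ×-dec (π x Fin.≟ r)
  ... | yes (eq , eq′) = inj₂ record
    { before = [] ; avoiding = here ; hits = inj₂ (e , eq , eq′) ; inside = dw ; after = p ; length≡ = refl }
  ... | no ¬hit with firstHit a dw p
  ...   | inj₁ q = inj₁ (step (bwd (π-⟶ e dw dx , ¬hit)) q)
  ...   | inj₂ f = inj₂ record
    { before = (bwd e , dw) ∷ before ; avoiding = step (bwd (π-⟶ e dw dx , ¬hit)) avoiding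
    ; hits = hits ; inside = inside ; after = after ; length≡ = cong suc length≡ }
    where open FirstHit f

  -- Twice 1 + R: two walks from `ρ₀` are joined into one.
  Length : ℕ
  Length = 2 + (R + R)

  bridge : ∀ {v r k} → v ⟶̂ r → limitMark r ≡ reticulation → Inside v → Inside r →
           k ≤ Length → ¬ Avoiding (π v , π r) k (π v) (π r)
  bridge {v} {r} e m dv dr k≤ p =
    no-cycle (near-π v dv) (π-⟶ e dv dr) (trans (π-mark r dr) m) (within-weaken k≤ p)

  -- A walk between two vertices with the same image closes up in N.  Take
  -- its first arc at a reticulation; the closed walk has to come back through the
  -- image of that arc, in the opposite direction, since the arc is on no
  -- short cycle.  By induction the two passages are the same
  -- arc of the limit, and the walk can be shortened.
  π-walk-injective : ∀ {k} → Acc _<_ k → ∀ {x y} → Inside x → k ≤ Length → Walk k x y → π x ≡ π y → x ≡ y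
  π-walk-injective {k} (acc rs) {x} {y} dx k≤ w eq with firstRetStep dx w
  ... | inj₁ same = π-piece-injective x y same dx (inside-end dx w) eq
  ... | inj₂ f = return retStep
    where
    open FirstRetStep f
    dt : Inside t
    dt = inside-end dx before

    i+j≤k : i + j ≤ k
    i+j≤k = subst (i + j ≤_) length≡ (ℕ.+-monoʳ-≤ i (ℕ.n≤1+n j))

    closed : ∀ {a} → Avoiding a j (π h) (π y) → Avoiding a i (π x) (π t) → Avoiding a (j + i) (π h) (π t)
    closed {a} p q = within-++ p (subst (λ u → Avoiding a i u (π t)) eq q)

    j+i≤ : j + i ≤ Length
    j+i≤ = ℕ.≤-trans (subst (_≤ k) (ℕ.+-comm i j) i+j≤k) k≤

    j≤ : ∀ {i′ j′} → i′ + suc j′ ≡ j → i′ ≤ Length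
    j≤ {i′} {j′} refl = ℕ.≤-trans (ℕ.m≤m+n i′ (suc j′)) (ℕ.≤-trans (ℕ.m≤m+n j i) j+i≤)

    shorter-loop : ∀ {i′ j′ t′} → i′ + suc j′ ≡ j → Walk i′ h t′ → π h ≡ π t′ → h ≡ t′
    shorter-loop {i′} {j′} len p = π-walk-injective (rs i′<k) inside (j≤ len) p
      where
      i′<k : i′ < k
      i′<k = ℕ.<-≤-trans (ℕ.m<m+n i′ (s≤s z≤n)) (subst (_≤ k) (sym len) (ℕ.≤-trans (ℕ.m≤n+m j i) i+j≤k))

    shortcut : ∀ {i′ j′} → i′ + suc j′ ≡ j → Walk j′ t y → x ≡ y
    shortcut {i′} {j′} len p = π-walk-injective (rs (shorter len)) dx (ℕ.≤-trans (ℕ.<⇒≤ (shorter len)) k≤) (before ++ʷ p) eq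
      where
      shorter : i′ + suc j′ ≡ j → i + j′ < k
      shorter refl = ℕ.≤-trans (subst (_≤ i + (i′ + suc j′)) (ℕ.+-suc i j′) (ℕ.+-monoʳ-≤ i (ℕ.m≤n+m (suc j′) i′))) i+j≤k

    return : RetStep t h → x ≡ y
    return (inj₁ (e , m)) with firstHit (π t , π h) inside after
    ... | inj₁ p = contradiction (within-sym (closed p (avoiding (trans (π-mark h inside) m))))
                                 (bridge e m dt inside j+i≤)
    ... | inj₂ g = back g (FirstHit.hits g)
      where
      back : (g : FirstHit (π t , π h) j h y) → Hits (π t , π h) (FirstHit.t g) (FirstHit.h g) → x ≡ y
      -- A second passage in the same direction: in between, the image leads from the head of the
      -- arc back to its tail without using the arc, which closes a short cycle.
      back g (inj₁ (_ , πt′ , _)) = contradiction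
        (within-sym (subst (Avoiding (π t , π h) G.i (π h)) πt′ G.avoiding)) (bridge e m dt inside (j≤ G.length≡))
        where module G = FirstHit g
      -- A passage back: the part in between is a shorter walk whose ends have the same image, so it
      -- is closed. Then `t` and the new end are parents of the same reticulation with the same
      -- image, and the detour can be cut out.
      back g (inj₂ (e′ , πh′ , πt′)) with refl ← shorter-loop (FirstHit.length≡ g) (FirstHit.before g) (sym πt′)
        with refl ← π-parents-injective e e′ m inside (sym πh′) = shortcut (FirstHit.length≡ g) (FirstHit.after g)
    return (inj₂ (e , m)) with firstHit (π h , π t) inside after
    ... | inj₁ p = contradiction (closed p (avoiding (trans (π-mark t dt) m))) (bridge e m inside dt j+i≤)
    ... | inj₂ g = back g (FirstHit.hits g)
      where
      back : (g : FirstHit (π h , π t) j h y) → Hits (π h , π t) (FirstHit.t g) (FirstHit.h g) → x ≡ y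
      back g (inj₂ (_ , _ , πt′)) = contradiction
        (subst (Avoiding (π h , π t) G.i (π h)) πt′ G.avoiding) (bridge e m inside dt (j≤ G.length≡))
        where module G = FirstHit g
      -- The mirror image, starting at the reticulation `t`: both passages end in a reticulation
      -- child of `h`, of which there is only one.
      back g (inj₁ (e′ , πt′ , πh′)) with refl ← shorter-loop (FirstHit.length≡ g) (FirstHit.before g) (sym πt′)
        with refl ← limit-ret-child-unique e e′ m
               (trans (marks-agree (FirstHit.h g) t (FirstHit.inside g) dt πh′) m)
        = shortcut (FirstHit.length≡ g) (FirstHit.after g)

  -- The radius is 1 + R because `reflects` lifts an arc of the ball of radius R to a child that may
  -- lie one step outside, and has to identify this child with a vertex of the ball.
  π-ball-injective : ∀ {x y} → Within R̂ (1 + R) ρ₀ x → Within R̂ (1 + R) ρ₀ y → π x ≡ π y → x ≡ y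
  π-ball-injective {x} {y} p q eq =
    let k , k≤ , w = fromWithin {1 + R} (ℕ.n≤1+n _) p
        l , l≤ , v = fromWithin {1 + R} (ℕ.n≤1+n _) q
    in π-walk-injective (<-wellFounded (k + l)) (inside-end z≤n w)
         (subst (k + l ≤_) (cong suc (ℕ.+-suc R R)) (ℕ.+-mono-≤ k≤ l≤)) (reverseʷ z≤n w ++ʷ v) eq

  -- Isomorphism of the balls

  lift-walk : ∀ {k x z} → depth x + k ≤ 1 + R → Within markedDigraph k (π x) z →
              ∃[ y ] Within R̂ k x y × π y ≡ z
  lift-walk {k} {x} d≤ here = x , here , refl
  lift-walk {suc k} {x} d≤ (step e p) with lift e
    where
    lift : ∀ {z} → SymClosure _⟶_ (π x) z → ∃[ y ] SymClosure _⟶̂_ x y × π y ≡ z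
    lift (fwd e) = let y , d , eq = lift-child x (s≤s (ℕ.≤-trans (ℕ.m≤m+n (depth x) (suc k)) d≤)) e in y , fwd d , eq
    lift (bwd e) = let y , d , eq = lift-parent x (s≤s (ℕ.≤-trans (ℕ.m≤m+n (depth x) (suc k)) d≤)) e in y , bwd d , eq
  ... | y , d , refl with lift-walk {k} {y} (ℕ.≤-trans (ℕ.+-monoˡ-≤ k (depth-step d)) (subst (_≤ 1 + R) (ℕ.+-suc (depth x) k) d≤)) p
  ...   | y′ , q , eq = y′ , step d q , eq

  Ball : Set
  Ball = RootedDigraph.Vertex (U R R̂ ρ₀)

  balls-isomorphic : U R R̂ ρ₀ ≅ U R markedDigraph r₀
  balls-isomorphic = record
    { bijection = mk↔ₛ′ to from to∘from from∘to
    ; to-base   = refl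
    ; to-mark   = λ { (x , [ p ]) → recompute (_ ≟ᵗ _) (π-mark x (inside p)) }
    ; to-edge   = λ { (x , [ p ]) (y , [ q ]) → mk⇔
        (λ e → recompute (Bool.T? _) (π-⟶ e (inside p) (inside q)))
        (λ e → recompute (LocallyFinite._⟶?_ R̂-locallyFinite x y) (reflects p q e)) }
    }
    where
    inside : ∀ {x} → Within R̂ R ρ₀ x → Inside x
    inside p = ℕ.≤-trans (depth-within p) (ℕ.≤-trans (ℕ.n≤1+n _) (ℕ.n≤1+n _))

    wider : ∀ {x} → Within R̂ R ρ₀ x → Within R̂ (1 + R) ρ₀ x
    wider = within-weaken (ℕ.n≤1+n R)

    reflects : ∀ {x y} → Within R̂ R ρ₀ x → Within R̂ R ρ₀ y → π x ⟶ π y → x ⟶̂ y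
    reflects {x} {y} p q e with lift-child x (s≤s (ℕ.≤-trans (depth-within p) (ℕ.n≤1+n R))) e
    ... | y′ , d , eq = subst (x ⟶̂_)
      (π-ball-injective (within-snoc p (fwd d)) (wider q) eq) d

    projected : ∀ {x} → Within R̂ R ρ₀ x → Near R (π x)
    projected = π-within (ℕ.≤-trans (ℕ.n≤1+n R) (ℕ.n≤1+n _))

    to : Ball → RootedDigraph.Vertex (U R markedDigraph r₀)
    to (x , [ p ]) = π x , [ projected p ]

    vertices : List Ball
    vertices = proj₁ (Finite.listing (U-finite R̂-locallyFinite R ρ₀))

    ∈-vertices : ∀ u → u ∈ vertices
    ∈-vertices = proj₂ (Finite.listing (U-finite R̂-locallyFinite R ρ₀))

    -- Membership in a ball is irrelevant, so that no lift can be extracted from it directly. The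
    -- preimage is found again by a search of the finite ball of the limit.
    preimage : ∀ z → .(Near R z) → Any (λ u → π (value u) ≡ z) vertices
    preimage z p = recompute (Any.any? (λ u → π (value u) Fin.≟ z) vertices) (found p)
      where
      found : Near R z → Any (λ u → π (value u) ≡ z) vertices
      found p = let x , q , eq = lift-walk (ℕ.n≤1+n R) p
                in Any.map (λ { refl → eq }) (∈-vertices (x , [ q ]))

    from : RootedDigraph.Vertex (U R markedDigraph r₀) → Ball
    from (z , [ p ]) = Any.lookup (preimage z p)

    π-from : ∀ z .p → π (value (from (z , [ p ]))) ≡ z
    π-from z p = Any.lookup-result (preimage z p)

    to∘from : ∀ z → to (from z) ≡ z
    to∘from (z , [ p ]) = value-injective (π-from z p)

    from∘to : ∀ x → from (to x) ≡ x
    from∘to (x , [ p ]) with from (to (x , [ p ])) | π-from (π x) (projected p)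
    ... | (y , [ q ]) | eq = value-injective (recompute (LocallyFinite._≟_ R̂-locallyFinite y x) (π-ball-injective (wider q) (wider p) eq))

-- Deviations of means

-- Recursive, so that compatibility with sums, products and order follows by induction; `reciprocal`
-- links it to the division in `mean`.
ι : ℕ → ℚ
ι zero    = 0ℚ
ι (suc k) = 1ℚ ℚ.+ ι k

module _ where
  open ℚ.+-*-Solver

  ι-+ : ∀ a b → ι (a + b) ≡ ι a ℚ.+ ι b
  ι-+ zero    b = sym (ℚ.+-identityˡ (ι b))
  ι-+ (suc a) b = trans (cong (1ℚ ℚ.+_) (ι-+ a b)) (sym (ℚ.+-assoc 1ℚ (ι a) (ι b)))

  ι-* : ∀ a b → ι (a * b) ≡ ι a ℚ.* ι b
  ι-* zero    b = sym (ℚ.*-zeroˡ (ι b))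
  ι-* (suc a) b = trans (ι-+ b (a * b)) (trans (cong (ι b ℚ.+_) (ι-* a b))
    (solve 2 (λ x y → y :+ x :* y := (con 1ℚ :+ x) :* y) refl (ι a) (ι b)))

  telescope : ∀ a s l c → (a ℚ.+ s) ℚ.- (1ℚ ℚ.+ l) ℚ.* c ≡ (a ℚ.- c) ℚ.+ (s ℚ.- l ℚ.* c)
  telescope = solve 4 (λ a s l c → (a :+ s) :- (con 1ℚ :+ l) :* c := (a :- c) :+ (s :- l :* c)) refl

  distribute : ∀ s i c l → (s ℚ.* i ℚ.- c) ℚ.* l ≡ s ℚ.* (i ℚ.* l) ℚ.- l ℚ.* c
  distribute = solve 4 (λ s i c l → (s :* i :- c) :* l := s :* (i :* l) :- l :* c) refl

  rearrange : ∀ a b c → (a ℚ.* b) ℚ.* c ≡ (a ℚ.* c) ℚ.* b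
  rearrange = solve 3 (λ a b c → (a :* b) :* c := (a :* c) :* b) refl

0≤ι : ∀ k → 0ℚ ℚ.≤ ι k
0≤ι zero    = ℚ.≤-refl
0≤ι (suc k) = ℚ.+-mono-≤ {0ℚ} {1ℚ} {0ℚ} {ι k} (ℚ.nonNegative⁻¹ 1ℚ) (0≤ι k)

ι-nonNeg : ∀ k → ℚ.NonNegative (ι k)
ι-nonNeg k = ℚ.nonNegative (0≤ι k)

ι-mono-≤ : ∀ {a b} → a ≤ b → ι a ℚ.≤ ι b
ι-mono-≤ {b = b} z≤n = 0≤ι b
ι-mono-≤ (s≤s a≤b)   = ℚ.+-monoʳ-≤ 1ℚ (ι-mono-≤ a≤b)

ι-mono-< : ∀ {a b} → a < b → ι a ℚ.< ι b
ι-mono-< {a} {suc b} (s≤s a≤b) = ℚ.<-≤-trans {ι a} {1ℚ ℚ.+ ι a}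
  (subst (ℚ._< 1ℚ ℚ.+ ι a) (ℚ.+-identityˡ (ι a)) (ℚ.+-monoˡ-< (ι a) {0ℚ} {1ℚ} (ℚ.positive⁻¹ 1ℚ)))
  (ℚ.+-monoʳ-≤ 1ℚ (ι-mono-≤ a≤b))

ι-pos : ∀ {k} → 0 < k → ℚ.Positive (ι k)
ι-pos 0<k = ℚ.positive (ι-mono-< 0<k)

toℚᵘ-ι : ∀ k → ℚ.toℚᵘ (ι k) ℚᵘ.≃ ℚᵘ.mkℚᵘ (ℤ.+ k) 0
toℚᵘ-ι zero    = ℚᵘ.≃-refl
toℚᵘ-ι (suc k) = ℚᵘ.≃-trans (ℚ.toℚᵘ-homo-+ 1ℚ (ι k))
  (ℚᵘ.≃-trans (ℚᵘ.+-cong (ℚᵘ.≃-refl {ℚᵘ.1ℚᵘ}) (toℚᵘ-ι k)) (ℚᵘ.*≡* (cong (ℤ._* ℤ.1ℤ) (cong (λ z → ℤ._+_ ℤ.1ℤ z) (ℤ.*-identityʳ (ℤ.+ k))))))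

reciprocal : ∀ m → (ℤ.+ 1 ℚ./ suc m) ℚ.* ι (suc m) ≡ 1ℚ
reciprocal m = ℚ.toℚᵘ-injective (ℚᵘ.≃-trans (ℚ.toℚᵘ-homo-* (ℤ.+ 1 ℚ./ suc m) (ι (suc m)))
  (ℚᵘ.≃-trans (ℚᵘ.*-cong (ℚ.toℚᵘ-fromℚᵘ (ℚᵘ.mkℚᵘ (ℤ.+ 1) m)) (toℚᵘ-ι (suc m)))
    (ℚᵘ.*≡* (trans (ℤ.*-identityʳ _) (trans (cong ℤ.+_ (ℕ.*-comm 1 (suc m))) (sym (ℤ.*-identityˡ _)))))))

archimedean : ∀ e → 0ℚ ℚ.< e → ∃[ Q ] 0 < Q × 1ℚ ℚ.≤ e ℚ.* ι Q
archimedean e@(ℚ.mkℚ (ℤ.+ zero) d _) (ℚ.*<* (ℤ.+<+ ()))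
archimedean e@(ℚ.mkℚ ℤ.-[1+ p ] d _) (ℚ.*<* ())
-- The denominator of `e` works, because the numerator is at least 1.
archimedean e@(ℚ.mkℚ ℤ.+[1+ p ] d _) _ = suc d , s≤s z≤n , ℚ.toℚᵘ-cancel-≤
  (ℚᵘ.≤-respʳ-≃ (ℚᵘ.≃-sym (ℚᵘ.≃-trans (ℚ.toℚᵘ-homo-* e (ι (suc d)))
    (ℚᵘ.*-cong (ℚᵘ.≃-refl {ℚ.toℚᵘ e}) (toℚᵘ-ι (suc d)))))
    (ℚᵘ.*≤* (ℤ.+≤+ bound)))
  where
  bound : 1 * (suc d * 1) ≤ (suc p * suc d) * 1
  bound = subst₂ _≤_ (sym (trans (ℕ.*-identityˡ _) (ℕ.*-identityʳ _))) (sym (ℕ.*-identityʳ _)) (ℕ.m≤m+n (suc d) (p * suc d))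

sumℚ : ∀ {A : Set} → List A → (A → ℚ) → ℚ
sumℚ xs f = List.foldr ℚ._+_ 0ℚ (List.map f xs)

sum-deviation : ∀ {A : Set} (xs : List A) (f : A → ℚ) c →
                ℚ.∣ sumℚ xs f ℚ.- ι (length xs) ℚ.* c ∣ ℚ.≤ sumℚ xs (λ x → ℚ.∣ f x ℚ.- c ∣)
sum-deviation [] f c = ℚ.≤-reflexive (cong (λ q → ℚ.∣ 0ℚ ℚ.- q ∣) (ℚ.*-zeroˡ c))
sum-deviation (x ∷ xs) f c = subst (λ q → ℚ.∣ q ∣ ℚ.≤ sumℚ (x ∷ xs) (λ x → ℚ.∣ f x ℚ.- c ∣)) (sym (telescope (f x) (sumℚ xs f) (ι (length xs)) c))
  (ℚ.≤-trans (ℚ.∣p+q∣≤∣p∣+∣q∣ (f x ℚ.- c) (sumℚ xs f ℚ.- ι (length xs) ℚ.* c))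
             (ℚ.+-monoʳ-≤ ℚ.∣ f x ℚ.- c ∣ (sum-deviation xs f c)))

mean-deviation : ∀ {A : Set} (xs : List A) (f : A → ℚ) c → 0 < length xs →
                 ℚ.∣ mean xs f ℚ.- c ∣ ℚ.* ι (length xs) ℚ.≤ sumℚ xs (λ x → ℚ.∣ f x ℚ.- c ∣)
mean-deviation (x ∷ xs) f c _ = subst (ℚ._≤ sumℚ (x ∷ xs) (λ x → ℚ.∣ f x ℚ.- c ∣)) scaled
  (sum-deviation (x ∷ xs) f c)
  where
  open ≡-Reasoning
  m = suc (length xs)
  s = sumℚ (x ∷ xs) f
  scaled : ℚ.∣ s ℚ.- ι m ℚ.* c ∣ ≡ ℚ.∣ s ℚ.* (ℤ.+ 1 ℚ./ m) ℚ.- c ∣ ℚ.* ι m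
  scaled = begin
    ℚ.∣ s ℚ.- ι m ℚ.* c ∣
      ≡⟨ cong (λ q → ℚ.∣ q ℚ.- ι m ℚ.* c ∣) (sym (trans (cong (s ℚ.*_) (reciprocal (length xs))) (ℚ.*-identityʳ s))) ⟩
    ℚ.∣ s ℚ.* ((ℤ.+ 1 ℚ./ m) ℚ.* ι m) ℚ.- ι m ℚ.* c ∣
      ≡⟨ cong ℚ.∣_∣ (distribute s (ℤ.+ 1 ℚ./ m) c (ι m)) ⟨
    ℚ.∣ (s ℚ.* (ℤ.+ 1 ℚ./ m) ℚ.- c) ℚ.* ι m ∣
      ≡⟨ ℚ.∣p*q∣≡∣p∣*∣q∣ (s ℚ.* (ℤ.+ 1 ℚ./ m) ℚ.- c) (ι m) ⟩
    ℚ.∣ s ℚ.* (ℤ.+ 1 ℚ./ m) ℚ.- c ∣ ℚ.* ℚ.∣ ι m ∣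
      ≡⟨ cong (ℚ.∣ s ℚ.* (ℤ.+ 1 ℚ./ m) ℚ.- c ∣ ℚ.*_) (ℚ.0≤p⇒∣p∣≡p (0≤ι m)) ⟩
    ℚ.∣ s ℚ.* (ℤ.+ 1 ℚ./ m) ℚ.- c ∣ ℚ.* ι m ∎

sumℚ-≤ : ∀ {A : Set} xs (f : A → ℚ) (g : A → ℕ) n → (∀ {x} → x ∈ xs → f x ℚ.* ι n ℚ.≤ ι (g x)) →
         sumℚ xs f ℚ.* ι n ℚ.≤ ι (total xs g)
sumℚ-≤ []       f g n f≤g = ℚ.≤-reflexive (ℚ.*-zeroˡ (ι n))
sumℚ-≤ (x ∷ xs) f g n f≤g = subst₂ ℚ._≤_ (sym (ℚ.*-distribʳ-+ (ι n) (f x) (sumℚ xs f))) (sym (ι-+ (g x) (total xs g)))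
  (ℚ.+-mono-≤ (f≤g (here refl)) (sumℚ-≤ xs f g n (f≤g ∘ there)))

mean-deviation-≤ : ∀ {A : Set} (xs : List A) (f : A → ℚ) c (g : A → ℕ) n → 0 < length xs →
                   (∀ {x} → x ∈ xs → ℚ.∣ f x ℚ.- c ∣ ℚ.* ι n ℚ.≤ ι (g x)) →
                   ℚ.∣ mean xs f ℚ.- c ∣ ℚ.* ι (length xs * n) ℚ.≤ ι (total xs g)
mean-deviation-≤ xs f c g n 0<m f≤g = ℚ.≤-trans
  (subst (ℚ._≤ sumℚ xs (λ x → ℚ.∣ f x ℚ.- c ∣) ℚ.* ι n)
    (trans (ℚ.*-assoc ℚ.∣ mean xs f ℚ.- c ∣ (ι (length xs)) (ι n)) (cong (ℚ.∣ mean xs f ℚ.- c ∣ ℚ.*_) (sym (ι-* (length xs) n))))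
    (ℚ.*-monoʳ-≤-nonNeg (ι n) {{ι-nonNeg n}} (mean-deviation xs f c 0<m)))
  (sumℚ-≤ xs (λ x → ℚ.∣ f x ℚ.- c ∣) g n f≤g)

-- Division-free form of: q ≤ b / m and b / m ≤ h / n give q ≤ h / n.
cancel-≤ : ∀ q m n b h → 0 < m → q ℚ.* ι m ℚ.≤ ι b → b * n ≤ m * h → q ℚ.* ι n ℚ.≤ ι h
cancel-≤ q m n b h 0<m q≤ bn≤ = ℚ.*-cancelʳ-≤-pos (ι m) {{ι-pos 0<m}} (begin
  (q ℚ.* ι n) ℚ.* ι m   ≡⟨ rearrange q (ι n) (ι m) ⟩
  (q ℚ.* ι m) ℚ.* ι n   ≤⟨ ℚ.*-monoʳ-≤-nonNeg (ι n) {{ι-nonNeg n}} q≤ ⟩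
  ι b ℚ.* ι n           ≡⟨ ι-* b n ⟨
  ι (b * n)             ≤⟨ ι-mono-≤ bn≤ ⟩
  ι (m * h)             ≡⟨ ι-* m h ⟩
  ι m ℚ.* ι h           ≡⟨ ℚ.*-comm (ι m) (ι h) ⟩
  ι h ℚ.* ι m           ∎)
  where open ℚ.≤-Reasoning

-- Division-free form of the chain q ≤ h / m < 1 / Q ≤ e.
cancel-< : ∀ q e m h Q → 0 < m → 0 < Q → 1ℚ ℚ.≤ e ℚ.* ι Q → q ℚ.* ι m ℚ.≤ ι h → Q * h < m → q ℚ.< e
cancel-< q e m h Q 0<m 0<Q 1≤eQ q≤ Qh<m = ℚ.*-cancelʳ-<-nonNeg (ι m) {{ι-nonNeg m}}
  (ℚ.*-cancelʳ-<-nonNeg (ι Q) {{ι-nonNeg Q}} (begin-strict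
    (q ℚ.* ι m) ℚ.* ι Q   ≤⟨ ℚ.*-monoʳ-≤-nonNeg (ι Q) {{ι-nonNeg Q}} q≤ ⟩
    ι h ℚ.* ι Q           ≡⟨ ι-* h Q ⟨
    ι (h * Q)             ≡⟨ cong ι (ℕ.*-comm h Q) ⟩
    ι (Q * h)             <⟨ ι-mono-< Qh<m ⟩
    ι m                   ≡⟨ ℚ.*-identityˡ (ι m) ⟨
    1ℚ ℚ.* ι m            ≤⟨ ℚ.*-monoʳ-≤-nonNeg (ι m) {{ι-nonNeg m}} 1≤eQ ⟩
    (e ℚ.* ι Q) ℚ.* ι m   ≡⟨ rearrange e (ι Q) (ι m) ⟩
    (e ℚ.* ι m) ℚ.* ι Q   ∎))
  where open ℚ.≤-Reasoning

-- Existence of networks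

smallest : Network 1
smallest = record { labelledDigraph = G ; isSimplexTreeChild = from-yes (isSimplexTreeChild? G) }
  where
  G : LabelledDigraph 1 2
  G = record
    { edge   = λ { zero (suc zero) → true ; _ _ → false }
    ; origin = zero
    ; mark   = λ { zero → root ; (suc zero) → leaf }
    ; taxon  = λ _ → suc zero }

-- A new root 0 is put above the old one, which gets a new leaf 1 as second child.
module Extend {n} (N : Network n) where
  open Network N
  open Structure N

  extended-edge : Fin (suc (suc size)) → Fin (suc (suc size)) → Bool
  extended-edge zero          (suc (suc v)) = does (v Fin.≟ origin)
  extended-edge (suc (suc u)) (suc zero)    = does (u Fin.≟ origin)
  extended-edge (suc (suc u)) (suc (suc v)) = edge u v
  extended-edge _             _             = false

  extended-mark : Fin (suc (suc size)) → VertexType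
  extended-mark zero          = root
  extended-mark (suc zero)    = leaf
  extended-mark (suc (suc v)) = if does (v Fin.≟ origin) then tree else mark v

  extended : LabelledDigraph (suc n) (suc (suc size))
  extended = record
    { edge = extended-edge ; origin = zero ; mark = extended-mark
    ; taxon = λ { zero → suc zero ; (suc i) → suc (suc (taxon i)) } }

  private module E = LabelledDigraph extended

  mark-origin : extended-mark (suc (suc origin)) ≡ tree
  mark-origin = cong (if_then tree else mark origin) (≟-refl origin)

  mark-other : ∀ {v} → v ≢ origin → extended-mark (suc (suc v)) ≡ mark v
  mark-other {v} v≢o = cong (if_then tree else mark v) (≟-≢ v≢o)

  ≢root⇒≢origin : ∀ {v} → mark v ≢ root → v ≢ origin
  ≢root⇒≢origin m refl = m origin-root

  mark-old : ∀ {v} → mark v ≢ root → extended-mark (suc (suc v)) ≡ mark v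
  mark-old m = mark-other (≢root⇒≢origin m)

  none : card (λ (v : Fin size) → false) ≡ 0
  none = card-false size

  typed′ : ∀ v → (E.indegree v , E.outdegree v) ≡ degrees (extended-mark v)
  typed′ zero = cong₂ _,_
    (trans (card-∷∷ (λ u → E.edge u zero)) none)
    (trans (card-∷∷ (E.edge zero)) (card-point origin))
  typed′ (suc zero) = cong₂ _,_
    (trans (card-∷∷ (λ u → E.edge u (suc zero))) (card-point origin))
    (trans (card-∷∷ (E.edge (suc zero))) none)
  typed′ (suc (suc v)) = trans (cong₂ _,_ (card-∷∷ (λ u → E.edge u (suc (suc v)))) (card-∷∷ (E.edge (suc (suc v)))))
    (by-cases (v Fin.≟ origin))
    where
    by-cases : Dec (v ≡ origin) →
               (χ (does (v Fin.≟ origin)) + indegree v , χ (does (v Fin.≟ origin)) + outdegree v)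
               ≡ degrees (extended-mark (suc (suc v)))
    by-cases (yes refl) = trans
      (cong₂ _,_ (cong₂ _+_ (cong χ (≟-refl origin)) (cong proj₁ d)) (cong₂ _+_ (cong χ (≟-refl origin)) (cong proj₂ d)))
      (sym (cong degrees mark-origin))
      where d = trans (typed origin) (cong degrees origin-root)
    by-cases (no v≢o) = trans
      (cong₂ _,_ (cong (λ b → χ b + indegree v) (≟-≢ v≢o)) (cong (λ b → χ b + outdegree v) (≟-≢ v≢o)))
      (trans (typed v) (sym (cong degrees (mark-other v≢o))))

  acc-leaf : Acc (flip E._⟶_) (suc zero)
  acc-leaf = acc λ { {zero} () ; {suc zero} () ; {suc (suc _)} () }

  acc-old : ∀ v → Acc (flip _⟶_) v → Acc (flip E._⟶_) (suc (suc v))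
  acc-old v (acc rs) = acc λ
    { {zero} ()
    ; {suc zero} _ → acc-leaf
    ; {suc (suc w)} e → acc-old w (rs e) }

  noetherian : WellFounded (flip E._⟶_)
  noetherian zero          = acc λ { {zero} () ; {suc zero} () ; {suc (suc v)} _ → acc-old v (descending v) }
  noetherian (suc zero)    = acc-leaf
  noetherian (suc (suc v)) = acc-old v (descending v)

  unmark : ∀ {v t} → t ≢ tree → extended-mark (suc (suc v)) ≡ t → v ≢ origin × mark v ≡ t
  unmark {v} t≢tree m = v≢o , trans (sym (mark-other v≢o)) m
    where
    v≢o : v ≢ origin
    v≢o refl = t≢tree (trans (sym m) mark-origin)

  network : Network (suc n)
  network = record
    { labelledDigraph = extended
    ; isSimplexTreeChild = IsAcyclicTyped.isSimplexTreeChild record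
        { typed            = typed′
        ; origin-root      = refl
        ; root-unique      = λ
            { zero _ → refl
            ; (suc (suc v)) m → let v≢o , m′ = unmark (λ ()) m in contradiction (root-unique v m′) v≢o }
        ; noetherian       = noetherian
        ; taxon-leaf       = λ
            { zero → refl
            ; (suc i) → trans (mark-old (λ m → contradiction (trans (sym m) (taxon-leaf i)) λ ())) (taxon-leaf i) }
        ; taxon-injective  = λ
            { zero zero _ → refl
            ; (suc i) (suc j) eq → cong suc (taxon-injective i j (Fin.suc-injective (Fin.suc-injective eq))) }
        ; taxon-surjective = λ
            { (suc zero) _ → zero , refl
            ; (suc (suc v)) m → let i , eq = taxon-surjective v (proj₂ (unmark (λ ()) m))
                                in suc i , cong (λ x → suc (suc x)) eq }
        ; tree-child       = λ
            { zero _ → suc (suc origin) , subst T (sym (≟-refl origin)) _ , inj₁ mark-origin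
            ; (suc zero) m → contradiction refl m
            ; (suc (suc v)) m → tree-child-old v m }
        ; one-component    = λ
            { (suc (suc u)) (suc zero) m e → refl
            ; (suc (suc u)) (suc (suc w)) m e →
                let mw = one-component u w (proj₂ (unmark (λ ()) m)) e
                in trans (mark-old (λ m′ → contradiction (trans (sym mw) m′) λ ())) mw }
        }
    }
    where
    tree-child-old : ∀ v → extended-mark (suc (suc v)) ≢ leaf →
                     ∃[ w ] suc (suc v) E.⟶ w × (extended-mark w ≡ tree ⊎ extended-mark w ≡ leaf)
    tree-child-old v m with mark v ≟ᵗ leaf
    ... | yes l = contradiction (trans (mark-old (λ r → contradiction (trans (sym r) l) λ ())) l) m
    ... | no ¬l with tree-child v ¬l
    ...   | w , e , inj₁ t = suc (suc w) , e , inj₁ (trans (mark-old (λ r → contradiction (trans (sym r) t) λ ())) t)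
    ...   | w , e , inj₂ l = suc (suc w) , e , inj₂ (trans (mark-old (λ r → contradiction (trans (sym r) l) λ ())) l)

someNetwork : ∀ n → Network (suc n)
someNetwork zero    = smallest
someNetwork (suc n) = Extend.network (someNetwork n)

-- On an empty list `mean` has a conventional value, about which the deviation estimates say
-- nothing.
list-nonempty : ∀ {n} (𝓛 : NetworkList (suc n)) → 0 < length (NetworkList.list 𝓛)
list-nonempty {n} 𝓛 with NetworkList.list 𝓛 | NetworkList.complete 𝓛 (someNetwork n)
... | _ ∷ _ | _ = s≤s z≤n

-- Expected defects and the limit

≅-sym : ∀ {G H} → G ≅ H → H ≅ G
≅-sym {G} {H} f = record
  { bijection = mk↔ₛ′ from to strictlyInverseʳ strictlyInverseˡ
  ; to-base   = trans (cong from (sym to-base)) (strictlyInverseʳ _)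
  ; to-mark   = λ v → trans (sym (to-mark (from v))) (cong (RootedDigraph.mark H) (strictlyInverseˡ v))
  ; to-edge   = λ u v → mk⇔
      (λ e → Equivalence.from (to-edge (from u) (from v))
               (subst₂ (RootedDigraph._⟶_ H) (sym (strictlyInverseˡ u)) (sym (strictlyInverseˡ v)) e))
      (λ e → subst₂ (RootedDigraph._⟶_ H) (strictlyInverseˡ u) (strictlyInverseˡ v)
               (Equivalence.to (to-edge (from u) (from v)) e))
  }
  where
  open _≅_ f
  open Inverse bijection using (strictlyInverseˡ; strictlyInverseʳ)

≅-trans : ∀ {G H K} → G ≅ H → H ≅ K → G ≅ K
≅-trans f g = record
  { bijection = g.bijection Composition.↔-∘ f.bijection
  ; to-base   = trans (cong g.to f.to-base) g.to-base
  ; to-mark   = λ v → trans (g.to-mark (f.to v)) (f.to-mark v)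
  ; to-edge   = λ u v → mk⇔ (Equivalence.to (g.to-edge _ _) ∘ Equivalence.to (f.to-edge u v))
                            (Equivalence.from (f.to-edge u v) ∘ Equivalence.from (g.to-edge _ _))
  }
  where
  module f = _≅_ f
  module g = _≅_ g

indicator-cong : ∀ {P Q : Set} (P? : Dec P) (Q? : Dec Q) → (P → Q) → (Q → P) → indicator P? ≡ indicator Q?
indicator-cong (yes _) (yes _) _ _ = refl
indicator-cong (no _)  (no _)  _ _ = refl
indicator-cong (yes p) (no ¬q) f _ = contradiction (f p) ¬q
indicator-cong (no ¬p) (yes q) _ g = contradiction (g q) ¬p

indicators-close : ∀ {P Q : Set} (P? : Dec P) (Q? : Dec Q) → ℚ.∣ indicator P? ℚ.- indicator Q? ∣ ℚ.≤ 1ℚ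
indicators-close (yes _) (yes _) = ℚ.nonNegative⁻¹ 1ℚ
indicators-close (no _)  (no _)  = ℚ.nonNegative⁻¹ 1ℚ
indicators-close (yes _) (no _)  = ℚ.≤-refl
indicators-close (no _)  (yes _) = ℚ.≤-refl

total-χ : ∀ {A : Set} {P : A → Set} (P? : Decidable P) xs → total xs (χ ∘ does ∘ P?) ≡ length (filter P? xs)
total-χ P? [] = refl
total-χ P? (x ∷ xs) with does (P? x)
... | true  = cong suc (total-χ P? xs)
... | false = total-χ P? xs

choices-cases : ∀ {n} (N : Network n) v →
                (length (reticulations N) ≡ 0 × choices N v ≡ v ∷ [])
                ⊎ (0 < length (reticulations N) × choices N v ≡ reticulations N)
choices-cases N v with reticulations N
... | []     = inj₁ (refl , refl)
... | r ∷ rs = inj₂ (s≤s z≤n , refl)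

module Neighbourhoods {n} (N : Network n) (R : ℕ) where
  open Network N
  open Counts N
  open Balls N
  open Rewire (R + R) N using (cycleArcs; L)
  open DecMembership (Fin._≟_ {size}) using (_∈?_)

  -- As distance is symmetric, the reticulations with a defect nearby are counted from the defects:
  -- an arc on a short cycle is represented by its tail.
  troubled : List (Fin size)
  troubled = concatMap (ball (2 + R)) (irregular ++ List.map proj₁ cycleArcs)

  length-troubled : length troubled ≤ (J + J + length cycleArcs) * ballSize (2 + R)
  length-troubled = begin
    length troubled
      ≡⟨ length-concatMap (ball (2 + R)) centres ⟩
    total centres (length ∘ ball (2 + R))
      ≤⟨ total-≤ centres (λ {v} _ → length-ball (2 + R) v) ⟩
    length centres * ballSize (2 + R)
      ≡⟨ cong (_* ballSize (2 + R)) (trans (length-++ irregular) (cong₂ _+_ length-irregular (length-map proj₁ cycleArcs))) ⟩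
    (J + J + length cycleArcs) * ballSize (2 + R) ∎
    where
    open ℕ.≤-Reasoning
    centres = irregular ++ List.map proj₁ cycleArcs

  ∈-troubled : ∀ {r v} → Within markedDigraph (2 + R) r v → v ∈ irregular ++ List.map proj₁ cycleArcs → r ∈ troubled
  ∈-troubled p v∈ = ∈-concatMap⁺ (ball (2 + R)) (Any.map (λ { refl → ∈-ball (within-sym p) }) v∈)

  untroubled : ∀ {r} → mark r ≡ reticulation → r ∉ troubled → U R R̂ ρ₀ ≅ U R markedDigraph r
  untroubled {r} m r∉ = Cover.balls-isomorphic N R r m
    (λ p z∈ → r∉ (∈-troubled p (∈-++⁺ˡ z∈)))
    (λ p e m′ c → r∉ (∈-troubled p (∈-++⁺ʳ irregular
      (∈-map⁺ proj₁ (∈-filter⁺ (onCycle? N L) (∈-retArcs {N = N} e m′) c)))))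

  -- The first summand bounds the number of troubled reticulations. The second pays for dividing by
  -- n instead of k = n - J, and it covers networks without reticulations, where J = n.
  defect : ℕ
  defect = (J + J + length cycleArcs) * ballSize (2 + R) + J

  module _ (G : FiniteRootedDigraph) where
    limit : ℚ
    limit = dirac R̂-locallyFinite ρ₀ R G

    at : Fin size → ℚ
    at r = indicator (U≅? (network-locallyFinite N) R r G)

    at-close : ∀ r → ℚ.∣ at r ℚ.- limit ∣ ℚ.≤ 1ℚ
    at-close r = indicators-close (U≅? (network-locallyFinite N) R r G) (U≅? R̂-locallyFinite R ρ₀ G)

    at-limit : ∀ {r} → mark r ≡ reticulation → r ∉ troubled → at r ≡ limit
    at-limit {r} m r∉ = indicator-cong (U≅? (network-locallyFinite N) R r G) (U≅? R̂-locallyFinite R ρ₀ G)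
      (≅-trans (untroubled m r∉)) (≅-trans (≅-sym (untroubled m r∉)))

    deviation : ∀ {r} → mark r ≡ reticulation → ℚ.∣ at r ℚ.- limit ∣ ℚ.* ι 1 ℚ.≤ ι (χ (does (r ∈? troubled)))
    deviation {r} m = by-cases (r ∈? troubled)
      where
      by-cases : (d : Dec (r ∈ troubled)) → ℚ.∣ at r ℚ.- limit ∣ ℚ.* ι 1 ℚ.≤ ι (χ (does d))
      by-cases (yes _) = subst (ℚ._≤ ι 1) (sym (ℚ.*-identityʳ _)) (at-close r)
      by-cases (no r∉) = ℚ.≤-reflexive (trans (cong (λ q → ℚ.∣ q ℚ.- limit ∣ ℚ.* ι 1) (at-limit m r∉))
        (trans (cong (λ q → ℚ.∣ q ∣ ℚ.* ι 1) (ℚ.+-inverseʳ limit)) (ℚ.*-zeroˡ (ι 1))))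

    mean-at : ∀ v → ℚ.∣ mean (choices N v) at ℚ.- limit ∣ ℚ.* ι n ℚ.≤ ι defect
    mean-at v with choices-cases N v
    ... | inj₁ (k≡0 , eq) = subst (λ xs → ℚ.∣ mean xs at ℚ.- limit ∣ ℚ.* ι n ℚ.≤ ι defect) (sym eq)
      (cancel-≤ (ℚ.∣ mean (v ∷ []) at ℚ.- limit ∣) 1 n 1 defect (s≤s z≤n)
        (mean-deviation-≤ (v ∷ []) at limit (λ _ → 1) 1 (s≤s z≤n)
          λ {x} _ → subst (ℚ._≤ ι 1) (sym (ℚ.*-identityʳ _)) (at-close x))
        (ℕ.*-monoʳ-≤ 1 (subst (_≤ defect) (trans (cong (_+ J) (sym k≡0)) k+J≡n) (ℕ.m≤n+m J _))))
    ... | inj₂ (0<k , eq) = subst (λ xs → ℚ.∣ mean xs at ℚ.- limit ∣ ℚ.* ι n ℚ.≤ ι defect) (sym eq)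
      (cancel-≤ (ℚ.∣ mean rets at ℚ.- limit ∣) k n b defect 0<k
        (subst (λ m → ℚ.∣ mean rets at ℚ.- limit ∣ ℚ.* ι m ℚ.≤ ι b) (ℕ.*-identityʳ k)
          (mean-deviation-≤ rets at limit (χ ∘ does ∘ (_∈? troubled)) 1 0<k (λ r∈ → deviation (withMark⁻ r∈))))
        bound)
      where
      b : ℕ
      b = total rets (χ ∘ does ∘ (_∈? troubled))
      b≡ : b ≡ length (filter (_∈? troubled) rets)
      b≡ = total-χ (_∈? troubled) rets
      b≤k : b ≤ k
      b≤k = subst (_≤ k) (sym b≡) (length-filter (_∈? troubled) rets)
      near = (J + J + length cycleArcs) * ballSize (2 + R)
      b≤near : b ≤ near
      b≤near = subst (_≤ near) (sym b≡) (ℕ.≤-trans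
        (⊆-length (Unique.filter⁺ (_∈? troubled) (withMark-unique reticulation))
          λ r∈ → proj₂ (∈-filter⁻ (_∈? troubled) {xs = rets} r∈))
        length-troubled)
      -- From b ≤ near and b ≤ k follows b (k + J) ≤ k (near + J), i.e. the proportion b / k is at
      -- most `defect` / n.
      bound : b * n ≤ k * defect
      bound = begin
        b * n             ≡⟨ cong (b *_) k+J≡n ⟨
        b * (k + J)       ≡⟨ ℕ.*-distribˡ-+ b k J ⟩
        b * k + b * J     ≤⟨ ℕ.+-mono-≤ (ℕ.*-monoˡ-≤ k b≤near) (ℕ.*-monoˡ-≤ J b≤k) ⟩
        near * k + k * J     ≡⟨ cong (_+ k * J) (ℕ.*-comm near k) ⟩
        k * near + k * J     ≡⟨ ℕ.*-distribˡ-+ k near J ⟨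
        k * (near + J)       ∎
        where open ℕ.≤-Reasoning

-- Averages over all networks

module Bounds (n′ R : ℕ) (𝓛 : NetworkList (suc (suc n′))) where
  open NetworkList 𝓛 using () renaming (list to nets)
  open ℕ.≤-Reasoning
  open +-*-Solver

  n count A B : ℕ
  n     = suc (suc n′)
  count = length nets
  A     = ballSize (2 + R)
  B     = ballSize (2 + (R + R))

  J cycles : Network n → ℕ
  J N      = Counts.J N
  cycles N = length (Rewire.cycleArcs (R + R) N)

  k≤n : ∀ (N : Network n) → Counts.k N ≤ n
  k≤n N = subst (Counts.k N ≤_) (Counts.k+J≡n N) (ℕ.m≤m+n _ _)

  total-directs : total nets (length ∘ directs) ≤ count * 4
  total-directs = ℕ.*-cancelʳ-≤ _ _ n (begin
    -- n ≤ 2 (n - 1), as n is at least 2; n - 1 is the guaranteed number of tree vertices.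
    D * n                                        ≤⟨ ℕ.*-monoʳ-≤ D (s≤s (s≤s (ℕ.m≤m+n n′ _))) ⟩
    D * (2 + (n′ + n′))                          ≡⟨ solve 2 (λ d m → d :* (con 2 :+ (m :+ m)) := (d :* (con 1 :+ m)) :* con 2) refl D n′ ⟩
    (D * suc n′) * 2                             ≡⟨ cong (_* 2) (total-* nets (length ∘ directs) (suc n′)) ⟨
    total nets (λ N → length (directs N) * suc n′) * 2
      ≤⟨ ℕ.*-monoˡ-≤ 2 (total-mono nets λ {N} _ → ℕ.*-monoʳ-≤ (length (directs N)) (many-trees N)) ⟩
    total nets (λ N → length (directs N) * length (trees N)) * 2
      ≤⟨ ℕ.*-monoˡ-≤ 2 (total-direct 𝓛) ⟩
    total nets (length ∘ retArcs) * 2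
      ≤⟨ ℕ.*-monoˡ-≤ 2 (total-≤ nets λ {N} _ → ℕ.≤-trans (ℕ.≤-reflexive (Counts.length-retArcs N)) (ℕ.*-monoˡ-≤ 2 (k≤n N))) ⟩
    count * (n * 2) * 2                          ≡⟨ solve 2 (λ c n → c :* (n :* con 2) :* con 2 := c :* con 4 :* n) refl count n ⟩
    count * 4 * n                                ∎)
    where
    D = total nets (length ∘ directs)
    many-trees : ∀ N → suc n′ ≤ length (trees N)
    many-trees N = ℕ.s≤s⁻¹ (subst (n ≤_) (sym (Counts.tree-count N)) (ℕ.m≤n+m n (Counts.k N)))

  -- 64 = 4 · 2 · 8: on average at most 4 direct leaves, for each at most 2 candidates for the
  -- parent, and at most 8 n arcs.
  total-J² : total nets (λ N → J N * (J N ∸ 2)) ≤ count * (64 * n)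
  total-J² = begin
    total nets (λ N → J N * (J N ∸ 2))
      ≤⟨ total-mono nets (λ {N} _ → subst (λ j → J N * (j ∸ 2) ≤ length (Regraft.regrafts N)) (Counts.1+branchings≡J N) (Regraft.length-regrafts N)) ⟩
    total nets (λ N → length (Regraft.regrafts N))     ≤⟨ total-regrafts 𝓛 ⟩
    total nets (λ N → length (regraftMarks N))         ≤⟨ total-mono nets (λ {N} _ → length-regraftMarks N) ⟩
    total nets (λ N → length (directs N) * 2 * (n * 8)) ≡⟨ total-* nets (λ N → length (directs N) * 2) (n * 8) ⟩
    total nets (λ N → length (directs N) * 2) * (n * 8) ≡⟨ cong (_* (n * 8)) (total-* nets (length ∘ directs) 2) ⟩
    total nets (length ∘ directs) * 2 * (n * 8)        ≤⟨ ℕ.*-monoˡ-≤ (n * 8) (ℕ.*-monoˡ-≤ 2 total-directs) ⟩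
    count * 4 * 2 * (n * 8)                            ≡⟨ solve 2 (λ c n → c :* con 4 :* con 2 :* (n :* con 8) := c :* (con 64 :* n)) refl count n ⟩
    count * (64 * n)                                   ∎

  -- Truncation at 2 + M: above it M ≤ j - 2, below it j M is at most a constant. This linearises
  -- the second moment: the mean of J is at most 64 n / M + 2 + M, where M is free.
  M*j≤ : ∀ M j → j * M ≤ j * (j ∸ 2) + M * (2 + M)
  M*j≤ M j with ℕ.≤-total j (2 + M)
  ... | inj₁ j≤ = ℕ.≤-trans (ℕ.*-monoˡ-≤ M j≤) (ℕ.≤-trans (ℕ.≤-reflexive (ℕ.*-comm (2 + M) M)) (ℕ.m≤n+m _ _))
  ... | inj₂ ≤j = ℕ.≤-trans (ℕ.*-monoʳ-≤ j (ℕ.∸-monoˡ-≤ 2 ≤j)) (ℕ.m≤m+n _ _)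

  total-J : ∀ M → total nets J * M ≤ count * (64 * n + M * (2 + M))
  total-J M = begin
    total nets J * M                          ≡⟨ total-* nets J M ⟨
    total nets (λ N → J N * M)                ≤⟨ total-mono nets (λ {N} _ → M*j≤ M (J N)) ⟩
    total nets (λ N → J N * (J N ∸ 2) + M * (2 + M)) ≡⟨ total-+ nets (λ N → J N * (J N ∸ 2)) (λ _ → M * (2 + M)) ⟩
    total nets (λ N → J N * (J N ∸ 2)) + total nets (λ _ → M * (2 + M))
      ≤⟨ ℕ.+-mono-≤ total-J² (ℕ.≤-reflexive (total-const nets (M * (2 + M)))) ⟩
    count * (64 * n) + count * (M * (2 + M))  ≡⟨ ℕ.*-distribˡ-+ count (64 * n) (M * (2 + M)) ⟨
    count * (64 * n + M * (2 + M))            ∎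

  -- Only 2 k - B far arcs are guaranteed, which falls short of n by at most B + J. On this
  -- shortfall the number of cycle arcs is replaced by the crude bound 2 n.
  cycles*n≤ : ∀ N → cycles N * n ≤ cycles N * (Counts.k N * 2 ∸ B) + (B + J N) * (n * 2)
  cycles*n≤ N = begin
    c * n                            ≤⟨ ℕ.*-monoʳ-≤ c n≤ ⟩
    c * ((k * 2 ∸ B) + (B + J N))    ≡⟨ ℕ.*-distribˡ-+ c (k * 2 ∸ B) (B + J N) ⟩
    c * (k * 2 ∸ B) + c * (B + J N)  ≤⟨ ℕ.+-monoʳ-≤ (c * (k * 2 ∸ B)) (ℕ.*-monoˡ-≤ (B + J N) c≤) ⟩
    c * (k * 2 ∸ B) + n * 2 * (B + J N) ≡⟨ cong (c * (k * 2 ∸ B) +_) (ℕ.*-comm (n * 2) (B + J N)) ⟩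
    c * (k * 2 ∸ B) + (B + J N) * (n * 2) ∎
    where
    k = Counts.k N
    c = cycles N
    c≤ : c ≤ n * 2
    c≤ = ℕ.≤-trans (length-filter (onCycle? N (2 + (R + R))) (retArcs N))
      (ℕ.≤-trans (ℕ.≤-reflexive (Counts.length-retArcs N)) (ℕ.*-monoˡ-≤ 2 (k≤n N)))
    n≤ : n ≤ (k * 2 ∸ B) + (B + J N)
    n≤ = begin
      n                          ≡⟨ Counts.k+J≡n N ⟨
      k + J N                    ≤⟨ ℕ.+-monoˡ-≤ (J N) (ℕ.m≤m*n k 2) ⟩
      k * 2 + J N                ≤⟨ ℕ.+-monoˡ-≤ (J N) (ℕ.m≤n+m∸n (k * 2) B) ⟩
      B + (k * 2 ∸ B) + J N      ≡⟨ solve 3 (λ b k j → b :+ k :+ j := k :+ (b :+ j)) refl B (k * 2 ∸ B) (J N) ⟩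
      (k * 2 ∸ B) + (B + J N)    ∎

  -- 18 = 4 · 4 + 2: the marks of a rewiring contribute 4 · 4, and the summand B of the shortfall 2.
  total-cycles : total nets cycles ≤ count * (18 * B) + total nets J * 2
  total-cycles = ℕ.*-cancelʳ-≤ _ _ n (begin
    total nets cycles * n              ≡⟨ total-* nets cycles n ⟨
    total nets (λ N → cycles N * n)    ≤⟨ total-mono nets (λ {N} _ → cycles*n≤ N) ⟩
    total nets (λ N → cycles N * (Counts.k N * 2 ∸ B) + (B + J N) * (n * 2))
      ≡⟨ total-+ nets (λ N → cycles N * (Counts.k N * 2 ∸ B)) (λ N → (B + J N) * (n * 2)) ⟩
    total nets (λ N → cycles N * (Counts.k N * 2 ∸ B)) + total nets (λ N → (B + J N) * (n * 2))
      ≤⟨ ℕ.+-mono-≤ rewirings (ℕ.≤-reflexive (trans (total-* nets (λ N → B + J N) (n * 2))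
           (cong (_* (n * 2)) (trans (total-+ nets (λ _ → B) J) (cong (_+ total nets J) (total-const nets B)))))) ⟩
    count * (n * 4 * B * 4) + (count * B + total nets J) * (n * 2)
      ≡⟨ solve 4 (λ c n b j → c :* (n :* con 4 :* b :* con 4) :+ (c :* b :+ j) :* (n :* con 2)
                              := (c :* (con 18 :* b) :+ j :* con 2) :* n) refl count n B (total nets J) ⟩
    (count * (18 * B) + total nets J * 2) * n ∎)
    where
    rewirings : total nets (λ N → cycles N * (Counts.k N * 2 ∸ B)) ≤ count * (n * 4 * B * 4)
    rewirings = begin
      total nets (λ N → cycles N * (Counts.k N * 2 ∸ B)) ≤⟨ total-mono nets (λ {N} _ → Rewire.length-rewirings (R + R) N) ⟩
      total nets (λ N → length (Rewire.rewirings (R + R) N)) ≤⟨ total-rewirings (R + R) 𝓛 ⟩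
      total nets (λ N → length (rewireMarks (R + R) N)) ≤⟨ total-≤ nets (λ {N} _ → length-rewireMarks (R + R) N) ⟩
      count * (n * 4 * B * 4) ∎

  defects : ℕ
  defects = total nets (λ N → Neighbourhoods.defect N R)

  -- J occurs four times with the factor A, twice from the irregular vertices and twice from
  -- `total-cycles`, and once on its own.
  defects≤ : defects ≤ total nets J * (4 * A + 1) + count * (18 * A * B)
  defects≤ = begin
    defects
      ≡⟨ total-+ nets (λ N → (J N + J N + cycles N) * A) J ⟩
    total nets (λ N → (J N + J N + cycles N) * A) + j
      ≡⟨ cong (_+ j) (trans (total-* nets (λ N → J N + J N + cycles N) A) (cong (_* A)
           (trans (total-+ nets (λ N → J N + J N) cycles) (cong (_+ total nets cycles) (total-+ nets J J))))) ⟩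
    (j + j + total nets cycles) * A + j
      ≤⟨ ℕ.+-monoˡ-≤ j (ℕ.*-monoˡ-≤ A (ℕ.+-monoʳ-≤ (j + j) total-cycles)) ⟩
    (j + j + (count * (18 * B) + j * 2)) * A + j
      ≡⟨ solve 4 (λ j c a b → (j :+ j :+ (c :* (con 18 :* b) :+ j :* con 2)) :* a :+ j
                              := j :* (con 4 :* a :+ con 1) :+ c :* (con 18 :* a :* b)) refl j count A B ⟩
    j * (4 * A + 1) + count * (18 * A * B) ∎
    where j = total nets J

module Threshold (R Q : ℕ) where
  A B K M threshold : ℕ
  A = ballSize (2 + R)
  B = ballSize (2 + (R + R))
  K = Q * (4 * A + 1)
  -- Per network, the left side of the final comparison grows like 64 K n and the right side is M n,
  -- so that one n is left over to beat the constant `threshold`.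
  M = suc (K * 64)
  threshold = K * (M * (2 + M)) + Q * (18 * A * B) * M

  few-defects : ∀ n′ (𝓛 : NetworkList (suc (suc n′))) → threshold < suc (suc n′) →
                Q * Bounds.defects n′ R 𝓛 < length (NetworkList.list 𝓛) * suc (suc n′)
  few-defects n′ 𝓛 t<n = ℕ.*-cancelʳ-< M _ _ (begin-strict
    Q * defects * M
      ≤⟨ ℕ.*-monoˡ-≤ M (ℕ.*-monoʳ-≤ Q defects≤) ⟩
    Q * (j * (4 * A + 1) + count * (18 * A * B)) * M
      ≡⟨ solve 6 (λ q j a c e m → q :* (j :* a :+ c :* e) :* m := q :* a :* (j :* m) :+ c :* (q :* e :* m))
               refl Q j (4 * A + 1) count (18 * A * B) M ⟩
    K * (j * M) + count * (Q * (18 * A * B) * M)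
      ≤⟨ ℕ.+-monoˡ-≤ _ (ℕ.*-monoʳ-≤ K (total-J M)) ⟩
    K * (count * (64 * n + M * (2 + M))) + count * (Q * (18 * A * B) * M)
      ≡⟨ solve 5 (λ k c n m e → k :* (c :* (con 64 :* n :+ m)) :+ c :* e := c :* (k :* con 64 :* n :+ (k :* m :+ e)))
               refl K count n (M * (2 + M)) (Q * (18 * A * B) * M) ⟩
    count * (K * 64 * n + threshold)
      <⟨ ℕ.*-monoʳ-< count {{ℕ.>-nonZero (list-nonempty 𝓛)}} (ℕ.+-monoʳ-< (K * 64 * n) t<n) ⟩
    count * (K * 64 * n + n)
      ≡⟨ solve 3 (λ c k n → c :* (k :* n :+ n) := c :* n :* (con 1 :+ k)) refl count (K * 64) n ⟩
    count * n * M ∎)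
    where
    open Bounds n′ R 𝓛 hiding (A; B)
    open ℕ.≤-Reasoning
    open +-*-Solver
    j = total (NetworkList.list 𝓛) J

theorem1p8 : (𝓝 : ∀ n → NetworkList n)
    (arbitrary : ∀ n (N : Network n) → Fin (Network.size N)) →
    (λ n → networkLaw (𝓝 n) (arbitrary n)) ⟶ᵈ dirac R̂-locallyFinite ρ₀
theorem1p8 𝓝 arbitrary R G e 0<e =
  -- The summand 2 supplies the two taxa that `Bounds` presupposes.
  let Q , 0<Q , 1≤eQ = archimedean e 0<e in 2 + Threshold.threshold R Q , close Q 0<Q 1≤eQ
  where
  close : ∀ Q → 0 < Q → 1ℚ ℚ.≤ e ℚ.* ι Q → ∀ n → 2 + Threshold.threshold R Q ≤ n →
          ℚ.∣ networkLaw (𝓝 n) (arbitrary n) R G ℚ.- dirac R̂-locallyFinite ρ₀ R G ∣ ℚ.< e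
  close Q 0<Q 1≤eQ (suc (suc n′)) (s≤s (s≤s t≤n′)) =
    cancel-< _ e (length nets * n) (Bounds.defects n′ R (𝓝 n)) Q
      (ℕ.*-mono-≤ (list-nonempty (𝓝 n)) (s≤s (z≤n {suc n′}))) 0<Q 1≤eQ
      (mean-deviation-≤ nets _ (dirac R̂-locallyFinite ρ₀ R G) (λ N → Neighbourhoods.defect N R) n
        (list-nonempty (𝓝 n)) (λ {N} _ → Neighbourhoods.mean-at N R G (arbitrary n N)))
      (Threshold.few-defects R Q n′ (𝓝 n) (s≤s (ℕ.m≤n⇒m≤1+n t≤n′)))
    where
    n    = suc (suc n′)
    nets = NetworkList.list (𝓝 n)
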